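{- Let $\ell \geq 4$ be a fixed integer. Then for every sufficiently large integer $n$, \[ \left(4^{\ell+1} z_{\ell,\ell} (1+o(1)) \right)^{ -1} \leq \mathbf{d}(Q_n, C_{2 \ell}, C_6) \leq 0.36577. \]
   Context: $Q_n$ denotes the $n$-dimensional hypercube: its vertices are the binary vectors of length $n$, two vectors being adjacent iff they differ in exactly one coordinate (the flip coordinate of the edge). $C_m$ is the cycle on $m$ vertices. For graphs $G$ and $T$, a copy of $T$ in $G$ is a subgraph of $G$ isomorphic to $T$, and $N(G,T)$ is the number of copies of $T$ in $G$. A graph is $H$-free if it has no subgraph isomorphic to $H$. For subgraphs $T,H$ of $G$, $\mathrm{ex}(G,T,H)=\max\{N(G',T): G'\subseteq G,\ G' \text{ is } H\text{ -free}\}$ and $\mathbf{d}(G,T,H)=\mathrm{ex}(G,T,H)/N(G,T)$. For integers $k,\ell$, $z_{k,\ell}$ denotes the number of copies of $C_{2\ell}$ in $Q_k$ whose edges together use all $k$ coordinates as flip coordinates. The term $o(1)$ denotes a nonnegative quantity tending to $0$ as $n\to\infty$ with $\ell$ fixed. -}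

module Defs where

open import Data.Bool using (Bool; true; false; not; _∧_; _∨_; if_then_else_)
import Data.Bool as B
open import Data.Nat using (ℕ; zero; suc; _⊔_; _≡ᵇ_; _≤ᵇ_; _*_)
open import Data.Fin using (Fin)
import Data.Fin as F
open import Data.Vec using (Vec; []; _∷_; lookup; updateAt)
import Data.Vec.Properties as VP
open import Data.List using (List; []; _∷_; [_]; _++_; map; concatMap; zip; length; allFin; foldr)
open import Data.Bool.ListAction using (any; all)
open import Data.Product using (_×_; _,_; proj₁; proj₂)
open import Data.Integer using (+_)
open import Data.Rational using (ℚ; 0ℚ; _/_; 1/_; ≢-nonZero; _≟_)
open import Relation.Nullary using (yes; no)
open import Relation.Nullary.Decidable using (⌊_⌋)

Vertex : ℕ → Set
Vertex n = Vec Bool n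

allVertices : (n : ℕ) → List (Vertex n)
allVertices zero    = [ [] ]
allVertices (suc n) = concatMap (λ v → (false ∷ v) ∷ (true ∷ v) ∷ []) (allVertices n)

flipAt : {n : ℕ} → Vertex n → Fin n → Vertex n
flipAt v i = updateAt v i not

_=V_ : {n : ℕ} → Vertex n → Vertex n → Bool
u =V v = ⌊ VP.≡-dec B._≟_ u v ⌋

-- an edge of Q_n is stored canonically as (v , i) with v[i] = 0;
-- its endpoints are v and v with coordinate i flipped, i is its flip coordinate
Edge : ℕ → Set
Edge n = Vertex n × Fin n

edgesQ : (n : ℕ) → List (Edge n)
edgesQ n = concatMap (λ v → concatMap (λ i → if lookup v i then [] else [ (v , i) ]) (allFin n))
                     (allVertices n)

joins : {n : ℕ} → Edge n → Vertex n → Vertex n → Bool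
joins (v , i) a b = ((a =V v) ∧ (b =V flipAt v i)) ∨ ((b =V v) ∧ (a =V flipAt v i))

-- Subgraphs, given by their edge sets (a duplicate-free list of edges).

sublists : {A : Set} → List A → List (List A)
sublists []       = [ [] ]
sublists (x ∷ xs) = let r = sublists xs in map (x ∷_) r ++ r

vertexSeqs : (n m : ℕ) → List (List (Vertex n))
vertexSeqs n zero    = [ [] ]
vertexSeqs n (suc m) = concatMap (λ v → map (v ∷_) (vertexSeqs n m)) (allVertices n)

cycPairs : {A : Set} → List A → List (A × A)
cycPairs []       = []
cycPairs (x ∷ xs) = zip (x ∷ xs) (xs ++ [ x ])

distinct : {n : ℕ} → List (Vertex n) → Bool
distinct []       = true
distinct (x ∷ xs) = not (any (x =V_) xs) ∧ distinct xs

isCycleThrough : {n : ℕ} → List (Edge n) → List (Vertex n) → Bool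
isCycleThrough S vs =
  distinct vs
  ∧ all (λ e → any (λ p → joins e (proj₁ p) (proj₂ p)) (cycPairs vs)) S
  ∧ all (λ p → any (λ e → joins e (proj₁ p) (proj₂ p)) S) (cycPairs vs)

isCycle : {n : ℕ} → ℕ → List (Edge n) → Bool
isCycle {n} m S = (3 ≤ᵇ m) ∧ any (isCycleThrough S) (vertexSeqs n m)

countB : {A : Set} → (A → Bool) → List A → ℕ
countB p []       = 0
countB p (x ∷ xs) = if p x then suc (countB p xs) else countB p xs

-- N(G , C_m) for the subgraph G of Q_n with edge set S:
-- the number of subgraphs of G isomorphic to C_m
-- (a copy of a cycle is determined by its edge set)
N-C : {n : ℕ} → ℕ → List (Edge n) → ℕ
N-C m S = countB (isCycle m) (sublists S)

N-Q : (n m : ℕ) → ℕ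
N-Q n m = N-C m (edgesQ n)

exQ : (n a b : ℕ) → ℕ
exQ n a b = foldr _⊔_ 0
  (map (λ S → if N-C b S ≡ᵇ 0 then N-C a S else 0) (sublists (edgesQ n)))

-- the ratio x / y in ℚ (returns 0 when y = 0, where it is not used)
ratio : ℕ → ℕ → ℚ
ratio x zero    = 0ℚ
ratio x (suc y) = (+ x) / suc y

dQ : (n a b : ℕ) → ℚ
dQ n a b = ratio (exQ n a b) (N-Q n a)

z : ℕ → ℕ → ℕ
z k l = countB (λ S → isCycle (2 * l) S ∧ all (λ i → any (λ e → ⌊ proj₂ e F.≟ i ⌋) S) (allFin k))
               (sublists (edgesQ k))

-- multiplicative inverse in ℚ (1/q for q ≠ 0; only used at q ≠ 0)
inv : ℚ → ℚ
inv q with q ≟ 0ℚ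
... | yes _  = 0ℚ
... | no q≢0 = 1/_ q {{≢-nonZero q≢0}}

{-# OPTIONS --safe #-}
module Submission where

-- Upper bound.  From a vertex u, the paths of length 3 with directions abc, bca and cab are pairwise internally
-- disjoint and have the same end, so two of them form a 6-cycle.  Every cycle of length at least 6 contains a path
-- with three distinct consecutive directions; rotating these directions about u moves the cycle through an orbit of
-- three, at most one of which lies in a given C₆-free graph.  Hence the density is at most 1/3.
--
-- Lower bound, with error term 0.  For a sign vector s and a parity p, the edges (v , i) with |v| ≡ p and with
-- s i as the parity of the ones of v before i form a C₆-free graph.  For l ≥ 4 one such layer of Q_l contains a
-- 2l-cycle using all directions.  It sits in every face of dimension l, for a proportion 2^-(l+1) of the
-- pairs (s , p), so some layer of Q_n has a positive proportion of the copies of C_2l.  All but a vanishing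
-- proportion of the copies of C_2l in Q_n span a face of dimension l, where there are z l l of them; the constants
-- leave enough room to count cycles by vertex sequences and to absorb the remaining copies.

open import Data.Bool using (Bool; true; false; not; _∧_; _xor_; T; if_then_else_)
import Data.Bool as B
import Data.Bool.Properties as BP
open import Data.Bool.ListAction using (any; all)
open import Data.Nat using (ℕ; zero; suc; _+_; _*_; _^_; _≤_; _<_; _≥_; _⊔_; z≤n; s≤s; _⊓_; _≤′_; ≤′-refl; ≤′-step; NonZero; >-nonZero; _≡ᵇ_; _≤ᵇ_)
import Data.Nat.Properties as ℕP
open import Data.Nat.ListAction using (sum)
open import Algebra.Properties.CommutativeSemigroup ℕP.+-commutativeSemigroup using (x∙yz≈y∙xz; interchange)
open import Data.Nat.Solver using (module +-*-Solver)
import Data.Integer as ℤ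
import Data.Integer.Properties as ℤP
import Data.Rational as Q
import Data.Rational.Properties as QP
import Data.Rational.Unnormalised as Qᵘ
import Data.Rational.Unnormalised.Properties as QᵘP
open import Data.Rational using (ℚ; 0ℚ; 1ℚ)
open import Data.Fin using (Fin; zero; suc)
import Data.Fin as F
import Data.Fin.Properties as FP
open import Data.Vec using (Vec; []; _∷_; lookup; tabulate)
import Data.Vec as Vec
import Data.Vec.Properties as VP
open import Data.List using (List; []; _∷_; [_]; _++_; map; concatMap; zip; length; allFin; foldr; filterᵇ; reverse; cartesianProductWith; cartesianProduct)
import Data.List.Properties as LP
open import Data.List.Membership.Propositional using (_∈_; find; lose)
open import Data.List.Membership.Propositional.Properties
open import Data.List.Relation.Unary.All as All using (All; []; _∷_)
import Data.List.Relation.Unary.All.Properties as AllP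
open import Data.List.Relation.Unary.Any as Any using (Any; here; there)
import Data.List.Relation.Unary.Any.Properties as AnyP
open import Data.List.Relation.Unary.AllPairs using ([]; _∷_)
open import Data.List.Relation.Unary.Unique.Propositional using (Unique)
import Data.List.Relation.Unary.Unique.Propositional.Properties as UP
open import Data.Product using (Σ; ∃; ∃₂; _×_; _,_; proj₁; proj₂; swap)
open import Data.Sum using (_⊎_; inj₁; inj₂; [_,_]′)
open import Data.Empty using (⊥; ⊥-elim)
open import Function using (_∘_; id; flip)
open import Function.Bundles using (_⇔_; mk⇔; Equivalence)
open import Relation.Nullary using (Dec; yes; no; contradiction)
open import Relation.Nullary.Decidable using (⌊_⌋; toWitness; fromWitness; T?; _×-dec_)
open import Relation.Binary.PropositionalEquality using (_≡_; _≢_; refl; sym; trans; cong; cong₂; subst; subst₂; module ≡-Reasoning)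
open import Defs

-- Counting in lists

-- The orbit argument needs a rotation that can be recovered from its image: the triple of
-- directions must be chosen canonically, and its place must still be the chosen one after the
-- rotation. Hence the first suitable triple is taken, and cycles are handled as vertex sequences
-- with a starting point and a sense. In the upper bound the factor between sequences and copies
-- stands on both sides and cancels. In the lower bound one fixed layer might avoid the wanted
-- cycles in most faces; the signs average this out. The absence of hexagons rests on comparing
-- parities before one and the same coordinate, so each coordinate may have a sign of its own. A
-- model cycle placed in a face of dimension l then forces `p` and the l signs of the free
-- directions, and leaves the other n - l signs arbitrary. For l = 3 the model cycle would itself be
-- a hexagon; l = 4 is also where `4 * l ≤ 2 ^ l`, which pays for the choice of starting point and
-- sense, is an equality.

injection⇒length≤ : {A B : Set} (R : A → B → Set) {xs : List A} {ys : List B} → Unique xs →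
  (∀ {x} → x ∈ xs → ∃ λ y → y ∈ ys × R x y) →
  (∀ {x x′ y} → x ∈ xs → x′ ∈ xs → R x y → R x′ y → x ≡ x′) →
  length xs ≤ length ys
injection⇒length≤ R [] tot inj = z≤n
injection⇒length≤ R {x ∷ xs} (x∉ ∷ u) tot inj with tot (here refl)
... | y , y∈ , rxy with ∈-∃++ y∈
... | us , vs , refl = subst (suc (length xs) ≤_) (sym lenEq) (s≤s
        (injection⇒length≤ R u tot′ (λ p q → inj (there p) (there q))))
  where
  lenEq : length (us ++ y ∷ vs) ≡ suc (length (us ++ vs))
  lenEq = trans (LP.length-++ us) (trans (ℕP.+-suc (length us) (length vs)) (cong suc (sym (LP.length-++ us))))
  drop-y : ∀ {z} → z ∈ us ++ y ∷ vs → z ≢ y → z ∈ us ++ vs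
  drop-y z∈ z≢y with ∈-++⁻ us z∈
  ... | inj₁ p = ∈-++⁺ˡ p
  ... | inj₂ (here e) = contradiction e z≢y
  ... | inj₂ (there p) = ∈-++⁺ʳ us p
  tot′ : ∀ {w} → w ∈ xs → ∃ λ z → z ∈ us ++ vs × R w z
  tot′ w∈ with tot (there w∈)
  -- A later element with partner `y` would coincide with `x` by injectivity, so removing `y` costs
  -- it nothing.
  ... | z , z∈ , rwz = z , drop-y z∈ (λ { refl → All.lookup x∉ w∈ (inj (here refl) (there w∈) rxy rwz) }) , rwz

subset⇒length≤ : {A : Set} {xs ys : List A} → Unique xs → (∀ {x} → x ∈ xs → x ∈ ys) → length xs ≤ length ys
subset⇒length≤ u sub = injection⇒length≤ _≡_ u (λ x∈ → _ , sub x∈ , refl) (λ _ _ p q → trans p (sym q))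

∈-filterᵇ⁺ : {A : Set} (p : A → Bool) {x : A} {xs : List A} → x ∈ xs → T (p x) → x ∈ filterᵇ p xs
∈-filterᵇ⁺ p = ∈-filter⁺ (T? ∘ p)

∈-filterᵇ⁻ : {A : Set} (p : A → Bool) {x : A} (xs : List A) → x ∈ filterᵇ p xs → x ∈ xs × T (p x)
∈-filterᵇ⁻ p xs = ∈-filter⁻ (T? ∘ p) {xs = xs}

unique-filterᵇ : {A : Set} (p : A → Bool) {xs : List A} → Unique xs → Unique (filterᵇ p xs)
unique-filterᵇ p = UP.filter⁺ (T? ∘ p)

countB≡length-filterᵇ : {A : Set} (p : A → Bool) (xs : List A) → countB p xs ≡ length (filterᵇ p xs)
countB≡length-filterᵇ p [] = refl
countB≡length-filterᵇ p (x ∷ xs) with p x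
... | true = cong suc (countB≡length-filterᵇ p xs)
... | false = countB≡length-filterᵇ p xs

sumBy : {A : Set} → (A → ℕ) → List A → ℕ
sumBy f xs = sum (map f xs)

sumBy-swap : {A B : Set} (R : A → B → Bool) (xs : List A) (ys : List B) →
  sumBy (λ x → countB (R x) ys) xs ≡ sumBy (λ y → countB (λ x → R x y) xs) ys
sumBy-swap R [] ys = sym (zeros ys)
  where
  zeros : ∀ zs → sumBy (λ _ → 0) zs ≡ 0
  zeros [] = refl
  zeros (_ ∷ zs) = zeros zs
sumBy-swap R (x ∷ xs) ys = trans (cong (countB (R x) ys +_) (sumBy-swap R xs ys)) (step ys)
  where
  step : ∀ zs → countB (R x) zs + sumBy (λ y → countB (λ x → R x y) xs) zs
              ≡ sumBy (λ y → countB (λ x → R x y) (x ∷ xs)) zs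
  step [] = refl
  step (z ∷ zs) with R x z
  ... | true = cong suc (trans (x∙yz≈y∙xz (countB (R x) zs) (countB (λ x → R x z) xs) _)
                               (cong (countB (λ x → R x z) xs +_) (step zs)))
  ... | false = trans (x∙yz≈y∙xz (countB (R x) zs) (countB (λ x → R x z) xs) _)
                      (cong (countB (λ x → R x z) xs +_) (step zs))

sumBy-≤ : {A : Set} (f : A → ℕ) {d : ℕ} (xs : List A) → (∀ {x} → x ∈ xs → f x ≤ d) → sumBy f xs ≤ length xs * d
sumBy-≤ f [] b = z≤n
sumBy-≤ f (x ∷ xs) b = ℕP.+-mono-≤ (b (here refl)) (sumBy-≤ f xs (b ∘ there))

sumBy-≥ : {A : Set} (f : A → ℕ) {d : ℕ} (xs : List A) → (∀ {x} → x ∈ xs → d ≤ f x) → length xs * d ≤ sumBy f xs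
sumBy-≥ f [] b = z≤n
sumBy-≥ f (x ∷ xs) b = ℕP.+-mono-≤ (b (here refl)) (sumBy-≥ f xs (b ∘ there))

double-count : {A B : Set} (R : A → B → Bool) {c d : ℕ} (xs : List A) (ys : List B) →
  (∀ {x} → x ∈ xs → c ≤ countB (R x) ys) → (∀ {y} → y ∈ ys → countB (λ x → R x y) xs ≤ d) →
  length xs * c ≤ length ys * d
double-count R xs ys lo hi =
  ℕP.≤-trans (sumBy-≥ _ xs lo) (ℕP.≤-trans (ℕP.≤-reflexive (sumBy-swap R xs ys)) (sumBy-≤ _ ys hi))

countB-unique : {A : Set} (p : A → Bool) {xs : List A} → Unique xs → {x : A} → x ∈ xs → T (p x) →
  (∀ {y} → y ∈ xs → T (p y) → y ≡ x) → countB p xs ≡ 1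
countB-unique p {xs} u {x} x∈ px only = trans (countB≡length-filterᵇ p xs)
  (ℕP.≤-antisym
    (subset⇒length≤ {ys = [ x ]} (unique-filterᵇ p u)
      (λ y∈ → let q , py = ∈-filterᵇ⁻ p xs y∈ in here (only q py)))
    (subset⇒length≤ ([] ∷ []) (λ { (here refl) → ∈-filterᵇ⁺ p x∈ px })))

unique-concatMap : {A B : Set} (f : A → List B) {xs : List A} → Unique xs → (∀ x → Unique (f x)) →
  (∀ {x x′ y} → y ∈ f x → y ∈ f x′ → x ≡ x′) → Unique (concatMap f xs)
unique-concatMap f [] uf det = []
unique-concatMap f {x ∷ xs} (x∉ ∷ u) uf det = UP.++⁺ (uf x) (unique-concatMap f u uf det) disj
  where
  disj : ∀ {y} → y ∈ f x × y ∈ concatMap f xs → ⊥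
  disj (p , q) with find (∈-concatMap⁻ f {xs = xs} q)
  ... | x′ , x′∈ , y∈ = All.lookup x∉ x′∈ (det p y∈)

∈-concatMap-intro : {A B : Set} (f : A → List B) {x : A} {y : B} {xs : List A} → x ∈ xs → y ∈ f x → y ∈ concatMap f xs
∈-concatMap-intro f x∈ y∈ = ∈-concatMap⁺ f (lose x∈ y∈)

∈-concatMap-elim : {A B : Set} (f : A → List B) {y : B} {xs : List A} → y ∈ concatMap f xs → ∃ λ x → x ∈ xs × y ∈ f x
∈-concatMap-elim f {xs = xs} y∈ = find (∈-concatMap⁻ f {xs = xs} y∈)

-- Vertices and edges of the cube

≢not : ∀ {x} → x ≢ not x
≢not {true} ()
≢not {false} ()

flipAt-involutive : ∀ {n} (v : Vertex n) i → flipAt (flipAt v i) i ≡ v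
flipAt-involutive (x ∷ v) zero = cong (_∷ v) (BP.not-involutive x)
flipAt-involutive (x ∷ v) (suc i) = cong (x ∷_) (flipAt-involutive v i)

lookup-flipAt-same : ∀ {n} (v : Vertex n) i → lookup (flipAt v i) i ≡ not (lookup v i)
lookup-flipAt-same v i = VP.lookup∘updateAt i v

lookup-flipAt-other : ∀ {n} (v : Vertex n) {i j} → j ≢ i → lookup (flipAt v i) j ≡ lookup v j
lookup-flipAt-other v {i} {j} j≢i = VP.lookup∘updateAt′ j i j≢i v

flipAt≢ : ∀ {n} (v : Vertex n) i → flipAt v i ≢ v
flipAt≢ v i eq = ≢not (trans (sym (cong (λ w → lookup w i) eq)) (lookup-flipAt-same v i))

flipAt-index-injective : ∀ {n} (v : Vertex n) {i j} → flipAt v i ≡ flipAt v j → i ≡ j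
flipAt-index-injective v {i} {j} eq with i F.≟ j
... | yes p = p
... | no i≢j = contradiction
      (sym (trans (sym (lookup-flipAt-same v i)) (trans (cong (λ w → lookup w i) eq) (lookup-flipAt-other v i≢j))))
      ≢not

flipAt-commutes : ∀ {n} (v : Vertex n) i j → flipAt (flipAt v i) j ≡ flipAt (flipAt v j) i
flipAt-commutes v i j with i F.≟ j
... | yes refl = refl
... | no i≢j = VP.updateAt-commutes j i (i≢j ∘ sym) v

flipAt-injective : ∀ {n} i {u v : Vertex n} → flipAt u i ≡ flipAt v i → u ≡ v
flipAt-injective i {u} {v} eq =
  trans (sym (flipAt-involutive u i)) (trans (cong (λ w → flipAt w i) eq) (flipAt-involutive v i))

∈-allVertices : ∀ {n} (v : Vertex n) → v ∈ allVertices n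
∈-allVertices [] = here refl
∈-allVertices (false ∷ v) = ∈-concatMap-intro _ (∈-allVertices v) (here refl)
∈-allVertices (true ∷ v) = ∈-concatMap-intro _ (∈-allVertices v) (there (here refl))

allVertices-unique : ∀ n → Unique (allVertices n)
allVertices-unique zero = [] ∷ []
allVertices-unique (suc n) = unique-concatMap _ (allVertices-unique n)
  (λ v → ((λ ()) ∷ []) ∷ [] ∷ [])
  (λ { (here refl) (here refl) → refl ; (here refl) (there (here ())) ; (here refl) (there (there ()))
     ; (there (here refl)) (here ()) ; (there (here refl)) (there (here refl)) → refl })

length-allVertices : ∀ n → length (allVertices n) ≡ 2 ^ n
length-allVertices zero = refl
length-allVertices (suc n) = trans (go (allVertices n)) (cong (2 *_) (length-allVertices n))
  where
  go : (vs : List (Vertex n)) →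
       length (concatMap (λ v → (false ∷ v) ∷ (true ∷ v) ∷ []) vs) ≡ 2 * length vs
  go [] = refl
  go (v ∷ vs) = trans (cong (2 +_) (go vs)) (sym (ℕP.*-suc 2 (length vs)))

∈-vertexSeqs⁺ : ∀ {n} (vs : List (Vertex n)) → vs ∈ vertexSeqs n (length vs)
∈-vertexSeqs⁺ [] = here refl
∈-vertexSeqs⁺ (v ∷ vs) = ∈-concatMap-intro _ (∈-allVertices v) (∈-map⁺ (v ∷_) (∈-vertexSeqs⁺ vs))

∈-vertexSeqs⁻ : ∀ {n} m {vs : List (Vertex n)} → vs ∈ vertexSeqs n m → length vs ≡ m
∈-vertexSeqs⁻ zero (here refl) = refl
∈-vertexSeqs⁻ {n} (suc m) vs∈ with ∈-concatMap-elim (λ v → map (v ∷_) (vertexSeqs n m)) {xs = allVertices n} vs∈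
... | v , _ , vs∈′ with ∈-map⁻ (v ∷_) vs∈′
... | ws , ws∈ , refl = cong suc (∈-vertexSeqs⁻ m ws∈)

vertexSeqs-unique : ∀ n m → Unique (vertexSeqs n m)
vertexSeqs-unique n zero = [] ∷ []
vertexSeqs-unique n (suc m) = unique-concatMap _ (allVertices-unique n)
  (λ v → UP.map⁺ LP.∷-injectiveʳ (vertexSeqs-unique n m)) det
  where
  det : ∀ {v v′ ws} → ws ∈ map (v ∷_) (vertexSeqs n m) → ws ∈ map (v′ ∷_) (vertexSeqs n m) → v ≡ v′
  det {v} {v′} p q with ∈-map⁻ (v ∷_) p | ∈-map⁻ (v′ ∷_) q
  ... | _ , _ , refl | _ , _ , refl = refl

∈-edgesQ⁺ : ∀ {n} {v : Vertex n} {i} → lookup v i ≡ false → (v , i) ∈ edgesQ n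
∈-edgesQ⁺ {n} {v} {i} vi = ∈-concatMap-intro _ (∈-allVertices v) (∈-concatMap-intro _ (∈-allFin i) step)
  where
  step : (v , i) ∈ (if lookup v i then [] else [ (v , i) ])
  step rewrite vi = here refl

private
  edgesAt : ∀ {n} → Vertex n → Fin n → List (Edge n)
  edgesAt v i = if lookup v i then [] else [ (v , i) ]

  edgesAt⁻ : ∀ {n} {v : Vertex n} {i e} → e ∈ edgesAt v i → e ≡ (v , i) × lookup v i ≡ false
  edgesAt⁻ {v = v} {i} e∈ with lookup v i
  edgesAt⁻ (here refl) | false = refl , refl

  ∈-edgesFrom⁻ : ∀ {n} {v : Vertex n} {e} → e ∈ concatMap (edgesAt v) (allFin n) →
    ∃ λ i → e ≡ (v , i) × lookup v i ≡ false
  ∈-edgesFrom⁻ {n} {v} e∈ with ∈-concatMap-elim (edgesAt v) {xs = allFin n} e∈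
  ... | i , _ , e∈′ = i , edgesAt⁻ e∈′

∈-edgesQ⁻ : ∀ {n} {v : Vertex n} {i} → (v , i) ∈ edgesQ n → lookup v i ≡ false
∈-edgesQ⁻ {n} e∈ with ∈-concatMap-elim (λ v → concatMap (edgesAt v) (allFin n)) {xs = allVertices n} e∈
... | v , _ , e∈′ with ∈-edgesFrom⁻ e∈′
... | i , refl , vi = vi

edgesQ-unique : ∀ n → Unique (edgesQ n)
edgesQ-unique n = unique-concatMap _ (allVertices-unique n)
  (λ v → unique-concatMap (edgesAt v) (UP.allFin⁺ n) edgesAt-unique
    (λ p q → cong proj₂ (trans (sym (proj₁ (edgesAt⁻ p))) (proj₁ (edgesAt⁻ q)))))
  (λ p q → cong proj₁ (trans (sym (proj₁ (proj₂ (∈-edgesFrom⁻ p)))) (proj₁ (proj₂ (∈-edgesFrom⁻ q)))))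
  where
  edgesAt-unique : ∀ {v : Vertex n} i → Unique (edgesAt v i)
  edgesAt-unique {v} i with lookup v i
  ... | true = []
  ... | false = [] ∷ []

-- Sublists as edge sets

∈-sublists⁻ : {A : Set} {S E : List A} {x : A} → E ∈ sublists S → x ∈ E → x ∈ S
∈-sublists⁻ {S = []} (here refl) ()
∈-sublists⁻ {S = y ∷ S} E∈ x∈ with ∈-++⁻ (map (y ∷_) (sublists S)) E∈
... | inj₂ p = there (∈-sublists⁻ p x∈)
... | inj₁ p with ∈-map⁻ (y ∷_) p
∈-sublists⁻ {S = y ∷ S} E∈ (here refl) | inj₁ p | E′ , E′∈ , refl = here refl
∈-sublists⁻ {S = y ∷ S} E∈ (there x∈) | inj₁ p | E′ , E′∈ , refl = there (∈-sublists⁻ E′∈ x∈)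

filterᵇ∈sublists : {A : Set} (p : A → Bool) (S : List A) → filterᵇ p S ∈ sublists S
filterᵇ∈sublists p [] = here refl
filterᵇ∈sublists p (y ∷ S) with p y
... | true = ∈-++⁺ˡ (∈-map⁺ (y ∷_) (filterᵇ∈sublists p S))
... | false = ∈-++⁺ʳ (map (y ∷_) (sublists S)) (filterᵇ∈sublists p S)

sublist-unique : {A : Set} {S E : List A} → Unique S → E ∈ sublists S → Unique E
sublist-unique {S = []} [] (here refl) = []
sublist-unique {S = y ∷ S} (y∉ ∷ u) E∈ with ∈-++⁻ (map (y ∷_) (sublists S)) E∈
... | inj₂ p = sublist-unique u p
... | inj₁ p with ∈-map⁻ (y ∷_) p
... | E′ , E′∈ , refl = All.tabulate (λ x∈ → All.lookup y∉ (∈-sublists⁻ E′∈ x∈)) ∷ sublist-unique u E′∈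

-- Since the order is inherited from `S`, a sublist is a canonical form of its set of elements.
-- Copies can therefore be counted as lists, and equality of edge sets becomes equality of lists.
sublist-ext : {A : Set} {S E E′ : List A} → Unique S → E ∈ sublists S → E′ ∈ sublists S →
  (∀ {x} → x ∈ E → x ∈ E′) → (∀ {x} → x ∈ E′ → x ∈ E) → E ≡ E′
sublist-ext {S = []} u (here refl) (here refl) f g = refl
sublist-ext {S = y ∷ S} (y∉ ∷ u) p q f g
  with ∈-++⁻ (map (y ∷_) (sublists S)) p | ∈-++⁻ (map (y ∷_) (sublists S)) q
... | inj₂ p′ | inj₂ q′ = sublist-ext u p′ q′ f g
... | inj₁ p′ | inj₂ q′ with ∈-map⁻ (y ∷_) p′
... | _ , _ , refl = contradiction refl (All.lookup y∉ (∈-sublists⁻ q′ (f (here refl))))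
sublist-ext {S = y ∷ S} (y∉ ∷ u) p q f g | inj₂ p′ | inj₁ q′ with ∈-map⁻ (y ∷_) q′
... | _ , _ , refl = contradiction refl (All.lookup y∉ (∈-sublists⁻ p′ (g (here refl))))
sublist-ext {S = y ∷ S} (y∉ ∷ u) p q f g | inj₁ p′ | inj₁ q′ with ∈-map⁻ (y ∷_) p′ | ∈-map⁻ (y ∷_) q′
... | E , E∈ , refl | E′ , E′∈ , refl = cong (y ∷_) (sublist-ext u E∈ E′∈ (tl E∈ f) (tl E′∈ g))
  where
  tl : ∀ {D D′} → D ∈ sublists S → (∀ {x} → x ∈ y ∷ D → x ∈ y ∷ D′) → ∀ {x} → x ∈ D → x ∈ D′
  tl D∈ h x∈ with h (there x∈)
  ... | here refl = contradiction refl (All.lookup y∉ (∈-sublists⁻ D∈ x∈))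
  ... | there x∈′ = x∈′

sublists-unique : {A : Set} {S : List A} → Unique S → Unique (sublists S)
sublists-unique [] = [] ∷ []
sublists-unique {S = y ∷ S} (y∉ ∷ u) = UP.++⁺ (UP.map⁺ LP.∷-injectiveʳ (sublists-unique u)) (sublists-unique u) disj
  where
  disj : ∀ {E} → E ∈ map (y ∷_) (sublists S) × E ∈ sublists S → ⊥
  disj (p , q) with ∈-map⁻ (y ∷_) p
  ... | _ , _ , refl = All.lookup y∉ (∈-sublists⁻ q (here refl)) refl

-- Boolean tests on edges and vertex sequences

Joins : ∀ {n} → Edge n → Vertex n → Vertex n → Set
Joins (v , i) a b = (a ≡ v × b ≡ flipAt v i) ⊎ (b ≡ v × a ≡ flipAt v i)

T-∧⁺ : ∀ {x y} → T x → T y → T (x ∧ y)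
T-∧⁺ p q = Equivalence.from BP.T-∧ (p , q)

T-∧⁻ : ∀ {x y} → T (x ∧ y) → T x × T y
T-∧⁻ = Equivalence.to BP.T-∧

=V⁺ : ∀ {n} {u v : Vertex n} → u ≡ v → T (u =V v)
=V⁺ = fromWitness

=V⁻ : ∀ {n} (u v : Vertex n) → T (u =V v) → u ≡ v
=V⁻ u v = toWitness

joins⁺ : ∀ {n} (e : Edge n) {a b} → Joins e a b → T (joins e a b)
joins⁺ (v , i) {a} {b} j = Equivalence.from (BP.T-∨ {(a =V v) ∧ (b =V flipAt v i)} {(b =V v) ∧ (a =V flipAt v i)}) (go j)
  where
  go : Joins (v , i) a b → T ((a =V v) ∧ (b =V flipAt v i)) ⊎ T ((b =V v) ∧ (a =V flipAt v i))
  go (inj₁ (p , q)) = inj₁ (T-∧⁺ {a =V v} (=V⁺ p) (=V⁺ q))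
  go (inj₂ (p , q)) = inj₂ (T-∧⁺ {b =V v} (=V⁺ p) (=V⁺ q))

joins⁻ : ∀ {n} (e : Edge n) {a b} → T (joins e a b) → Joins e a b
joins⁻ (v , i) {a} {b} t
  with Equivalence.to (BP.T-∨ {(a =V v) ∧ (b =V flipAt v i)} {(b =V v) ∧ (a =V flipAt v i)}) t
... | inj₁ s = let p , q = T-∧⁻ {a =V v} s in inj₁ (=V⁻ a v p , =V⁻ b (flipAt v i) q)
... | inj₂ s = let p , q = T-∧⁻ {b =V v} s in inj₂ (=V⁻ b v p , =V⁻ a (flipAt v i) q)

joins-sym : ∀ {n} {e : Edge n} {a b} → Joins e a b → Joins e b a
joins-sym (inj₁ p) = inj₂ p
joins-sym (inj₂ p) = inj₁ p

joins-endpoints : ∀ {n} {e : Edge n} {a b c d} → Joins e a b → Joins e c d →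
  (a ≡ c × b ≡ d) ⊎ (a ≡ d × b ≡ c)
joins-endpoints (inj₁ (refl , refl)) (inj₁ (refl , refl)) = inj₁ (refl , refl)
joins-endpoints (inj₁ (refl , refl)) (inj₂ (refl , refl)) = inj₂ (refl , refl)
joins-endpoints (inj₂ (refl , refl)) (inj₁ (refl , refl)) = inj₂ (refl , refl)
joins-endpoints (inj₂ (refl , refl)) (inj₂ (refl , refl)) = inj₁ (refl , refl)

joins-determines-edge : ∀ {n} {e e′ : Edge n} {a b} → e ∈ edgesQ n → e′ ∈ edgesQ n →
  Joins e a b → Joins e′ a b → e ≡ e′
joins-determines-edge {e = v , i} {v′ , i′} p q j j′ = go j j′
  where
  -- If the two edges were stored at opposite ends, their common flip coordinate would be `false` at
  -- both ends.
  crossed : ∀ {w w′ : Vertex _} {k k′} → (w , k) ∈ edgesQ _ → (w′ , k′) ∈ edgesQ _ →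
    w ≡ flipAt w′ k′ → flipAt w k ≡ w′ → ⊥
  crossed {w} {w′} {k} {k′} r s refl eq with flipAt-index-injective w (trans eq (sym (flipAt-involutive w′ k′)))
  ... | refl = ≢not (trans (trans (∈-edgesQ⁻ s) (sym (∈-edgesQ⁻ r))) (lookup-flipAt-same w′ k))
  go : Joins (v , i) _ _ → Joins (v′ , i′) _ _ → (v , i) ≡ (v′ , i′)
  go (inj₁ (refl , refl)) (inj₁ (refl , eq)) = cong (v ,_) (flipAt-index-injective v eq)
  go (inj₂ (refl , refl)) (inj₂ (refl , eq)) = cong (v ,_) (flipAt-index-injective v eq)
  go (inj₁ (refl , refl)) (inj₂ (eq , eq′)) = ⊥-elim (crossed p q eq′ eq)
  go (inj₂ (refl , refl)) (inj₁ (eq , eq′)) = ⊥-elim (crossed p q eq′ eq)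

distinct⁺ : ∀ {n} {vs : List (Vertex n)} → Unique vs → T (distinct vs)
distinct⁺ [] = _
distinct⁺ {vs = x ∷ xs} (x∉ ∷ u) = T-∧⁺ {not (any (x =V_) xs)} fresh (distinct⁺ u)
  where
  fresh : T (not (any (x =V_) xs))
  fresh with any (x =V_) xs in eq
  ... | false = _
  ... | true with find (AnyP.any⁻ (x =V_) xs (subst T (sym eq) _))
  ... | y , y∈ , x≡y = All.lookup x∉ y∈ (=V⁻ x y x≡y)

distinct⁻ : ∀ {n} (vs : List (Vertex n)) → T (distinct vs) → Unique vs
distinct⁻ [] _ = []
distinct⁻ (x ∷ xs) t = All.tabulate fresh ∷ distinct⁻ xs (proj₂ (T-∧⁻ {not (any (x =V_) xs)} t))
  where
  fresh : ∀ {y} → y ∈ xs → x ≢ y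
  fresh y∈ x≡y with any (x =V_) xs | proj₁ (T-∧⁻ {not (any (x =V_) xs)} t) | AnyP.any⁺ (x =V_) (lose y∈ (=V⁺ x≡y))
  ... | true | () | _
  ... | false | _ | ()

-- Cyclic sequences

Near : {A : Set} → List A → A → A → Set
Near vs a b = (a , b) ∈ cycPairs vs ⊎ (b , a) ∈ cycPairs vs

near-sym : {A : Set} {vs : List A} {a b : A} → Near vs a b → Near vs b a
near-sym (inj₁ p) = inj₂ p
near-sym (inj₂ p) = inj₁ p

zip-∈ˡ : {A B : Set} (as : List A) (bs : List B) {a : A} {b : B} → (a , b) ∈ zip as bs → a ∈ as
zip-∈ˡ (_ ∷ as) (_ ∷ bs) (here refl) = here refl
zip-∈ˡ (_ ∷ as) (_ ∷ bs) (there p) = there (zip-∈ˡ as bs p)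

zip-∈ʳ : {A B : Set} (as : List A) (bs : List B) {a : A} {b : B} → (a , b) ∈ zip as bs → b ∈ bs
zip-∈ʳ (_ ∷ as) (_ ∷ bs) (here refl) = here refl
zip-∈ʳ (_ ∷ as) (_ ∷ bs) (there p) = there (zip-∈ʳ as bs p)

zip-functional : {A B : Set} {as : List A} (bs : List B) {a : A} {b c : B} → Unique as →
  (a , b) ∈ zip as bs → (a , c) ∈ zip as bs → b ≡ c
zip-functional {as = _ ∷ _} (_ ∷ bs) u (here refl) (here refl) = refl
zip-functional {as = _ ∷ as} (_ ∷ bs) (a∉ ∷ u) (here refl) (there q) = contradiction refl (All.lookup a∉ (zip-∈ˡ as bs q))
zip-functional {as = _ ∷ as} (_ ∷ bs) (a∉ ∷ u) (there p) (here refl) = contradiction refl (All.lookup a∉ (zip-∈ˡ as bs p))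
zip-functional {as = _ ∷ as} (_ ∷ bs) (a∉ ∷ u) (there p) (there q) = zip-functional bs u p q

zip-injective : {A B : Set} (as : List A) {bs : List B} {a c : A} {b : B} → Unique bs →
  (a , b) ∈ zip as bs → (c , b) ∈ zip as bs → a ≡ c
zip-injective (_ ∷ as) {_ ∷ _} u (here refl) (here refl) = refl
zip-injective (_ ∷ as) {_ ∷ bs} (a∉ ∷ u) (here refl) (there q) = contradiction refl (All.lookup a∉ (zip-∈ʳ as bs q))
zip-injective (_ ∷ as) {_ ∷ bs} (a∉ ∷ u) (there p) (here refl) = contradiction refl (All.lookup a∉ (zip-∈ʳ as bs p))
zip-injective (_ ∷ as) {_ ∷ bs} (a∉ ∷ u) (there p) (there q) = zip-injective as u p q

zip-unique : {A B : Set} {as : List A} (bs : List B) → Unique as → Unique (zip as bs)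
zip-unique bs [] = []
zip-unique [] (_ ∷ _) = []
zip-unique {as = a ∷ as} (b ∷ bs) (a∉ ∷ u) = All.tabulate fresh ∷ zip-unique bs u
  where
  fresh : ∀ {d} → d ∈ zip as bs → (a , b) ≢ d
  fresh p refl = All.lookup a∉ (zip-∈ˡ as bs p) refl

zip-++ : {A B : Set} (as : List A) (bs : List B) {as′ : List A} {bs′ : List B} → length as ≡ length bs →
  zip (as ++ as′) (bs ++ bs′) ≡ zip as bs ++ zip as′ bs′
zip-++ [] [] eq = refl
zip-++ (a ∷ as) (b ∷ bs) eq = cong ((a , b) ∷_) (zip-++ as bs (ℕP.suc-injective eq))

zip-swap : {A B : Set} (as : List A) (bs : List B) → zip bs as ≡ map swap (zip as bs)
zip-swap [] [] = refl
zip-swap [] (_ ∷ _) = refl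
zip-swap (_ ∷ _) [] = refl
zip-swap (a ∷ as) (b ∷ bs) = cong ((b , a) ∷_) (zip-swap as bs)

zip-reverse : {A B : Set} (as : List A) (bs : List B) → length as ≡ length bs →
  zip (reverse as) (reverse bs) ≡ reverse (zip as bs)
zip-reverse [] [] eq = refl
zip-reverse (a ∷ as) (b ∷ bs) eq
  rewrite LP.unfold-reverse a as | LP.unfold-reverse b bs | LP.unfold-reverse (a , b) (zip as bs) =
  trans (zip-++ (reverse as) (reverse bs)
          (trans (LP.length-reverse as) (trans (ℕP.suc-injective eq) (sym (LP.length-reverse bs)))))
        (cong (_++ [ (a , b) ]) (zip-reverse as bs (ℕP.suc-injective eq)))

length-snoc : {A : Set} (xs : List A) {x : A} → length (xs ++ [ x ]) ≡ suc (length xs)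
length-snoc xs = trans (LP.length-++ xs) (ℕP.+-comm (length xs) 1)

length-cycPairs : {A : Set} (vs : List A) → length (cycPairs vs) ≡ length vs
length-cycPairs [] = refl
length-cycPairs (x ∷ xs) = trans (LP.length-zipWith _,_ (x ∷ xs) (xs ++ [ x ]))
  (trans (cong (suc (length xs) ⊓_) (length-snoc xs)) (ℕP.⊓-idem (suc (length xs))))

cycPairs-rotate : {A : Set} (x y : A) (xs : List A) →
  cycPairs ((y ∷ xs) ++ [ x ]) ≡ zip (y ∷ xs) (xs ++ [ x ]) ++ [ (x , y) ]
cycPairs-rotate x y xs = zip-++ (y ∷ xs) (xs ++ [ x ]) (sym (length-snoc xs))

cycPairs-reflect : {A : Set} (x : A) (xs : List A) →
  cycPairs (x ∷ reverse xs) ≡ map swap (reverse (cycPairs (x ∷ xs)))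
cycPairs-reflect x xs = begin
  zip (x ∷ reverse xs) (reverse xs ++ [ x ])
    ≡⟨ sym (cong₂ zip (LP.reverse-++ xs [ x ]) (LP.unfold-reverse x xs)) ⟩
  zip (reverse (xs ++ [ x ])) (reverse (x ∷ xs))
    ≡⟨ zip-swap (reverse (x ∷ xs)) (reverse (xs ++ [ x ])) ⟩
  map swap (zip (reverse (x ∷ xs)) (reverse (xs ++ [ x ])))
    ≡⟨ cong (map swap) (zip-reverse (x ∷ xs) (xs ++ [ x ]) (sym (length-snoc xs))) ⟩
  map swap (reverse (cycPairs (x ∷ xs))) ∎
  where open ≡-Reasoning

unique-snoc : {A : Set} {x : A} {xs : List A} → Unique (x ∷ xs) → Unique (xs ++ [ x ])
unique-snoc (x∉ ∷ u) = UP.++⁺ u ([] ∷ []) (λ { (p , here refl) → All.lookup x∉ p refl })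

unique-reverse : {A : Set} {xs : List A} → Unique xs → Unique (reverse xs)
unique-reverse [] = []
unique-reverse {xs = x ∷ xs} (x∉ ∷ u) rewrite LP.unfold-reverse x xs =
  unique-snoc (All.tabulate (λ p → All.lookup x∉ (AnyP.reverse⁻ p)) ∷ unique-reverse u)

next-unique : {A : Set} {vs : List A} {a b c : A} → Unique vs →
  (a , b) ∈ cycPairs vs → (a , c) ∈ cycPairs vs → b ≡ c
next-unique {vs = x ∷ xs} u = zip-functional (xs ++ [ x ]) u

previous-unique : {A : Set} {vs : List A} {a b c : A} → Unique vs →
  (a , c) ∈ cycPairs vs → (b , c) ∈ cycPairs vs → a ≡ b
previous-unique {vs = x ∷ xs} u = zip-injective (x ∷ xs) (unique-snoc u)

-- Of three neighbours of `a`, two lie on the same side, both after `a` or both before it, and these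
-- agree.
at-most-two-neighbours : {A : Set} {vs : List A} {a b c d : A} → Unique vs →
  Near vs a b → Near vs a c → Near vs a d → b ≢ c → b ≢ d → c ≡ d
at-most-two-neighbours u (inj₁ p) (inj₁ q) r b≢c b≢d = contradiction (next-unique u p q) b≢c
at-most-two-neighbours u (inj₂ p) (inj₂ q) r b≢c b≢d = contradiction (previous-unique u p q) b≢c
at-most-two-neighbours u (inj₁ p) q (inj₁ r) b≢c b≢d = contradiction (next-unique u p r) b≢d
at-most-two-neighbours u (inj₂ p) q (inj₂ r) b≢c b≢d = contradiction (previous-unique u p r) b≢d
at-most-two-neighbours u (inj₁ p) (inj₂ q) (inj₂ r) b≢c b≢d = previous-unique u q r
at-most-two-neighbours u (inj₂ p) (inj₁ q) (inj₁ r) b≢c b≢d = next-unique u q r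

record SameCycle {A : Set} (vs ws : List A) : Set where
  constructor same
  field
    to   : ∀ {a b} → Near vs a b → Near ws a b
    from : ∀ {a b} → Near ws a b → Near vs a b
    len  : length vs ≡ length ws

StartsWith : {A : Set} → List A → A × A → Set
StartsWith ws (a , b) = ∃ λ t → ws ≡ a ∷ b ∷ t

private
  open import Data.List.Relation.Unary.Linked as Linked using (Linked; []; [-]; _∷_)

  cycPairs-linked : {A : Set} (x : A) (xs : List A) {y : A} → Linked (λ a b → (a , b) ∈ zip (x ∷ xs) (xs ++ [ y ])) (x ∷ xs)
  cycPairs-linked x [] = [-]
  cycPairs-linked x (x′ ∷ xs) = here refl ∷ Linked.map there (cycPairs-linked x′ xs)

  -- One of the two neighbours of `b` is taken by `a`, and distinctness forbids turning back, so
  -- each further vertex is forced.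
  walk-determined : {A : Set} {vs : List A} {a b : A} {s t : List A} → Unique vs →
    Linked (Near vs) (a ∷ b ∷ s) → Linked (Near vs) (a ∷ b ∷ t) →
    Unique (a ∷ b ∷ s) → Unique (a ∷ b ∷ t) → length s ≡ length t → s ≡ t
  walk-determined {s = []} {[]} u _ _ _ _ _ = refl
  walk-determined {vs = vs} {s = c ∷ s} {d ∷ t} u (p ∷ q ∷ qs) (p′ ∷ r ∷ rs) (a≢ ∷ us) (a≢′ ∷ ut) eq
    with at-most-two-neighbours u (near-sym {vs = vs} p) q r (All.lookup a≢ (there (here refl))) (All.lookup a≢′ (there (here refl)))
  ... | refl = cong (c ∷_) (walk-determined u (q ∷ qs) (r ∷ rs) us ut (ℕP.suc-injective eq))

cycle-determined-by-start : {A : Set} {vs ws ws′ : List A} {d : A × A} → Unique vs → Unique ws → Unique ws′ →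
  SameCycle vs ws → SameCycle vs ws′ → StartsWith ws d → StartsWith ws′ d → ws ≡ ws′
cycle-determined-by-start {ws = ws} {ws′} {a , b} u uw uw′ e e′ (t , refl) (t′ , refl) =
  cong (λ s → a ∷ b ∷ s) (walk-determined u
    (Linked.map (λ p → from e (inj₁ p)) (cycPairs-linked a (b ∷ t)))
    (Linked.map (λ p → from e′ (inj₁ p)) (cycPairs-linked a (b ∷ t′)))
    uw uw′ (ℕP.suc-injective (ℕP.suc-injective (trans (sym (len e)) (len e′)))))
  where open SameCycle

snoc⇔cons : {A : Set} (ps : List A) {p q : A} → p ∈ ps ++ [ q ] ⇔ p ∈ q ∷ ps
snoc⇔cons ps {p} {q} = mk⇔ f g
  where
  f : p ∈ ps ++ [ q ] → p ∈ q ∷ ps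
  f r with ∈-++⁻ ps r
  ... | inj₁ s = there s
  ... | inj₂ (here s) = here s
  g : p ∈ q ∷ ps → p ∈ ps ++ [ q ]
  g (here s) = ∈-++⁺ʳ ps (here s)
  g (there s) = ∈-++⁺ˡ s

samePairs⇒sameCycle : {A : Set} {vs ws : List A} → (∀ {p} → p ∈ cycPairs vs ⇔ p ∈ cycPairs ws) →
  length vs ≡ length ws → SameCycle vs ws
samePairs⇒sameCycle e l = same
  [ inj₁ ∘ Equivalence.to e , inj₂ ∘ Equivalence.to e ]′
  [ inj₁ ∘ Equivalence.from e , inj₂ ∘ Equivalence.from e ]′ l

sameCycle-trans : {A : Set} {us vs ws : List A} → SameCycle us vs → SameCycle vs ws → SameCycle us ws
sameCycle-trans (same t f l) (same t′ f′ l′) = same (t′ ∘ t) (f ∘ f′) (trans l l′)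

sameCycle-refl : {A : Set} {vs : List A} → SameCycle vs vs
sameCycle-refl = same id id refl

sameCycle-rotate : {A : Set} (x y : A) (xs : List A) → SameCycle (x ∷ y ∷ xs) ((y ∷ xs) ++ [ x ])
sameCycle-rotate x y xs = samePairs⇒sameCycle
  (λ {p} → subst (λ ps → p ∈ cycPairs (x ∷ y ∷ xs) ⇔ p ∈ ps) (sym (cycPairs-rotate x y xs))
    (mk⇔ (Equivalence.from (snoc⇔cons ps)) (Equivalence.to (snoc⇔cons ps))))
  (sym (length-snoc (y ∷ xs)))
  where
  ps = zip (y ∷ xs) (xs ++ [ x ])

sameCycle-reflect : {A : Set} (x : A) (xs : List A) → SameCycle (x ∷ xs) (x ∷ reverse xs)
sameCycle-reflect x xs = same to from (cong suc (sym (LP.length-reverse xs)))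
  where
  ps = cycPairs (x ∷ xs)
  to′ : ∀ {a b} → (a , b) ∈ ps → (b , a) ∈ cycPairs (x ∷ reverse xs)
  to′ p = subst (_ ∈_) (sym (cycPairs-reflect x xs)) (∈-map⁺ swap (AnyP.reverse⁺ p))
  from′ : ∀ {a b} → (a , b) ∈ cycPairs (x ∷ reverse xs) → (b , a) ∈ ps
  from′ p with ∈-map⁻ swap (subst (_ ∈_) (cycPairs-reflect x xs) p)
  ... | _ , q , refl = AnyP.reverse⁻ q
  to : ∀ {a b} → Near (x ∷ xs) a b → Near (x ∷ reverse xs) a b
  to = [ inj₂ ∘ to′ , inj₁ ∘ to′ ]′
  from : ∀ {a b} → Near (x ∷ reverse xs) a b → Near (x ∷ xs) a b
  from = [ inj₂ ∘ from′ , inj₁ ∘ from′ ]′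

private
  -- Recursion on the pairs in front of `d`: one rotation moves the first of them to the end.
  rotate-to : {A : Set} (ps : List (A × A)) {qs : List (A × A)} {d : A × A} (x y : A) (xs : List A) →
    Unique (x ∷ y ∷ xs) → cycPairs (x ∷ y ∷ xs) ≡ ps ++ d ∷ qs →
    ∃ λ ws → StartsWith ws d × Unique ws × SameCycle (x ∷ y ∷ xs) ws
  rotate-to [] x y xs u refl = _ , (xs , refl) , u , sameCycle-refl
  -- The split on the tail exposes the first two entries of the rotated sequence for the recursive
  -- call.
  rotate-to (p ∷ ps) {qs} {d} x y [] u eq
    with LP.∷-injectiveˡ eq
  ... | refl with rotate-to ps y x [] (unique-snoc u)
                    (trans (cycPairs-rotate x y [])
                      (trans (cong (_++ [ (x , y) ]) (LP.∷-injectiveʳ eq)) (LP.++-assoc ps (d ∷ qs) [ (x , y) ])))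
  ... | ws , st , uw , e = ws , st , uw , sameCycle-trans (sameCycle-rotate x y []) e
  rotate-to (p ∷ ps) {qs} {d} x y (z ∷ xs) u eq
    with LP.∷-injectiveˡ eq
  ... | refl with rotate-to ps y z (xs ++ [ x ]) (unique-snoc u)
                    (trans (cycPairs-rotate x y (z ∷ xs))
                      (trans (cong (_++ [ (x , y) ]) (LP.∷-injectiveʳ eq)) (LP.++-assoc ps (d ∷ qs) [ (x , y) ])))
  ... | ws , st , uw , e = ws , st , uw , sameCycle-trans (sameCycle-rotate x y (z ∷ xs)) e

  rotate-to-pair : {A : Set} {d : A × A} (vs : List A) → 2 ≤ length vs → Unique vs → d ∈ cycPairs vs →
    ∃ λ ws → StartsWith ws d × Unique ws × SameCycle vs ws
  rotate-to-pair (x ∷ []) (s≤s ())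
  rotate-to-pair (x ∷ y ∷ xs) _ u d∈ with ∈-∃++ d∈
  ... | ps , qs , eq = rotate-to ps x y xs u eq

  reflect-unique : {A : Set} {x : A} {xs : List A} → Unique (x ∷ xs) → Unique (x ∷ reverse xs)
  reflect-unique (x∉ ∷ u) = All.tabulate (λ p → All.lookup x∉ (AnyP.reverse⁻ p)) ∷ unique-reverse u

cycle-from-start : {A : Set} {a b : A} (vs : List A) → 2 ≤ length vs → Unique vs → Near vs a b →
  ∃ λ ws → StartsWith ws (a , b) × Unique ws × SameCycle vs ws
cycle-from-start vs l u (inj₁ p) = rotate-to-pair vs l u p
cycle-from-start (x ∷ xs) l u (inj₂ p)
  with rotate-to-pair (x ∷ reverse xs) (subst (2 ≤_) (SameCycle.len (sameCycle-reflect x xs)) l) (reflect-unique u)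
         (subst (_ ∈_) (sym (cycPairs-reflect x xs)) (∈-map⁺ swap (AnyP.reverse⁺ p)))
... | ws , st , uw , e = ws , st , uw , sameCycle-trans (sameCycle-reflect x xs) e

darts : {A : Set} → List A → List (A × A)
darts vs = cycPairs vs ++ map swap (cycPairs vs)

length-darts : {A : Set} (vs : List A) → length (darts vs) ≡ 2 * length vs
length-darts vs rewrite LP.length-++ (cycPairs vs) {map swap (cycPairs vs)} | LP.length-map swap (cycPairs vs)
  | length-cycPairs vs = cong (length vs +_) (sym (ℕP.+-identityʳ _))

∈-darts⁺ : {A : Set} {vs : List A} {a b : A} → Near vs a b → (a , b) ∈ darts vs
∈-darts⁺ (inj₁ p) = ∈-++⁺ˡ p
∈-darts⁺ {vs = vs} (inj₂ p) = ∈-++⁺ʳ (cycPairs vs) (∈-map⁺ swap p)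

∈-darts⁻ : {A : Set} {vs : List A} {a b : A} → (a , b) ∈ darts vs → Near vs a b
∈-darts⁻ {vs = vs} d with ∈-++⁻ (cycPairs vs) d
... | inj₁ p = inj₁ p
... | inj₂ p with ∈-map⁻ swap p
... | _ , q , refl = inj₂ q

-- After rotation the sequence begins `a`, `b`, `c`. If `a` both precedes and follows `b`, then `c`
-- shares a side of `b` with `a`, and so equals it. This makes the `2 * length vs` darts distinct.
not-both-directions : {A : Set} {a b : A} (vs : List A) → 3 ≤ length vs → Unique vs →
  (a , b) ∈ cycPairs vs → (b , a) ∈ cycPairs vs → ⊥
not-both-directions vs l u p q with cycle-from-start vs (ℕP.<⇒≤ l) u (inj₁ p)
... | ws , (t , refl) , uw , e with t
... | [] = contradiction (subst (3 ≤_) (SameCycle.len e) l) λ { (s≤s (s≤s ())) }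
... | c ∷ t′ with uw | SameCycle.from e (inj₁ (there (here refl)))
... | (_ ∷ a≢c ∷ _) ∷ _ | inj₁ bc = a≢c (next-unique u q bc)
... | (_ ∷ a≢c ∷ _) ∷ _ | inj₂ cb = a≢c (previous-unique u p cb)

darts-unique : {A : Set} (vs : List A) → 3 ≤ length vs → Unique vs → Unique (darts vs)
darts-unique vs@(x ∷ xs) l u = UP.++⁺ cu (UP.map⁺ (λ { {_ , _} {_ , _} refl → refl }) cu) disj
  where
  cu = zip-unique (xs ++ [ x ]) u
  disj : ∀ {d} → d ∈ cycPairs vs × d ∈ map swap (cycPairs vs) → ⊥
  disj (p , q) with ∈-map⁻ swap q
  ... | _ , r , refl = not-both-directions vs l u p r

length≥2⇒startsWith : {A : Set} (vs : List A) → 2 ≤ length vs → ∃ λ d → StartsWith vs d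
length≥2⇒startsWith (x ∷ y ∷ t) _ = (x , y) , t , refl
length≥2⇒startsWith (x ∷ []) (s≤s ())

-- A cyclic sequence on at least three points is determined, among those with the same edges, by its first
-- two entries, and these can be any edge in either direction.
sequences-of-a-cycle : {A : Set} {vs : List A} (wss : List (List A)) → 3 ≤ length vs → Unique vs → Unique wss →
  (∀ {ws} → ws ∈ wss ⇔ (Unique ws × SameCycle vs ws)) → length wss ≡ 2 * length vs
sequences-of-a-cycle {vs = vs} wss l u uw spec = trans (ℕP.≤-antisym le ge) (length-darts vs)
  where
  open Equivalence
  le : length wss ≤ length (darts vs)
  le = injection⇒length≤ StartsWith uw tot inj
    where
    tot : ∀ {ws} → ws ∈ wss → ∃ λ d → d ∈ darts vs × StartsWith ws d
    tot {ws} ws∈ with to spec ws∈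
    ... | _ , e with length≥2⇒startsWith ws (ℕP.<⇒≤ (subst (3 ≤_) (SameCycle.len e) l))
    ... | d , t , refl = d , ∈-darts⁺ {vs = vs} (SameCycle.from e (inj₁ (here refl))) , t , refl
    inj : ∀ {ws ws′ d} → ws ∈ wss → ws′ ∈ wss → StartsWith ws d → StartsWith ws′ d → ws ≡ ws′
    inj p q st st′ = let u₁ , e₁ = to spec p ; u₂ , e₂ = to spec q in
      cycle-determined-by-start u u₁ u₂ e₁ e₂ st st′
  ge : length (darts vs) ≤ length wss
  ge = injection⇒length≤ (flip StartsWith) (darts-unique vs l u) tot inj
    where
    tot : ∀ {d} → d ∈ darts vs → ∃ λ ws → ws ∈ wss × StartsWith ws d
    tot d∈ with cycle-from-start vs (ℕP.<⇒≤ l) u (∈-darts⁻ {vs = vs} d∈)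
    ... | ws , st , uw′ , e = ws , from spec (uw′ , e) , st
    inj : ∀ {d d′ ws} → d ∈ darts vs → d′ ∈ darts vs → StartsWith ws d → StartsWith ws d′ → d ≡ d′
    inj _ _ (_ , refl) (_ , refl) = refl

-- Copies of cycles and the vertex sequences traversing them

Joined : ∀ {n} → List (Edge n) → Vertex n → Vertex n → Set
Joined S a b = ∃ λ e → e ∈ S × Joins e a b

joined-sym : ∀ {n} {S : List (Edge n)} {a b} → Joined S a b → Joined S b a
joined-sym (e , e∈ , j) = e , e∈ , joins-sym {e = e} j

Inside : ∀ {n} → List (Edge n) → List (Vertex n) → Set
Inside S vs = Unique vs × (∀ {a b} → (a , b) ∈ cycPairs vs → Joined S a b)

insideᵇ : ∀ {n} → List (Edge n) → List (Vertex n) → Bool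
insideᵇ S vs = distinct vs ∧ all (λ p → any (λ e → joins e (proj₁ p) (proj₂ p)) S) (cycPairs vs)

record Through {n} (E : List (Edge n)) (vs : List (Vertex n)) : Set where
  constructor through
  field
    uniq : Unique vs
    to   : ∀ {a b} → Near vs a b → Joined E a b
    from : ∀ {a b} → Joined E a b → Near vs a b

private
  any-joins⁺ : ∀ {n} {S : List (Edge n)} {a b} → Joined S a b → T (any (λ e → joins e a b) S)
  any-joins⁺ {a = a} {b} (e , e∈ , j) = AnyP.any⁺ (λ e → joins e a b) (lose e∈ (joins⁺ e j))

  any-joins⁻ : ∀ {n} (S : List (Edge n)) {a b} → T (any (λ e → joins e a b) S) → Joined S a b
  any-joins⁻ S {a} {b} t with find (AnyP.any⁻ (λ e → joins e a b) S t)
  ... | e , e∈ , j = e , e∈ , joins⁻ e j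

  all-joins⁺ : ∀ {n} {S : List (Edge n)} {ps : List (Vertex n × Vertex n)} → (∀ {a b} → (a , b) ∈ ps → Joined S a b) →
    T (all (λ p → any (λ e → joins e (proj₁ p) (proj₂ p)) S) ps)
  all-joins⁺ {S = S} h = AllP.all⁻ (λ p → any (λ e → joins e (proj₁ p) (proj₂ p)) S) (All.tabulate (any-joins⁺ ∘ h))

  all-joins⁻ : ∀ {n} (S : List (Edge n)) (ps : List (Vertex n × Vertex n)) →
    T (all (λ p → any (λ e → joins e (proj₁ p) (proj₂ p)) S) ps) → ∀ {a b} → (a , b) ∈ ps → Joined S a b
  all-joins⁻ S ps t p∈ = any-joins⁻ S (All.lookup (AllP.all⁺ (λ p → any (λ e → joins e (proj₁ p) (proj₂ p)) S) ps t) p∈)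

inside⁺ : ∀ {n} {S : List (Edge n)} {vs} → Inside S vs → T (insideᵇ S vs)
inside⁺ {vs = vs} (u , h) = T-∧⁺ {distinct vs} (distinct⁺ u) (all-joins⁺ h)

inside⁻ : ∀ {n} (S : List (Edge n)) vs → T (insideᵇ S vs) → Inside S vs
inside⁻ S vs t = let d , h = T-∧⁻ {distinct vs} t in distinct⁻ vs d , all-joins⁻ S (cycPairs vs) h

private
  onᵇ : ∀ {n} → List (Vertex n) → Edge n → Bool
  onᵇ vs e = any (λ p → joins e (proj₁ p) (proj₂ p)) (cycPairs vs)

  on⁺ : ∀ {n} {vs : List (Vertex n)} {e a b} → Near vs a b → Joins e a b → T (onᵇ vs e)
  on⁺ {vs = vs} {e} (inj₁ p) j = AnyP.any⁺ _ (lose p (joins⁺ e j))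
  on⁺ {vs = vs} {e} (inj₂ p) j = AnyP.any⁺ _ (lose p (joins⁺ e (joins-sym {e = e} j)))

  on⁻ : ∀ {n} (vs : List (Vertex n)) {e} → T (onᵇ vs e) → ∃₂ λ a b → (a , b) ∈ cycPairs vs × Joins e a b
  on⁻ vs {e} t with find (AnyP.any⁻ _ (cycPairs vs) t)
  ... | (a , b) , p , j = a , b , p , joins⁻ e j

isCycleThrough⁺ : ∀ {n} {E : List (Edge n)} {vs} → Through E vs → T (isCycleThrough E vs)
isCycleThrough⁺ {E = E} {vs} (through u t f) = T-∧⁺ {distinct vs} (distinct⁺ u)
  (T-∧⁺ {all (onᵇ vs) E} (AllP.all⁻ (onᵇ vs) (All.tabulate on)) (all-joins⁺ (t ∘ inj₁)))
  where
  on : ∀ {e} → e ∈ E → T (onᵇ vs e)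
  on {v , i} e∈ = on⁺ {vs = vs} {v , i} {v} {flipAt v i} (f (_ , e∈ , inj₁ (refl , refl))) (inj₁ (refl , refl))

isCycleThrough⁻ : ∀ {n} (E : List (Edge n)) vs → T (isCycleThrough E vs) → Through E vs
isCycleThrough⁻ E vs t = through (distinct⁻ vs d) to from
  where
  d = proj₁ (T-∧⁻ {distinct vs} t)
  r = T-∧⁻ {all (onᵇ vs) E} (proj₂ (T-∧⁻ {distinct vs} t))
  joined = all-joins⁻ E (cycPairs vs) (proj₂ r)
  to : ∀ {a b} → Near vs a b → Joined E a b
  to (inj₁ p) = joined p
  to (inj₂ p) = joined-sym (joined p)
  from : ∀ {a b} → Joined E a b → Near vs a b
  from (e , e∈ , j) with on⁻ vs {e} (All.lookup (AllP.all⁺ (onᵇ vs) E (proj₁ r)) e∈)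
  ... | a′ , b′ , p , j′ with joins-endpoints {e = e} j j′
  ... | inj₁ (refl , refl) = inj₁ p
  ... | inj₂ (refl , refl) = inj₂ p

edgesOf : ∀ {n} → List (Edge n) → List (Vertex n) → List (Edge n)
edgesOf S vs = filterᵇ (onᵇ vs) S

cyclesIn : ∀ {n} → ℕ → List (Edge n) → List (List (Vertex n))
cyclesIn {n} m S = filterᵇ (insideᵇ S) (vertexSeqs n m)

∈-cyclesIn⁺ : ∀ {n m} {S : List (Edge n)} {vs} → length vs ≡ m → Inside S vs → vs ∈ cyclesIn m S
∈-cyclesIn⁺ {S = S} {vs} refl i = ∈-filterᵇ⁺ (insideᵇ S) (∈-vertexSeqs⁺ vs) (inside⁺ i)

∈-cyclesIn⁻ : ∀ {n} m (S : List (Edge n)) {vs} → vs ∈ cyclesIn m S → length vs ≡ m × Inside S vs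
∈-cyclesIn⁻ {n} m S {vs} vs∈ = let p , q = ∈-filterᵇ⁻ (insideᵇ S) (vertexSeqs n m) vs∈ in
  ∈-vertexSeqs⁻ m p , inside⁻ S vs q

cyclesIn-unique : ∀ {n} m (S : List (Edge n)) → Unique (cyclesIn m S)
cyclesIn-unique {n} m S = unique-filterᵇ (insideᵇ S) (vertexSeqs-unique n m)

∈-edgesOf⁺ : ∀ {n} {S : List (Edge n)} {vs e a b} → e ∈ S → (a , b) ∈ cycPairs vs → Joins e a b → e ∈ edgesOf S vs
∈-edgesOf⁺ {vs = vs} {e} e∈ p j = ∈-filterᵇ⁺ (onᵇ vs) e∈ (on⁺ {vs = vs} {e} (inj₁ p) j)

private
  -- Each pair of consecutive vertices is joined by an edge of `E`, and by `joins-determines-edge`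
  -- this is the only edge of `S` that joins it.
  edgesOf-through : ∀ {n} {S E : List (Edge n)} {vs} → Unique S → (∀ {e} → e ∈ S → e ∈ edgesQ n) →
    E ∈ sublists S → Through E vs → E ≡ edgesOf S vs
  edgesOf-through {S = S} {E} {vs} u sub E∈ (through _ to from) =
    sublist-ext u E∈ (filterᵇ∈sublists (onᵇ vs) S) f g
    where
    f : ∀ {e} → e ∈ E → e ∈ edgesOf S vs
    f {v , i} e∈ = ∈-filterᵇ⁺ (onᵇ vs) {xs = S} (∈-sublists⁻ E∈ e∈)
      (on⁺ {vs = vs} {v , i} {v} {flipAt v i} (from (_ , e∈ , inj₁ (refl , refl))) (inj₁ (refl , refl)))
    g : ∀ {e} → e ∈ edgesOf S vs → e ∈ E
    g {e} e∈ with ∈-filterᵇ⁻ (onᵇ vs) S e∈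
    ... | e∈S , t with on⁻ vs {e} t
    ... | a , b , p , j with to (inj₁ p)
    ... | e′ , e′∈ , j′ = subst (_∈ E) (joins-determines-edge (sub (∈-sublists⁻ E∈ e′∈)) (sub e∈S) j′ j) e′∈

  inside⇒through : ∀ {n} {S : List (Edge n)} {vs} → Inside S vs → Through (edgesOf S vs) vs
  inside⇒through {S = S} {vs} (u , h) = through u to from
    where
    to : ∀ {a b} → Near vs a b → Joined (edgesOf S vs) a b
    to (inj₁ p) with h p
    ... | e , e∈ , j = e , ∈-edgesOf⁺ {vs = vs} e∈ p j , j
    to (inj₂ p) with h p
    ... | e , e∈ , j = e , ∈-edgesOf⁺ {vs = vs} e∈ p j , joins-sym {e = e} j
    from : ∀ {a b} → Joined (edgesOf S vs) a b → Near vs a b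
    from (e , e∈ , j) with on⁻ vs {e} (proj₂ (∈-filterᵇ⁻ (onᵇ vs) S e∈))
    ... | a′ , b′ , p , j′ with joins-endpoints {e = e} j j′
    ... | inj₁ (refl , refl) = inj₁ p
    ... | inj₂ (refl , refl) = inj₂ p

  through⇒inside : ∀ {n} {S E : List (Edge n)} {vs} → E ∈ sublists S → Through E vs → Inside S vs
  through⇒inside {S = S} {E} {vs} E∈ (through u to _) = u , h
    where
    h : ∀ {a b} → (a , b) ∈ cycPairs vs → Joined S a b
    h p with to (inj₁ p)
    ... | e , e∈ , j = e , ∈-sublists⁻ E∈ e∈ , j

isCycle⁺ : ∀ {n m} {E : List (Edge n)} {vs} → 3 ≤ m → length vs ≡ m → Through E vs → T (isCycle m E)
isCycle⁺ {m = m} {E} {vs} m≥3 refl th = T-∧⁺ {3 ≤ᵇ m} (ℕP.≤⇒≤ᵇ m≥3)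
  (AnyP.any⁺ (isCycleThrough E) (lose (∈-vertexSeqs⁺ vs) (isCycleThrough⁺ th)))

isCycle⁻ : ∀ {n} m (E : List (Edge n)) → T (isCycle m E) → ∃ λ vs → length vs ≡ m × Through E vs
isCycle⁻ {n} m E t with find (AnyP.any⁻ (isCycleThrough E) (vertexSeqs n m) (proj₂ (T-∧⁻ {3 ≤ᵇ m} t)))
... | vs , vs∈ , th = vs , ∈-vertexSeqs⁻ m vs∈ , isCycleThrough⁻ E vs th

through-sameCycle : ∀ {n} {E : List (Edge n)} {vs ws} → length vs ≡ length ws → Through E vs → Through E ws → SameCycle vs ws
through-sameCycle l (through _ t f) (through _ t′ f′) = same (f′ ∘ t) (f ∘ t′) l

-- Incidences between copies and sequences are counted both ways: a sequence determines its edge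
-- set, and a copy is traversed by `2 * m` sequences, from each vertex in either sense. The filter
-- `Q` is `allDirections` for `z` and constantly true for `N-C`.
copies-by-sequences : ∀ {n m} {S : List (Edge n)} (Q : List (Edge n) → Bool) → 3 ≤ m →
  Unique S → (∀ {e} → e ∈ S → e ∈ edgesQ n) →
  countB (λ E → isCycle m E ∧ Q E) (sublists S) * (2 * m)
    ≡ length (filterᵇ (λ vs → Q (edgesOf S vs)) (cyclesIn m S))
copies-by-sequences {n} {m} {S} Q m≥3 uS sub =
  trans (cong (_* (2 * m)) (countB≡length-filterᵇ good (sublists S)))
    (ℕP.≤-antisym
      (ℕP.≤-trans (double-count isCycleThrough copies seqs (λ p → ℕP.≤-reflexive (sym (per-copy p))) (λ q → ℕP.≤-reflexive (per-seq q)))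
                  (ℕP.≤-reflexive (ℕP.*-identityʳ _)))
      (ℕP.≤-trans (ℕP.≤-reflexive (sym (ℕP.*-identityʳ _)))
                  (double-count (flip isCycleThrough) seqs copies (λ q → ℕP.≤-reflexive (sym (per-seq q))) (λ p → ℕP.≤-reflexive (per-copy p)))))
  where
  good = λ E → isCycle m E ∧ Q E
  goodSeq = λ vs → Q (edgesOf S vs)
  copies = filterᵇ good (sublists S)
  seqs = filterᵇ goodSeq (cyclesIn m S)
  per-seq : ∀ {vs} → vs ∈ seqs → countB (λ E → isCycleThrough E vs) copies ≡ 1
  per-seq {vs} vs∈ with ∈-filterᵇ⁻ goodSeq (cyclesIn m S) vs∈
  ... | p , q with ∈-cyclesIn⁻ m S p
  ... | l , ins = countB-unique (λ E → isCycleThrough E vs) (unique-filterᵇ good (sublists-unique uS))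
          (∈-filterᵇ⁺ good (filterᵇ∈sublists (onᵇ vs) S) (T-∧⁺ {isCycle m (edgesOf S vs)} (isCycle⁺ m≥3 l th) q))
          (isCycleThrough⁺ th)
          (λ {E} E∈ t → edgesOf-through uS sub (proj₁ (∈-filterᵇ⁻ good (sublists S) E∈)) (isCycleThrough⁻ E vs t))
    where
    th = inside⇒through ins
  per-copy : ∀ {E} → E ∈ copies → countB (isCycleThrough E) seqs ≡ 2 * m
  per-copy {E} E∈ with ∈-filterᵇ⁻ good (sublists S) E∈
  ... | E∈S , t with T-∧⁻ {isCycle m E} t
  ... | cyc , qE with isCycle⁻ m E cyc
  ... | vs , refl , th = trans (countB≡length-filterᵇ (isCycleThrough E) seqs)
        (sequences-of-a-cycle (filterᵇ (isCycleThrough E) seqs) m≥3 (Through.uniq th)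
          (unique-filterᵇ (isCycleThrough E) (unique-filterᵇ goodSeq (cyclesIn-unique m S)))
          (mk⇔ f g))
    where
    f : ∀ {ws} → ws ∈ filterᵇ (isCycleThrough E) seqs → Unique ws × SameCycle vs ws
    f {ws} ws∈ with ∈-filterᵇ⁻ (isCycleThrough E) seqs ws∈
    ... | p , q with isCycleThrough⁻ E ws q
    ... | th′ = Through.uniq th′ , through-sameCycle
            (sym (proj₁ (∈-cyclesIn⁻ m S (proj₁ (∈-filterᵇ⁻ goodSeq (cyclesIn m S) p))))) th th′
    g : ∀ {ws} → Unique ws × SameCycle vs ws → ws ∈ filterᵇ (isCycleThrough E) seqs
    g {ws} (u , same t′ f′ l) = ∈-filterᵇ⁺ (isCycleThrough E) {xs = seqs}
      (∈-filterᵇ⁺ goodSeq {xs = cyclesIn m S} (∈-cyclesIn⁺ (sym l) (through⇒inside {S = S} E∈S th′)) (subst (T ∘ Q) (edgesOf-through uS sub E∈S th′) qE))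
      (isCycleThrough⁺ th′)
      where
      th′ : Through E ws
      th′ = through u (Through.to th ∘ f′) (t′ ∘ Through.from th)

N-C-by-sequences : ∀ {n m} {S : List (Edge n)} → 3 ≤ m → Unique S → (∀ {e} → e ∈ S → e ∈ edgesQ n) →
  N-C m S * (2 * m) ≡ length (cyclesIn m S)
N-C-by-sequences {m = m} {S} m≥3 uS sub =
  trans (cong (_* (2 * m)) (countB-cong (sublists S)))
    (trans (copies-by-sequences (λ _ → true) m≥3 uS sub) (cong length (LP.filter-all (λ _ → T? true) {xs = cyclesIn m S} (All.tabulate (λ _ → _)))))
  where
  countB-cong : ∀ Es → countB (isCycle m) Es ≡ countB (λ E → isCycle m E ∧ true) Es
  countB-cong [] = refl
  countB-cong (E ∷ Es) with isCycle m E
  ... | true = cong suc (countB-cong Es)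
  ... | false = countB-cong Es

-- Rotating three coordinates about a vertex

-- `F` plays the role of a permutation with cube the identity, and no element satisfying `p` is
-- followed by another one. Sending `(k , x)` to the result of `k` steps from `x` is then injective
-- on the `x` that satisfy `p`, for `k` = 0, 1, 2.
orbits-of-three : {A : Set} (F : A → A → Set) (p : A → Bool) {xs : List A} → Unique xs →
  (∀ {x} → x ∈ xs → ∃ (F x)) →
  (∀ {x y} → x ∈ xs → F x y → y ∈ xs) →
  (∀ {x y z w} → x ∈ xs → F x y → F y z → F z w → w ≡ x) →
  (∀ {x y} → x ∈ xs → F x y → T (p x) → T (p y) → ⊥) →
  3 * length (filterᵇ p xs) ≤ length xs
orbits-of-three {A} F p {xs} u step closed cube alternate =
  subst (_≤ length xs) (length-copies (allFin 3))
    (injection⇒length≤ R {cartesianProduct (allFin 3) ps} (UP.cartesianProduct⁺ (UP.allFin⁺ 3) (unique-filterᵇ p u)) tot inj)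
  where
  ps = filterᵇ p xs
  length-copies : (ks : List (Fin 3)) → length (cartesianProduct ks ps) ≡ length ks * length ps
  length-copies [] = refl
  length-copies (k ∷ ks) = trans (LP.length-++ (map (k ,_) ps)) (cong₂ _+_ (LP.length-map (k ,_) ps) (length-copies ks))
  R : Fin 3 × A → A → Set
  R (zero , x) y = x ≡ y
  R (suc zero , x) y = F x y
  R (suc (suc zero) , x) y = ∃ λ z → F x z × F z y
  good : ∀ {k x} → (k , x) ∈ cartesianProduct (allFin 3) ps → x ∈ xs × T (p x)
  good kx = ∈-filterᵇ⁻ p xs (proj₂ (∈-cartesianProduct⁻ (allFin 3) ps kx))
  tot : ∀ {kx} → kx ∈ cartesianProduct (allFin 3) ps → ∃ λ y → y ∈ xs × R kx y
  tot {zero , x} kx = x , proj₁ (good kx) , refl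
  tot {suc zero , x} kx = let y , f = step (proj₁ (good kx)) in y , closed (proj₁ (good kx)) f , f
  tot {suc (suc zero) , x} kx with step (proj₁ (good kx))
  ... | y , f with closed (proj₁ (good kx)) f
  ... | y∈ with step y∈
  ... | z , g = z , closed y∈ g , y , f , g
  F-injective : ∀ {x x′ y} → x ∈ xs → x′ ∈ xs → F x y → F x′ y → x ≡ x′
  F-injective x∈ x′∈ f f′ with step (closed x∈ f)
  ... | z , g with step (closed (closed x∈ f) g)
  ... | w , h = trans (sym (cube x∈ f g h)) (cube x′∈ f′ g h)
  -- Two steps from `x` to `z` amount to one step from `z` back to `x`.
  not-two-steps : ∀ {x y z} → x ∈ xs → F x y → F y z → T (p x) → T (p z) → ⊥
  not-two-steps x∈ f g px pz with closed (closed x∈ f) g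
  ... | z∈ with step z∈
  ... | w , h = alternate z∈ h pz (subst (T ∘ p) (sym (cube x∈ f g h)) px)
  inj : ∀ {kx kx′ y} → kx ∈ cartesianProduct (allFin 3) ps → kx′ ∈ cartesianProduct (allFin 3) ps →
    R kx y → R kx′ y → kx ≡ kx′
  inj {zero , x} {zero , x′} _ _ refl refl = refl
  inj {zero , x} {suc zero , x′} q q′ refl f′ =
    ⊥-elim (alternate (proj₁ (good q′)) f′ (proj₂ (good q′)) (proj₂ (good q)))
  inj {zero , x} {suc (suc zero) , x′} q q′ refl (z , f , g) =
    ⊥-elim (not-two-steps (proj₁ (good q′)) f g (proj₂ (good q′)) (proj₂ (good q)))
  inj {suc zero , x} {zero , x′} q q′ f refl =
    ⊥-elim (alternate (proj₁ (good q)) f (proj₂ (good q)) (proj₂ (good q′)))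
  inj {suc zero , x} {suc zero , x′} q q′ f f′ =
    cong (suc zero ,_) (F-injective (proj₁ (good q)) (proj₁ (good q′)) f f′)
  inj {suc zero , x} {suc (suc zero) , x′} q q′ f (z , f′ , g)
    with F-injective (proj₁ (good q)) (closed (proj₁ (good q′)) f′) f g
  ... | refl = ⊥-elim (alternate (proj₁ (good q′)) f′ (proj₂ (good q′)) (proj₂ (good q)))
  inj {suc (suc zero) , x} {zero , x′} q q′ (z , f , g) refl =
    ⊥-elim (not-two-steps (proj₁ (good q)) f g (proj₂ (good q)) (proj₂ (good q′)))
  inj {suc (suc zero) , x} {suc zero , x′} q q′ (z , f , g) f′
    with F-injective (proj₁ (good q′)) (closed (proj₁ (good q)) f) f′ g
  ... | refl = ⊥-elim (alternate (proj₁ (good q)) f (proj₂ (good q)) (proj₂ (good q′)))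
  inj {suc (suc zero) , x} {suc (suc zero) , x′} q q′ (z , f , g) (z′ , f′ , g′)
    with F-injective (closed (proj₁ (good q)) f) (closed (proj₁ (good q′)) f′) g g′
  ... | refl = cong (suc (suc zero) ,_) (F-injective (proj₁ (good q)) (proj₁ (good q′)) f f′)

-- It maps `a` to `c`, `c` to `b` and `b` to `a`, the inverse of the rotation wanted on directions:
-- `turn` reads coordinate `i` from coordinate `ρ i`, so steps in directions `a`, `b`, `c` become
-- steps in directions `b`, `c`, `a`.
threeCycle : ∀ {n} → Fin n → Fin n → Fin n → Fin n → Fin n
threeCycle a b c i with i F.≟ a | i F.≟ b | i F.≟ c
... | yes _ | _ | _ = c
... | no _ | yes _ | _ = a
... | no _ | no _ | yes _ = b
... | no _ | no _ | no _ = i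

module _ {n} {a b c : Fin n} where

  threeCycle-a : threeCycle a b c a ≡ c
  threeCycle-a with a F.≟ a | a F.≟ b | a F.≟ c
  ... | yes _ | _ | _ = refl
  ... | no a≢a | _ | _ = contradiction refl a≢a

  threeCycle-b : a ≢ b → threeCycle a b c b ≡ a
  threeCycle-b a≢b with b F.≟ a | b F.≟ b | b F.≟ c
  ... | yes b≡a | _ | _ = contradiction (sym b≡a) a≢b
  ... | no _ | yes _ | _ = refl
  ... | no _ | no b≢b | _ = contradiction refl b≢b

  threeCycle-c : a ≢ c → b ≢ c → threeCycle a b c c ≡ b
  threeCycle-c a≢c b≢c with c F.≟ a | c F.≟ b | c F.≟ c
  ... | yes c≡a | _ | _ = contradiction (sym c≡a) a≢c
  ... | no _ | yes c≡b | _ = contradiction (sym c≡b) b≢c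
  ... | no _ | no _ | yes _ = refl
  ... | no _ | no _ | no c≢c = contradiction refl c≢c

  threeCycle-other : ∀ {i} → i ≢ a → i ≢ b → i ≢ c → threeCycle a b c i ≡ i
  threeCycle-other {i} i≢a i≢b i≢c with i F.≟ a | i F.≟ b | i F.≟ c
  ... | yes p | _ | _ = contradiction p i≢a
  ... | no _ | yes p | _ = contradiction p i≢b
  ... | no _ | no _ | yes p = contradiction p i≢c
  ... | no _ | no _ | no _ = refl

-- The three factors are one permutation under cyclically renamed parameters. The renaming is what
-- repeated turning produces, as the frame passes from `a b c` to `b c a` and then to `c a b`.
threeCycle-cubed : ∀ {n} {a b c : Fin n} → a ≢ b → a ≢ c → b ≢ c → ∀ i →
  threeCycle a b c (threeCycle b c a (threeCycle c a b i)) ≡ i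
threeCycle-cubed {a = a} {b} {c} a≢b a≢c b≢c i = go (i F.≟ a) (i F.≟ b) (i F.≟ c)
  where
  chain : ∀ {j k} → threeCycle c a b i ≡ j → threeCycle b c a j ≡ k → threeCycle a b c k ≡ i →
    threeCycle a b c (threeCycle b c a (threeCycle c a b i)) ≡ i
  chain refl refl eq = eq
  go : Dec (i ≡ a) → Dec (i ≡ b) → Dec (i ≡ c) → threeCycle a b c (threeCycle b c a (threeCycle c a b i)) ≡ i
  go (yes refl) _ _ = chain (threeCycle-b (a≢c ∘ sym)) (threeCycle-b b≢c) (threeCycle-b a≢b)
  go (no _) (yes refl) _ = chain (threeCycle-c (b≢c ∘ sym) a≢b) (threeCycle-c (a≢b ∘ sym) (a≢c ∘ sym)) (threeCycle-c a≢c b≢c)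
  go (no _) (no _) (yes refl) = chain (threeCycle-a {a = c} {a} {b}) (threeCycle-a {a = b} {c} {a}) (threeCycle-a {a = a} {b} {c})
  go (no i≢a) (no i≢b) (no i≢c) = chain (threeCycle-other i≢c i≢a i≢b) (threeCycle-other i≢b i≢c i≢a) (threeCycle-other i≢a i≢b i≢c)

-- The automorphism of the cube that fixes u and turns a step in direction ρ i into a step in direction i.
turn : ∀ {n} → Vertex n → (Fin n → Fin n) → Vertex n → Vertex n
turn u ρ x = tabulate (λ i → lookup u i xor (lookup u (ρ i) xor lookup x (ρ i)))

vertex-ext : ∀ {n} {x y : Vertex n} → (∀ i → lookup x i ≡ lookup y i) → x ≡ y
vertex-ext {x = []} {[]} h = refl
vertex-ext {x = _ ∷ _} {_ ∷ _} h = cong₂ _∷_ (h zero) (vertex-ext (h ∘ suc))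

lookup-turn : ∀ {n} (u : Vertex n) ρ x i → lookup (turn u ρ x) i ≡ lookup u i xor (lookup u (ρ i) xor lookup x (ρ i))
lookup-turn u ρ x i = VP.lookup∘tabulate _ i

xor-cancel : ∀ x y → x xor (x xor y) ≡ y
xor-cancel x y = trans (sym (BP.xor-assoc x x y)) (cong (_xor y) (BP.xor-same x))

turn-∘ : ∀ {n} (u : Vertex n) ρ σ x → turn u ρ (turn u σ x) ≡ turn u (σ ∘ ρ) x
turn-∘ u ρ σ x = VP.tabulate-cong (λ i → cong (lookup u i xor_)
  (trans (cong (lookup u (ρ i) xor_) (lookup-turn u σ x (ρ i))) (xor-cancel (lookup u (ρ i)) _)))

turn-id : ∀ {n} (u : Vertex n) {ρ} → (∀ i → ρ i ≡ i) → ∀ x → turn u ρ x ≡ x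
turn-id u {ρ} h x = vertex-ext (λ i → trans (lookup-turn u ρ x i)
  (trans (cong (λ j → lookup u i xor (lookup u j xor lookup x j)) (h i)) (xor-cancel (lookup u i) (lookup x i))))

turn-fixes : ∀ {n} (u : Vertex n) ρ → turn u ρ u ≡ u
turn-fixes u ρ = vertex-ext (λ i → trans (lookup-turn u ρ u i)
  (trans (cong (lookup u i xor_) (BP.xor-same (lookup u (ρ i)))) (BP.xor-identityʳ (lookup u i))))

xor-notʳ : ∀ x y → x xor not y ≡ not (x xor y)
xor-notʳ true y = refl
xor-notʳ false y = refl

turn-flipAt : ∀ {n} (u : Vertex n) {ρ} → (∀ {i j} → ρ i ≡ ρ j → i ≡ j) → ∀ x j →
  turn u ρ (flipAt x (ρ j)) ≡ flipAt (turn u ρ x) j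
turn-flipAt u {ρ} inj x j = vertex-ext go
  where
  go : ∀ i → lookup (turn u ρ (flipAt x (ρ j))) i ≡ lookup (flipAt (turn u ρ x) j) i
  go i with i F.≟ j
  ... | yes refl = trans (lookup-turn u ρ (flipAt x (ρ i)) i)
        (trans (cong (λ t → lookup u i xor (lookup u (ρ i) xor t)) (lookup-flipAt-same x (ρ i)))
        (trans (cong (lookup u i xor_) (xor-notʳ (lookup u (ρ i)) _)) (trans (xor-notʳ (lookup u i) _)
        (sym (trans (lookup-flipAt-same (turn u ρ x) i) (cong not (lookup-turn u ρ x i)))))))
  ... | no i≢j = trans (lookup-turn u ρ (flipAt x (ρ j)) i)
        (trans (cong (λ t → lookup u i xor (lookup u (ρ i) xor t)) (lookup-flipAt-other x (i≢j ∘ inj)))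
        (sym (trans (lookup-flipAt-other (turn u ρ x) i≢j) (lookup-turn u ρ x i))))

module _ {n} (u : Vertex n) {a b c : Fin n} (a≢b : a ≢ b) (a≢c : a ≢ c) (b≢c : b ≢ c) where

  private
    ρ = threeCycle a b c

  threeCycle-injective : ∀ {i j} → ρ i ≡ ρ j → i ≡ j
  threeCycle-injective {i} {j} eq = trans (sym (inverse i)) (trans (cong (threeCycle b c a ∘ threeCycle c a b) eq) (inverse j))
    where
    inverse = threeCycle-cubed b≢c (a≢b ∘ sym) (a≢c ∘ sym)

  turn-cubed : ∀ x → turn u (threeCycle c a b) (turn u (threeCycle b c a) (turn u ρ x)) ≡ x
  turn-cubed x = trans (cong (turn u (threeCycle c a b)) (turn-∘ u (threeCycle b c a) ρ x))
    (trans (turn-∘ u (threeCycle c a b) _ x) (turn-id u (threeCycle-cubed a≢b a≢c b≢c) x))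

  turn-injective : ∀ {x y} → turn u ρ x ≡ turn u ρ y → x ≡ y
  turn-injective {x} {y} eq = trans (sym (turn-cubed x))
    (trans (cong (turn u (threeCycle c a b) ∘ turn u (threeCycle b c a)) eq) (turn-cubed y))

  turn-adjacent : ∀ x i → ∃ λ j → turn u ρ (flipAt x i) ≡ flipAt (turn u ρ x) j
  turn-adjacent x i = j , trans (cong (turn u ρ ∘ flipAt x) (sym (threeCycle-cubed a≢b a≢c b≢c i)))
                              (turn-flipAt u threeCycle-injective x j)
    where
    j = threeCycle b c a (threeCycle c a b i)

  private
    step : ∀ {i j} → ρ j ≡ i → ∀ {x y} → turn u ρ x ≡ y → turn u ρ (flipAt x i) ≡ flipAt y j
    step {j = j} refl {x} refl = turn-flipAt u threeCycle-injective x j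

  turn-step-a : ∀ {x y} → turn u ρ x ≡ y → turn u ρ (flipAt x a) ≡ flipAt y b
  turn-step-a {x} = step (threeCycle-b a≢b) {x}

  turn-step-b : ∀ {x y} → turn u ρ x ≡ y → turn u ρ (flipAt x b) ≡ flipAt y c
  turn-step-b {x} = step (threeCycle-c a≢c b≢c) {x}

  turn-step-c : ∀ {x y} → turn u ρ x ≡ y → turn u ρ (flipAt x c) ≡ flipAt y a
  turn-step-c {x} = step (threeCycle-a {a = a} {b} {c}) {x}

path : ∀ {n} → Vertex n → Fin n → Fin n → Fin n → List (Vertex n) → List (Vertex n)
path u a b c t = u ∷ flipAt u a ∷ flipAt (flipAt u a) b ∷ flipAt (flipAt (flipAt u a) b) c ∷ t

-- The first three consecutive steps in distinct directions a, b, c start at u; a vertex precedes them when the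
-- first three steps are b, a, b.
data Frame {n} (vs : List (Vertex n)) (u : Vertex n) (a b c : Fin n) : Set where
  front : ∀ t → vs ≡ path u a b c t → Frame vs u a b c
  back  : ∀ t → vs ≡ flipAt u b ∷ path u a b c t → Frame vs u a b c

record Turned {n} (vs ws : List (Vertex n)) : Set where
  constructor turned
  field
    {u} : Vertex n
    {a b c} : Fin n
    a≢b : a ≢ b
    a≢c : a ≢ c
    b≢c : b ≢ c
    frame : Frame vs u a b c
    image : ws ≡ map (turn u (threeCycle a b c)) vs

private
  path-injective : ∀ {n} {u u′ : Vertex n} {a b c a′ b′ c′ t t′} → path u a b c t ≡ path u′ a′ b′ c′ t′ →
    u ≡ u′ × a ≡ a′ × b ≡ b′ × c ≡ c′
  path-injective {u = u} {a = a} {b} eq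
    with LP.∷-injective eq
  ... | refl , eq₁ with LP.∷-injective eq₁
  ... | p , eq₂ with flipAt-index-injective u p
  ... | refl with LP.∷-injective eq₂
  ... | q , eq₃ with flipAt-index-injective (flipAt u a) q
  ... | refl = refl , refl , refl , flipAt-index-injective (flipAt (flipAt u a) b) (LP.∷-injectiveˡ eq₃)

  front≢back : ∀ {n} {u u′ : Vertex n} {a b c a′ b′ c′ t t′} → a ≢ c →
    path u a b c t ≡ flipAt u′ b′ ∷ path u′ a′ b′ c′ t′ → ⊥
  front≢back {u′ = u′} {a} {b} {c} {a′} {b′} a≢c eq
    with LP.∷-injective eq
  ... | refl , eq₁ with LP.∷-injective eq₁
  ... | p , eq₂ with flipAt-index-injective (flipAt u′ b′) (trans p (sym (flipAt-involutive u′ b′)))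
  ... | refl with LP.∷-injective eq₂
  ... | q , eq₃ with flipAt-index-injective u′ (trans (cong (λ x → flipAt x b) (sym p)) q)
  ... | refl = a≢c (sym (flipAt-index-injective (flipAt u′ b) (trans (cong (λ x → flipAt x c) (sym q)) (LP.∷-injectiveˡ eq₃))))

-- A `back` sequence begins with steps b, a, b, so its first and third directions agree, whereas in
-- a `front` sequence they are the distinct `a` and `c`. Thus the frame, and with it the turn, can
-- be read off from the sequence.
frame-unique : ∀ {n} {vs : List (Vertex n)} {u u′ a b c a′ b′ c′} → a ≢ c → a′ ≢ c′ →
  Frame vs u a b c → Frame vs u′ a′ b′ c′ → u ≡ u′ × a ≡ a′ × b ≡ b′ × c ≡ c′
frame-unique a≢c _ (front t refl) (front t′ eq) = path-injective eq
frame-unique a≢c _ (front t refl) (back t′ eq) = ⊥-elim (front≢back a≢c eq)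
frame-unique _ a′≢c′ (back t eq) (front t′ refl) = ⊥-elim (front≢back a′≢c′ eq)
frame-unique _ _ (back t refl) (back t′ eq) = path-injective (LP.∷-injectiveʳ eq)

-- The turn fixes `u` and advances the directions cyclically. A preceding vertex `flipAt u b` goes
-- to `flipAt u c`, the flip in the new middle direction, so the image of a `back` frame is again a
-- `back` frame.
frame-turn : ∀ {n} {vs : List (Vertex n)} {u a b c} → a ≢ b → a ≢ c → b ≢ c → Frame vs u a b c →
  Frame (map (turn u (threeCycle a b c)) vs) u b c a
frame-turn {u = u} {a} {b} {c} a≢b a≢c b≢c = go
  where
  f = turn u (threeCycle a b c)
  image : ∀ t → map f (path u a b c t) ≡ path u b c a (map f t)
  image t = cong₂ _∷_ p₀ (cong₂ _∷_ p₁ (cong₂ _∷_ p₂ (cong₂ _∷_ p₃ refl)))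
    where
    p₀ : f u ≡ u
    p₀ = turn-fixes u _
    p₁ : f (flipAt u a) ≡ flipAt u b
    p₁ = turn-step-a u a≢b a≢c b≢c {u} p₀
    p₂ : f (flipAt (flipAt u a) b) ≡ flipAt (flipAt u b) c
    p₂ = turn-step-b u a≢b a≢c b≢c {flipAt u a} p₁
    p₃ : f (flipAt (flipAt (flipAt u a) b) c) ≡ flipAt (flipAt (flipAt u b) c) a
    p₃ = turn-step-c u a≢b a≢c b≢c {flipAt (flipAt u a) b} p₂
  go : ∀ {vs} → Frame vs u a b c → Frame (map f vs) u b c a
  go (front t refl) = front (map f t) (image t)
  go (back t refl) = back (map f t) (cong₂ _∷_ (turn-step-b u a≢b a≢c b≢c {u} (turn-fixes u _)) (image t))

turned-cubed : ∀ {n} {x y z w : List (Vertex n)} → Turned x y → Turned y z → Turned z w → w ≡ x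
turned-cubed {x = x} (turned {u} {a} {b} {c} a≢b a≢c b≢c f refl) (turned b≢c′ b≢a′ c≢a′ g refl) (turned c≢a″ c≢b″ a≢b″ h refl)
  with frame-unique (a≢b ∘ sym) b≢a′ (frame-turn a≢b a≢c b≢c f) g
... | refl , refl , refl , refl with frame-unique (b≢c ∘ sym) c≢b″ (frame-turn b≢c′ b≢a′ c≢a′ g) h
... | refl , refl , refl , refl = trans (sym (LP.map-∘ (map (turn u (threeCycle a b c)) x)))
      (trans (sym (LP.map-∘ x)) (trans (LP.map-cong (turn-cubed u a≢b a≢c b≢c) x) (LP.map-id x)))

joined-edgesQ⁺ : ∀ {n} (v : Vertex n) i → Joined (edgesQ n) v (flipAt v i)
joined-edgesQ⁺ v i with lookup v i in eq
... | false = (v , i) , ∈-edgesQ⁺ eq , inj₁ (refl , refl)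
... | true = (flipAt v i , i) , ∈-edgesQ⁺ (trans (lookup-flipAt-same v i) (cong not eq)) , inj₂ (refl , sym (flipAt-involutive v i))

joined⇒flipAt : ∀ {n} {S : List (Edge n)} {a b} → Joined S a b → ∃ λ i → b ≡ flipAt a i
joined⇒flipAt ((v , i) , _ , inj₁ (refl , refl)) = i , refl
joined⇒flipAt ((v , i) , _ , inj₂ (refl , refl)) = i , sym (flipAt-involutive v i)

cycPairs-map : {A B : Set} (f : A → B) (vs : List A) → cycPairs (map f vs) ≡ map (λ p → f (proj₁ p) , f (proj₂ p)) (cycPairs vs)
cycPairs-map f [] = refl
cycPairs-map f (x ∷ xs) = trans (cong (zip (f x ∷ map f xs)) (sym (LP.map-++ f xs [ x ])))
  (trans (LP.zipWith-map _,_ f f (x ∷ xs) (xs ++ [ x ])) (sym (LP.map-zipWith _,_ _ (x ∷ xs) (xs ++ [ x ]))))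

inside-map : ∀ {k n} {S : List (Edge k)} {S′ : List (Edge n)} (f : Vertex k → Vertex n) → (∀ {x y} → f x ≡ f y → x ≡ y) →
  (∀ {x y} → Joined S x y → Joined S′ (f x) (f y)) → ∀ {vs} → Inside S vs → Inside S′ (map f vs)
inside-map {S′ = S′} f inj hom {vs} (u , h) = UP.map⁺ inj u , h′
  where
  h′ : ∀ {a b} → (a , b) ∈ cycPairs (map f vs) → Joined S′ a b
  h′ p with ∈-map⁻ _ (subst (_ ∈_) (cycPairs-map f vs) p)
  ... | _ , q , refl = hom (h q)

turned-inside : ∀ {n} {vs ws : List (Vertex n)} → Inside (edgesQ n) vs → Turned vs ws → Inside (edgesQ n) ws
turned-inside {n} ins (turned {u} {a} {b} {c} a≢b a≢c b≢c _ refl) = inside-map f (turn-injective u a≢b a≢c b≢c) hom ins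
  where
  f = turn u (threeCycle a b c)
  hom : ∀ {x y} → Joined (edgesQ n) x y → Joined (edgesQ n) (f x) (f y)
  hom {x} j with joined⇒flipAt j
  ... | i , refl with turn-adjacent u a≢b a≢c b≢c x i
  ... | k , eq = subst (Joined (edgesQ n) (f x)) (sym eq) (joined-edgesQ⁺ (f x) k)

-- Consecutive directions differ. If the third direction repeats the first, the fourth differs from
-- the second too, since otherwise the four steps would close a square and the fifth vertex would
-- equal the first; then steps two to four form the frame.
frame-exists : ∀ {n} {vs : List (Vertex n)} → 5 ≤ length vs → Inside (edgesQ n) vs → ∃ (Turned vs)
frame-exists {vs = []} () _
frame-exists {vs = _ ∷ []} (s≤s ()) _
frame-exists {vs = _ ∷ _ ∷ []} (s≤s (s≤s ())) _
frame-exists {vs = _ ∷ _ ∷ _ ∷ []} (s≤s (s≤s (s≤s ()))) _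
frame-exists {vs = _ ∷ _ ∷ _ ∷ _ ∷ []} (s≤s (s≤s (s≤s (s≤s ())))) _
frame-exists {vs = v₀ ∷ v₁ ∷ v₂ ∷ v₃ ∷ v₄ ∷ t} _
  (((_ ∷ v₀≢v₂ ∷ _ ∷ v₀≢v₄ ∷ _) ∷ (_ ∷ v₁≢v₃ ∷ _) ∷ (_ ∷ v₂≢v₄ ∷ _) ∷ _) , h)
  with joined⇒flipAt (h (here refl)) | joined⇒flipAt (h (there (here refl)))
     | joined⇒flipAt (h (there (there (here refl)))) | joined⇒flipAt (h (there (there (there (here refl)))))
... | i , refl | j , refl | k , refl | l , refl = go (i F.≟ k)
  where
  back-and-forth : ∀ v {x y} → v ≢ flipAt (flipAt v x) y → x ≢ y
  back-and-forth v {x} v≢ refl = v≢ (sym (flipAt-involutive v x))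
  i≢j = back-and-forth v₀ v₀≢v₂
  j≢k = back-and-forth v₁ v₁≢v₃
  k≢l = back-and-forth v₂ v₂≢v₄
  square : ∀ v x y → flipAt (flipAt (flipAt (flipAt v x) y) x) y ≡ v
  square v x y = trans (cong (λ w → flipAt w y) (flipAt-commutes (flipAt v x) y x))
    (trans (flipAt-involutive (flipAt (flipAt v x) x) y) (flipAt-involutive v x))
  go : Dec (i ≡ k) → ∃ (Turned (v₀ ∷ v₁ ∷ v₂ ∷ v₃ ∷ v₄ ∷ t))
  go (no i≢k) = _ , turned i≢j i≢k j≢k (front (v₄ ∷ t) refl) refl
  go (yes refl) = _ , turned j≢k j≢l k≢l (back t (cong (_∷ v₁ ∷ v₂ ∷ v₃ ∷ v₄ ∷ t) (sym (flipAt-involutive v₀ i)))) refl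
    where
    j≢l : j ≢ l
    j≢l refl = v₀≢v₄ (sym (square v₀ i j))

frame-joined : ∀ {n} {S : List (Edge n)} {vs u a b c} → Inside S vs → Frame vs u a b c →
  Unique (path u a b c []) × Joined S u (flipAt u a) × Joined S (flipAt u a) (flipAt (flipAt u a) b)
    × Joined S (flipAt (flipAt u a) b) (flipAt (flipAt (flipAt u a) b) c)
frame-joined (u , h) (front t refl) = UP.take⁺ 4 u , h (here refl) , h (there (here refl)) , h (there (there (here refl)))
frame-joined (_ ∷ u , h) (back t refl) = UP.take⁺ 4 u , h (there (here refl)) , h (there (there (here refl))) , h (there (there (there (here refl))))

-- The paths from u with directions a, b, c and b, c, a bound a hexagon.
turned-disjoint : ∀ {n} {S : List (Edge n)} {vs ws} → (∀ {hs} → length hs ≡ 6 → Inside S hs → ⊥) →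
  Inside S vs → Inside S ws → Turned vs ws → ⊥
turned-disjoint {S = S} free ins ins′ (turned {u} {a} {b} {c} a≢b a≢c b≢c f refl)
  with frame-joined ins f | frame-joined ins′ (frame-turn a≢b a≢c b≢c f)
... | ((u≢ua ∷ u≢uab ∷ u≢uabc ∷ []) ∷ (ua≢uab ∷ ua≢uabc ∷ []) ∷ (uab≢uabc ∷ []) ∷ _) , j₁ , j₂ , j₃
    | ((u≢ub ∷ u≢ubc ∷ _) ∷ (ub≢ubc ∷ ub≢uabc′ ∷ []) ∷ (ubc≢uabc′ ∷ []) ∷ _) , k₁ , k₂ , k₃ = free {hexagon} refl (uniq , joined)
  where
  ua = flipAt u a
  ub = flipAt u b
  uab = flipAt ua b
  ubc = flipAt ub c
  uabc = flipAt uab c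
  hexagon = u ∷ ua ∷ uab ∷ uabc ∷ ubc ∷ ub ∷ []
  -- Both paths end at the vertex opposite to `u` in the subcube of the three directions.
  corner : flipAt ubc a ≡ uabc
  corner = trans (flipAt-commutes ub c a) (cong (λ x → flipAt x c) (flipAt-commutes u b a))
  k₃′ : Joined S ubc uabc
  k₃′ = subst (Joined S ubc) corner k₃
  at : ∀ {x : Vertex _} {i j} → i ≢ j → ∀ {b} → lookup x i ≡ b → lookup (flipAt x j) i ≡ b
  at {x} i≢j eq = trans (lookup-flipAt-other x i≢j) eq
  ua≢ubc : ua ≢ ubc
  ua≢ubc eq = ≢not (trans (sym (at {u} (a≢c ∘ sym) refl)) (trans (cong (λ x → lookup x c) eq)
    (trans (lookup-flipAt-same ub c) (cong not (at {u} (b≢c ∘ sym) refl)))))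
  ua≢ub : ua ≢ ub
  ua≢ub eq = a≢b (flipAt-index-injective u eq)
  uab≢ub : uab ≢ ub
  uab≢ub eq = flipAt≢ u a (flipAt-injective b eq)
  uab≢ubc : uab ≢ ubc
  uab≢ubc eq = a≢c (flipAt-index-injective ub (trans (flipAt-commutes u b a) eq))
  uniq : Unique hexagon
  uniq =
    (u≢ua ∷ u≢uab ∷ u≢uabc ∷ u≢ubc ∷ u≢ub ∷ [])
    ∷ (ua≢uab ∷ ua≢uabc ∷ ua≢ubc ∷ ua≢ub ∷ [])
    ∷ (uab≢uabc ∷ uab≢ubc ∷ uab≢ub ∷ [])
    ∷ ((λ eq → ubc≢uabc′ (trans (sym eq) (sym corner))) ∷ (λ eq → ub≢uabc′ (trans (sym eq) (sym corner))) ∷ [])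
    ∷ ((ub≢ubc ∘ sym) ∷ [])
    ∷ [] ∷ []
  joined : ∀ {x y} → (x , y) ∈ cycPairs hexagon → Joined S x y
  joined (here refl) = j₁
  joined (there (here refl)) = j₂
  joined (there (there (here refl))) = j₃
  joined (there (there (there (here refl)))) = joined-sym k₃′
  joined (there (there (there (there (here refl))))) = joined-sym k₂
  joined (there (there (there (there (there (here refl)))))) = joined-sym k₁

cyclesIn≤third : ∀ {n m} {S : List (Edge n)} → 5 ≤ m → (∀ {e} → e ∈ S → e ∈ edgesQ n) →
  (∀ {hs} → length hs ≡ 6 → Inside S hs → ⊥) → 3 * length (cyclesIn m S) ≤ length (cyclesIn m (edgesQ n))
cyclesIn≤third {n} {m} {S} m≥5 sub free = ℕP.≤-trans (ℕP.*-monoʳ-≤ 3 fewer)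
  (orbits-of-three Turned (insideᵇ S) (cyclesIn-unique m (edgesQ n)) exists closed (λ _ → turned-cubed)
    (λ {vs} {ws} _ f p q → turned-disjoint {S = S} free (inside⁻ S vs p) (inside⁻ S ws q) f))
  where
  mono : ∀ {vs} → Inside S vs → Inside (edgesQ n) vs
  mono (u , h) = u , λ p → let e , e∈ , j = h p in e , sub e∈ , j
  fewer : length (cyclesIn m S) ≤ length (filterᵇ (insideᵇ S) (cyclesIn m (edgesQ n)))
  fewer = subset⇒length≤ (cyclesIn-unique m S) λ vs∈ → let l , i = ∈-cyclesIn⁻ m S vs∈ in
    ∈-filterᵇ⁺ (insideᵇ S) {xs = cyclesIn m (edgesQ n)} (∈-cyclesIn⁺ l (mono i)) (inside⁺ i)
  exists : ∀ {vs} → vs ∈ cyclesIn m (edgesQ n) → ∃ (Turned vs)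
  exists vs∈ with ∈-cyclesIn⁻ m (edgesQ n) vs∈
  ... | refl , ins = frame-exists m≥5 ins
  closed : ∀ {vs ws} → vs ∈ cyclesIn m (edgesQ n) → Turned vs ws → ws ∈ cyclesIn m (edgesQ n)
  closed {vs} vs∈ f@(turned _ _ _ _ refl) with ∈-cyclesIn⁻ m (edgesQ n) vs∈
  ... | refl , ins = ∈-cyclesIn⁺ (LP.length-map _ vs) (turned-inside ins f)

-- Hexagon-free layers

parity : ∀ {n} → Vertex n → Bool
parity [] = false
parity (x ∷ v) = x xor parity v

parityBefore : ∀ {n} → Vertex n → Fin n → Bool
parityBefore (x ∷ v) zero = false
parityBefore (x ∷ v) (suc i) = x xor parityBefore v i

_<ᵇ_ : ∀ {n} → Fin n → Fin n → Bool
zero <ᵇ zero = false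
zero <ᵇ suc j = true
suc i <ᵇ zero = false
suc i <ᵇ suc j = i <ᵇ j

<ᵇ-not : ∀ {n} {i j : Fin n} → i ≢ j → (i <ᵇ j) ≡ not (j <ᵇ i)
<ᵇ-not {i = zero} {zero} i≢j = contradiction refl i≢j
<ᵇ-not {i = zero} {suc j} _ = refl
<ᵇ-not {i = suc i} {zero} _ = refl
<ᵇ-not {i = suc i} {suc j} i≢j = <ᵇ-not (i≢j ∘ cong suc)

parity-flipAt : ∀ {n} (v : Vertex n) i → parity (flipAt v i) ≡ not (parity v)
parity-flipAt (x ∷ v) zero = sym (BP.not-distribˡ-xor x (parity v))
parity-flipAt (x ∷ v) (suc i) = trans (cong (x xor_) (parity-flipAt v i)) (xor-notʳ x (parity v))

parityBefore-flipAt : ∀ {n} (v : Vertex n) j i → parityBefore (flipAt v j) i ≡ parityBefore v i xor (j <ᵇ i)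
parityBefore-flipAt (x ∷ v) zero zero = refl
parityBefore-flipAt (x ∷ v) zero (suc i) = not-xor x (parityBefore v i)
  where
  not-xor : ∀ x y → not x xor y ≡ (x xor y) xor true
  not-xor true y = sym (trans (BP.xor-comm (not y) true) (BP.not-involutive y))
  not-xor false y = BP.xor-comm true y
parityBefore-flipAt (x ∷ v) (suc j) zero = refl
parityBefore-flipAt (x ∷ v) (suc j) (suc i) = trans (cong (x xor_) (parityBefore-flipAt v j i)) (sym (BP.xor-assoc x _ _))

-- For constant `s` these are the classes of the classical colouring of the edges in four colours
-- without a monochromatic hexagon; `s` twists it separately for each direction. Fixing the parity
-- of the lower endpoint keeps every walk in a layer between two consecutive levels of the cube.
layerᵇ : ∀ {n} → Vec Bool n → Bool → Edge n → Bool
layerᵇ s p (v , i) = ⌊ parity v B.≟ p ⌋ ∧ ⌊ parityBefore v i B.≟ lookup s i ⌋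

layer : ∀ {n} → Vec Bool n → Bool → List (Edge n)
layer {n} s p = filterᵇ (layerᵇ s p) (edgesQ n)

record Lower {n} (s : Vec Bool n) (p : Bool) (v : Vertex n) (i : Fin n) : Set where
  constructor lower
  field
    zeroAt : lookup v i ≡ false
    par    : parity v ≡ p
    before : parityBefore v i ≡ lookup s i

open Lower

layer⊆edgesQ : ∀ {n} {s : Vec Bool n} {p e} → e ∈ layer s p → e ∈ edgesQ n
layer⊆edgesQ {n} {s} {p} e∈ = proj₁ (∈-filterᵇ⁻ (layerᵇ s p) (edgesQ n) e∈)

layer-unique : ∀ {n} (s : Vec Bool n) p → Unique (layer s p)
layer-unique {n} s p = unique-filterᵇ (layerᵇ s p) (edgesQ-unique n)

∈-layer⁺ : ∀ {n} {s : Vec Bool n} {p v i} → Lower s p v i → (v , i) ∈ layer s p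
∈-layer⁺ {s = s} {p} {v} (lower z q b) =
  ∈-filterᵇ⁺ (layerᵇ s p) (∈-edgesQ⁺ z) (T-∧⁺ {⌊ parity v B.≟ p ⌋} (fromWitness q) (fromWitness b))

∈-layer⁻ : ∀ {n} {s : Vec Bool n} {p v i} → (v , i) ∈ layer s p → Lower s p v i
∈-layer⁻ {n} {s} {p} {v} {i} e∈ with ∈-filterᵇ⁻ (layerᵇ s p) (edgesQ n) e∈
... | e∈Q , t with T-∧⁻ {⌊ parity v B.≟ p ⌋} t
... | q , b = lower (∈-edgesQ⁻ e∈Q) (toWitness q) (toWitness b)

joined-layer-up : ∀ {n} {s : Vec Bool n} {p a b} → Joined (layer s p) a b → parity a ≡ p →
  ∃ λ i → b ≡ flipAt a i × Lower s p a i
joined-layer-up ((v , i) , e∈ , inj₁ (refl , refl)) q = i , refl , ∈-layer⁻ e∈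
joined-layer-up {s = s} {p} ((v , i) , e∈ , inj₂ (refl , refl)) q =
  contradiction (trans (par (∈-layer⁻ {s = s} {p} e∈)) (trans (sym q) (parity-flipAt v i))) ≢not

joined-layer-parity : ∀ {n} (s : Vec Bool n) p {a b} → Joined (layer s p) a b → parity a ≢ p → parity b ≡ p
joined-layer-parity s p ((v , i) , e∈ , inj₁ (refl , refl)) q = contradiction (par (∈-layer⁻ {s = s} {p} e∈)) q
joined-layer-parity s p ((v , i) , e∈ , inj₂ (refl , refl)) q = par (∈-layer⁻ {s = s} {p} e∈)

-- Around the hexagon the steps go up in `a`, down in `b`, up in `c`, down in `d`, up in `e`, down
-- in `f`. Coordinate `a`, raised by the first step, must be lowered again; neither `b` nor `f` does
-- it, so `d` does.
opposite-steps-agree : ∀ {n} {x y z : Vertex n} {a b c d e f} →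
  lookup x a ≡ false → lookup y c ≡ false → lookup z e ≡ false →
  flipAt x a ≡ flipAt y b → flipAt y c ≡ flipAt z d → flipAt z e ≡ flipAt x f → a ≢ b → a ≢ f → d ≡ a
opposite-steps-agree {x = x} {y} {z} {a} {b} {c} {d} {e} {f} xa yc ze xy yz zx a≢b a≢f with d F.≟ a
... | yes d≡a = d≡a
... | no d≢a = ⊥-elim (true≢false (trans (sym x′a) xa))
  where
  true≢false : true ≢ false
  true≢false ()
  ya : lookup y a ≡ true
  ya = trans (sym (lookup-flipAt-other y a≢b)) (trans (cong (λ w → lookup w a) (sym xy)) (trans (lookup-flipAt-same x a) (cong not xa)))
  a≢c : a ≢ c
  a≢c refl = true≢false (trans (sym ya) yc)
  za : lookup z a ≡ true
  za = trans (sym (lookup-flipAt-other z (d≢a ∘ sym))) (trans (cong (λ w → lookup w a) (sym yz)) (trans (lookup-flipAt-other y a≢c) ya))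
  a≢e : a ≢ e
  a≢e refl = true≢false (trans (sym za) ze)
  x′a : lookup x a ≡ true
  x′a = trans (sym (lookup-flipAt-other x a≢f)) (trans (cong (λ w → lookup w a) (sym zx)) (trans (lookup-flipAt-other z a≢e) za))

-- The parity before `a` at the common upper vertex can be computed from `x` or from `y`. As the two
-- starting values agree, the flips in `b` and in `c` change it alike.
equal-shift : ∀ {n} {x y : Vertex n} {a b c} → flipAt x b ≡ flipAt y c → parityBefore x a ≡ parityBefore y a →
  (b <ᵇ a) ≡ (c <ᵇ a)
equal-shift {x = x} {y} {a} {b} {c} eq h = cancel (parityBefore y a)
  (trans (cong (_xor (b <ᵇ a)) (sym h)) (trans (sym (parityBefore-flipAt x b a))
    (trans (cong (λ w → parityBefore w a) eq) (parityBefore-flipAt y c a))))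
  where
  cancel : ∀ t {u v} → t xor u ≡ t xor v → u ≡ v
  cancel t {u} {v} e = trans (sym (xor-cancel t u)) (trans (cong (t xor_) e) (xor-cancel t v))

-- Opposite edges of a hexagon have the same direction, so its directions are a, e, c, a, e, c; comparing the
-- parities before c, before e and before a gives [a < c] = [e < c], [c < e] = [a < e] and [e < a] = [c < a].
no-hexagon : ∀ {n} {s : Vec Bool n} {p x y z a b c d e f} →
  Lower s p x a → Lower s p y b → Lower s p y c → Lower s p z d → Lower s p z e → Lower s p x f →
  flipAt x a ≡ flipAt y b → flipAt y c ≡ flipAt z d → flipAt z e ≡ flipAt x f →
  a ≢ b → a ≢ f → c ≢ d → c ≢ b → e ≢ f → e ≢ d → ⊥
no-hexagon {x = x} {y} {z} {a} {b} {c} {d} {e} {f} xa yb yc zd ze xf xy yz zx a≢b a≢f c≢d c≢b e≢f e≢d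
  with opposite-steps-agree (zeroAt xa) (zeroAt yc) (zeroAt ze) xy yz zx a≢b a≢f
     | opposite-steps-agree (zeroAt yc) (zeroAt ze) (zeroAt xa) yz zx xy c≢d c≢b
     | opposite-steps-agree (zeroAt ze) (zeroAt xa) (zeroAt yc) zx xy yz e≢f e≢d
... | refl | refl | refl = ≢not (begin
  (a <ᵇ c)     ≡⟨ equal-shift {x = x} xy (agree xf yc) ⟩
  (e <ᵇ c)     ≡⟨ <ᵇ-not (c≢b ∘ sym) ⟩
  not (c <ᵇ e) ≡⟨ cong not (equal-shift {x = y} yz (agree yb ze)) ⟩
  not (a <ᵇ e) ≡⟨ sym (<ᵇ-not (a≢b ∘ sym)) ⟩
  (e <ᵇ a)     ≡⟨ equal-shift {x = z} zx (agree zd xa) ⟩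
  (c <ᵇ a)     ≡⟨ <ᵇ-not (a≢f ∘ sym) ⟩
  not (a <ᵇ c) ∎)
  where
  open ≡-Reasoning
  agree : ∀ {v w i} → Lower _ _ v i → Lower _ _ w i → parityBefore v i ≡ parityBefore w i
  agree l m = trans (before l) (sym (before m))

layer-no-hexagon : ∀ {n} (s : Vec Bool n) p {x u y v z w} → parity x ≡ p →
  Inside (layer s p) (x ∷ u ∷ y ∷ v ∷ z ∷ w ∷ []) → ⊥
layer-no-hexagon s p {x} {u} {y} {v} {z} {w} px
  (((_ ∷ x≢y ∷ _ ∷ x≢z ∷ _) ∷ (_ ∷ u≢v ∷ _ ∷ u≢w ∷ []) ∷ (_ ∷ y≢z ∷ _) ∷ (_ ∷ v≢w ∷ []) ∷ _) , h) =
  go (joined-layer-up xu px) (joined-layer-up (joined-sym uy) py) (joined-layer-up yv py)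
     (joined-layer-up (joined-sym vz) pz) (joined-layer-up zw pz) (joined-layer-up (joined-sym wx) px)
  where
  xu = h (here refl)
  uy = h (there (here refl))
  yv = h (there (there (here refl)))
  vz = h (there (there (there (here refl))))
  zw = h (there (there (there (there (here refl)))))
  wx = h (there (there (there (there (there (here refl))))))
  upper : ∀ {t t′} → Joined (layer s p) t t′ → parity t ≡ p → parity t′ ≢ p
  upper {t} j q r with joined⇒flipAt j
  ... | i , refl = ≢not (trans q (trans (sym r) (parity-flipAt t i)))
  py = joined-layer-parity s p uy (upper xu px)
  pz = joined-layer-parity s p vz (upper yv py)
  Step = λ t t′ → ∃ λ i → t′ ≡ flipAt t i × Lower s p t i
  step≢ : ∀ {t t′ r i j} → t′ ≡ flipAt t i → r ≡ flipAt t j → t′ ≢ r → i ≢ j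
  step≢ refl refl t≢ refl = t≢ refl
  step≢′ : ∀ {t t′ r i j} → r ≡ flipAt t i → r ≡ flipAt t′ j → t ≢ t′ → i ≢ j
  step≢′ {i = i} refl eq t≢ refl = t≢ (flipAt-injective i eq)
  go : Step x u → Step y u → Step y v → Step z v → Step z w → Step x w → ⊥
  go (a , ua , xa) (b , ub , yb) (c , vc , yc) (d , vd , zd) (e , we , ze) (f , wf , xf) =
    no-hexagon xa yb yc zd ze xf (trans (sym ua) ub) (trans (sym vc) vd) (trans (sym we) wf)
      (step≢′ ua ub x≢y) (step≢ ua wf u≢w) (step≢′ vc vd y≢z) (step≢ vc ub (u≢v ∘ sym))
      (step≢′ we wf (x≢z ∘ sym)) (step≢ we vd (v≢w ∘ sym))

inside-rotate : ∀ {n} {S : List (Edge n)} {x y xs} → Inside S (x ∷ y ∷ xs) → Inside S ((y ∷ xs) ++ [ x ])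
inside-rotate {S = S} {x} {y} {xs} (u , h) = unique-snoc u , joined
  where
  joined : ∀ {a b} → (a , b) ∈ cycPairs ((y ∷ xs) ++ [ x ]) → Joined S a b
  joined p with SameCycle.from (sameCycle-rotate x y xs) (inj₁ p)
  ... | inj₁ q = h q
  ... | inj₂ q = joined-sym (h q)

layer-hexagon-free : ∀ {n} (s : Vec Bool n) p {hs} → length hs ≡ 6 → Inside (layer s p) hs → ⊥
layer-hexagon-free s p {x ∷ u ∷ y ∷ v ∷ z ∷ w ∷ []} refl ins with parity x B.≟ p
... | yes px = layer-no-hexagon s p px ins
... | no px≢ = layer-no-hexagon s p (joined-layer-parity s p (proj₂ ins (here refl)) px≢) (inside-rotate {S = layer s p} ins)

-- Faces of the cube

-- The labels of the fixed coordinates are a parameter: a bit gives an ordinary face of the cube, a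
-- bit with a sign gives a face together with the free part of a sign vector.
data Face (A : Set) : ℕ → ℕ → Set where
  done : Face A zero zero
  free : ∀ {k n} → Face A k n → Face A (suc k) (suc n)
  fix  : ∀ {k n} → A → Face A k n → Face A k (suc n)

allFaces : {A : Set} → List A → (k n : ℕ) → List (Face A k n)
allFaces as zero zero = [ done ]
allFaces as (suc k) zero = []
allFaces as zero (suc n) = cartesianProductWith fix as (allFaces as zero n)
allFaces as (suc k) (suc n) = map free (allFaces as k n) ++ cartesianProductWith fix as (allFaces as (suc k) n)

-- This is the binomial coefficient of `n` over `k` times the power of `c` with exponent n - k, by
-- Pascal's rule on the first coordinate.
faceCount : ℕ → ℕ → ℕ → ℕ
faceCount c zero zero = 1
faceCount c (suc k) zero = 0
faceCount c zero (suc n) = c * faceCount c zero n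
faceCount c (suc k) (suc n) = faceCount c k n + c * faceCount c (suc k) n

length-cartesianProductWith : {A B C : Set} (f : A → B → C) (xs : List A) (ys : List B) →
  length (cartesianProductWith f xs ys) ≡ length xs * length ys
length-cartesianProductWith f [] ys = refl
length-cartesianProductWith f (x ∷ xs) ys = trans (LP.length-++ (map (f x) ys))
  (cong₂ _+_ (LP.length-map (f x) ys) (length-cartesianProductWith f xs ys))

length-allFaces : {A : Set} (as : List A) → ∀ k n → length (allFaces as k n) ≡ faceCount (length as) k n
length-allFaces as zero zero = refl
length-allFaces as (suc k) zero = refl
length-allFaces as zero (suc n) = trans (length-cartesianProductWith fix as (allFaces as zero n))
  (cong (length as *_) (length-allFaces as zero n))
length-allFaces as (suc k) (suc n) = trans (LP.length-++ (map free (allFaces as k n)))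
  (cong₂ _+_ (trans (LP.length-map free (allFaces as k n)) (length-allFaces as k n))
    (trans (length-cartesianProductWith fix as (allFaces as (suc k) n)) (cong (length as *_) (length-allFaces as (suc k) n))))

private
  fix-injective : ∀ {A k n} {a b : A} {φ ψ : Face A k n} → fix a φ ≡ fix b ψ → a ≡ b × φ ≡ ψ
  fix-injective refl = refl , refl

  free-injective : ∀ {A k n} {φ ψ : Face A k n} → free φ ≡ free ψ → φ ≡ ψ
  free-injective refl = refl

allFaces-unique : {A : Set} {as : List A} → Unique as → ∀ k n → Unique (allFaces as k n)
allFaces-unique u zero zero = [] ∷ []
allFaces-unique u (suc k) zero = []
allFaces-unique u zero (suc n) = UP.cartesianProductWith⁺ fix fix-injective u (allFaces-unique u zero n)
allFaces-unique {as = as} u (suc k) (suc n) = UP.++⁺ (UP.map⁺ free-injective (allFaces-unique u k n))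
  (UP.cartesianProductWith⁺ fix fix-injective u (allFaces-unique u (suc k) n)) disj
  where
  disj : ∀ {φ} → φ ∈ map free (allFaces as k n) × φ ∈ cartesianProductWith fix as (allFaces as (suc k) n) → ⊥
  disj (p , q) with ∈-map⁻ free p | ∈-cartesianProductWith⁻ fix as (allFaces as (suc k) n) q
  ... | _ , _ , refl | _ , _ , _ , _ , ()

∈-allFaces : {A : Set} {as : List A} → (∀ a → a ∈ as) → ∀ {k n} (φ : Face A k n) → φ ∈ allFaces as k n
∈-allFaces c done = here refl
∈-allFaces c (free φ) = ∈-++⁺ˡ (∈-map⁺ free (∈-allFaces c φ))
∈-allFaces c {zero} (fix a φ) = ∈-cartesianProductWith⁺ fix (c a) (∈-allFaces c φ)
∈-allFaces {as = as} c {suc k} {suc n} (fix a φ) =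
  ∈-++⁺ʳ (map free (allFaces as k n)) (∈-cartesianProductWith⁺ fix (c a) (∈-allFaces c φ))

embed : ∀ {A k n} → (A → Bool) → Face A k n → Vertex k → Vertex n
embed val done [] = []
embed val (free φ) (x ∷ v) = x ∷ embed val φ v
embed val (fix a φ) v = val a ∷ embed val φ v

direction : ∀ {A k n} → Face A k n → Fin k → Fin n
direction (free φ) zero = zero
direction (free φ) (suc i) = suc (direction φ i)
direction (fix a φ) i = suc (direction φ i)

restrict : ∀ {A k n} → Face A k n → Vertex n → Vertex k
restrict done [] = []
restrict (free φ) (x ∷ v) = x ∷ restrict φ v
restrict (fix a φ) (x ∷ v) = restrict φ v

module _ {A : Set} (val : A → Bool) where

  restrict-embed : ∀ {k n} (φ : Face A k n) v → restrict φ (embed val φ v) ≡ v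
  restrict-embed done [] = refl
  restrict-embed (free φ) (x ∷ v) = cong (x ∷_) (restrict-embed φ v)
  restrict-embed (fix a φ) v = restrict-embed φ v

  embed-injective : ∀ {k n} (φ : Face A k n) {v w} → embed val φ v ≡ embed val φ w → v ≡ w
  embed-injective φ {v} {w} eq = trans (sym (restrict-embed φ v)) (trans (cong (restrict φ) eq) (restrict-embed φ w))

  embed-flipAt : ∀ {k n} (φ : Face A k n) v i → embed val φ (flipAt v i) ≡ flipAt (embed val φ v) (direction φ i)
  embed-flipAt (free φ) (x ∷ v) zero = refl
  embed-flipAt (free φ) (x ∷ v) (suc i) = cong (x ∷_) (embed-flipAt φ v i)
  embed-flipAt (fix a φ) v i = cong (val a ∷_) (embed-flipAt φ v i)

  embed-reflects-flipAt : ∀ {k n} (φ : Face A k n) v {w j} → embed val φ w ≡ flipAt (embed val φ v) j →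
    ∃ λ i → w ≡ flipAt v i
  embed-reflects-flipAt (free φ) (x ∷ v) {y ∷ w} {zero} eq =
    zero , cong₂ _∷_ (VP.∷-injectiveˡ eq) (embed-injective φ (VP.∷-injectiveʳ eq))
  embed-reflects-flipAt (free φ) (x ∷ v) {y ∷ w} {suc j} eq with embed-reflects-flipAt φ v (VP.∷-injectiveʳ eq)
  ... | i , refl = suc i , cong (_∷ flipAt v i) (VP.∷-injectiveˡ eq)
  embed-reflects-flipAt (fix a φ) v {j = zero} eq = contradiction (VP.∷-injectiveˡ eq) ≢not
  embed-reflects-flipAt (fix a φ) v {j = suc j} eq = embed-reflects-flipAt φ v (VP.∷-injectiveʳ eq)

Contains : ∀ {k n} → Face Bool k n → Vertex n → Set
Contains φ v = embed id φ (restrict φ v) ≡ v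

widen : ∀ {k n} (φ : Face Bool k n) → k < n → ∃ λ (ψ : Face Bool (suc k) n) → ∀ v → Contains φ v → Contains ψ v
widen (free φ) (s≤s k<n) with widen φ k<n
... | ψ , h = free ψ , λ { (x ∷ v) eq → cong (x ∷_) (h v (VP.∷-injectiveʳ eq)) }
widen (fix b φ) _ = free φ , λ { (x ∷ v) eq → cong (x ∷_) (VP.∷-injectiveʳ eq) }

-- Faces spanned by cycles

unequal : Bool → Bool → ℕ
unequal x y = if x xor y then 1 else 0

hamming : ∀ {n} → Vertex n → Vertex n → ℕ
hamming [] [] = 0
hamming (x ∷ v) (y ∷ w) = unequal x y + hamming v w

cyclicLength : ∀ {n} → List (Vertex n) → ℕ
cyclicLength vs = sumBy (λ p → hamming (proj₁ p) (proj₂ p)) (cycPairs vs)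

private
  unequal-refl : ∀ x → unequal x x ≡ 0
  unequal-refl true = refl
  unequal-refl false = refl

  unequal-≢ : ∀ {x y} → x ≢ y → unequal x y ≡ 1
  unequal-≢ {true} {true} x≢y = contradiction refl x≢y
  unequal-≢ {true} {false} _ = refl
  unequal-≢ {false} {true} _ = refl
  unequal-≢ {false} {false} x≢y = contradiction refl x≢y

  hamming-refl : ∀ {n} (v : Vertex n) → hamming v v ≡ 0
  hamming-refl [] = refl
  hamming-refl (x ∷ v) = cong₂ _+_ (unequal-refl x) (hamming-refl v)

  hamming-flipAt : ∀ {n} (v : Vertex n) i → hamming v (flipAt v i) ≡ 1
  hamming-flipAt (x ∷ v) zero = cong₂ _+_ (unequal-≢ (≢not {x})) (hamming-refl v)
  hamming-flipAt (x ∷ v) (suc i) = cong₂ _+_ (unequal-refl x) (hamming-flipAt v i)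

  changes : List (Bool × Bool) → ℕ
  changes = sumBy (λ p → unequal (proj₁ p) (proj₂ p))

  changes-open : ∀ x xs y → x ≢ y → 1 ≤ changes (zip (x ∷ xs) (xs ++ [ y ]))
  changes-open x [] y x≢y = ℕP.≤-trans (ℕP.≤-reflexive (sym (unequal-≢ x≢y))) (ℕP.m≤m+n _ 0)
  changes-open x (z ∷ zs) y x≢y with z B.≟ x
  ... | yes refl = ℕP.≤-trans (changes-open x zs y x≢y) (ℕP.m≤n+m _ _)
  ... | no z≢x = ℕP.≤-trans (ℕP.≤-reflexive (sym (unequal-≢ (z≢x ∘ sym)))) (ℕP.m≤m+n _ _)

  -- A closed sequence of bits that leaves the value `x` has to return to it, which makes a second
  -- change.
  changes-closed : ∀ x xs → All (_≡ x) xs ⊎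
    (2 ≤ changes (zip (x ∷ xs) (xs ++ [ x ])) × ∃₂ λ a b → (a , b) ∈ zip (x ∷ xs) (xs ++ [ x ]) × a ≢ b)
  changes-closed x [] = inj₁ []
  changes-closed x (z ∷ zs) with z B.≟ x
  ... | no z≢x = inj₂ (ℕP.+-mono-≤ (ℕP.≤-reflexive (sym (unequal-≢ (z≢x ∘ sym)))) (changes-open z zs x z≢x)
                      , x , z , here refl , z≢x ∘ sym)
  ... | yes refl with changes-closed x zs
  ... | inj₁ all = inj₁ (refl ∷ all)
  ... | inj₂ (le , a , b , p , a≢b) = inj₂ (ℕP.≤-trans le (ℕP.m≤n+m _ _) , a , b , there p , a≢b)

  sumBy-+ : {A : Set} (f g : A → ℕ) (xs : List A) → sumBy (λ x → f x + g x) xs ≡ sumBy f xs + sumBy g xs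
  sumBy-+ f g [] = refl
  sumBy-+ f g (x ∷ xs) = trans (cong (f x + g x +_) (sumBy-+ f g xs)) (interchange (f x) (g x) (sumBy f xs) (sumBy g xs))

  sumBy-cong : {A : Set} {f g : A → ℕ} (xs : List A) → (∀ {x} → x ∈ xs → f x ≡ g x) → sumBy f xs ≡ sumBy g xs
  sumBy-cong [] h = refl
  sumBy-cong (x ∷ xs) h = cong₂ _+_ (h (here refl)) (sumBy-cong xs (h ∘ there))

  sumBy-cycPairs-map : {A B : Set} (f : B × B → ℕ) (g : A → B) (vs : List A) →
    sumBy f (cycPairs (map g vs)) ≡ sumBy (λ p → f (g (proj₁ p) , g (proj₂ p))) (cycPairs vs)
  sumBy-cycPairs-map f g vs = trans (cong (sumBy f) (cycPairs-map g vs)) (cong sum (sym (LP.map-∘ (cycPairs vs))))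

  cyclicLength-suc : ∀ {n} (vs : List (Vertex (suc n))) →
    cyclicLength vs ≡ changes (cycPairs (map Vec.head vs)) + cyclicLength (map Vec.tail vs)
  cyclicLength-suc vs = trans (sumBy-cong (cycPairs vs) (λ {p} _ → split (proj₁ p) (proj₂ p)))
    (trans (sumBy-+ _ _ (cycPairs vs))
      (sym (cong₂ _+_ (sumBy-cycPairs-map _ Vec.head vs) (sumBy-cycPairs-map _ Vec.tail vs))))
    where
    split : ∀ {n} (v w : Vertex (suc n)) → hamming v w ≡ unequal (Vec.head v) (Vec.head w) + hamming (Vec.tail v) (Vec.tail w)
    split (x ∷ v) (y ∷ w) = refl

Moves : ∀ {k n} → Face Bool k n → List (Vertex n) → Set
Moves {k} φ vs = ∀ (i : Fin k) → ∃₂ λ a b → (a , b) ∈ cycPairs vs × lookup (restrict φ a) i ≢ lookup (restrict φ b) i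

∈-cycPairs-map⁻ : {A B : Set} (f : A → B) (vs : List A) {a b : B} → (a , b) ∈ cycPairs (map f vs) →
  ∃₂ λ x y → (x , y) ∈ cycPairs vs × a ≡ f x × b ≡ f y
∈-cycPairs-map⁻ f vs p with ∈-map⁻ _ (subst (_ ∈_) (cycPairs-map f vs) p)
... | (x , y) , q , refl = x , y , q , refl , refl

-- Induction on the coordinates: one that is constant along the sequence becomes fixed; one that
-- varies becomes free and contributes at least two to the cyclic length.
spanned-face : ∀ {n} (v : Vertex n) (vs : List (Vertex n)) → ∃₂ λ k (φ : Face Bool k n) →
  All (Contains φ) (v ∷ vs) × Moves φ (v ∷ vs) × 2 * k ≤ cyclicLength (v ∷ vs)
spanned-face {zero} v vs = zero , done , All.tabulate (λ { {[]} _ → refl }) , (λ ()) , z≤n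
spanned-face {suc n} v@(x ∷ v′) vs
  with spanned-face v′ (map Vec.tail vs) | changes-closed x (map Vec.head vs)
... | k , φ , all , moves , le | inj₁ const = k , fix x φ , All.tabulate contains , moves′ ,
      ℕP.≤-trans le (ℕP.≤-trans (ℕP.m≤n+m _ _) (ℕP.≤-reflexive (sym (cyclicLength-suc (v ∷ vs)))))
  where
  contains : ∀ {w} → w ∈ v ∷ vs → Contains (fix x φ) w
  contains {y ∷ w} p = cong₂ _∷_ (sym (All.lookup (refl ∷ const) (∈-map⁺ Vec.head p))) (All.lookup all (∈-map⁺ Vec.tail p))
  moves′ : Moves (fix x φ) (v ∷ vs)
  moves′ i with moves i
  ... | a , b , p , a≢b with ∈-cycPairs-map⁻ Vec.tail (v ∷ vs) p
  ... | _ ∷ _ , _ ∷ _ , q , refl , refl = _ , _ , q , a≢b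
... | k , φ , all , moves , le | inj₂ (two , a , b , p , a≢b) = suc k , free φ , All.tabulate contains , moves′ ,
      ℕP.≤-trans (ℕP.≤-reflexive (ℕP.*-suc 2 k)) (ℕP.≤-trans (ℕP.+-mono-≤ two le) (ℕP.≤-reflexive (sym (cyclicLength-suc (v ∷ vs)))))
  where
  contains : ∀ {w} → w ∈ v ∷ vs → Contains (free φ) w
  contains {y ∷ w} p = cong (y ∷_) (All.lookup all (∈-map⁺ Vec.tail p))
  moves′ : Moves (free φ) (v ∷ vs)
  moves′ zero with ∈-cycPairs-map⁻ Vec.head (v ∷ vs) p
  ... | _ ∷ _ , _ ∷ _ , q , refl , refl = _ , _ , q , a≢b
  moves′ (suc i) with moves i
  ... | a , b , p , a≢b with ∈-cycPairs-map⁻ Vec.tail (v ∷ vs) p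
  ... | _ ∷ _ , _ ∷ _ , q , refl , refl = _ , _ , q , a≢b

cyclicLength-cycle : ∀ {n} {S : List (Edge n)} {vs} → Inside S vs → cyclicLength vs ≡ length vs
cyclicLength-cycle {vs = vs} (_ , h) = trans (sumBy-cong (cycPairs vs) (λ {p} → step {p}))
  (trans (ones (cycPairs vs)) (length-cycPairs vs))
  where
  step : ∀ {p} → p ∈ cycPairs vs → hamming (proj₁ p) (proj₂ p) ≡ 1
  step {a , _} p with joined⇒flipAt (h p)
  ... | i , refl = hamming-flipAt a i
  ones : {A : Set} (xs : List A) → sumBy (λ _ → 1) xs ≡ length xs
  ones [] = refl
  ones (x ∷ xs) = cong suc (ones xs)

∈-cycPairs⁻ : {A : Set} (vs : List A) {a b : A} → (a , b) ∈ cycPairs vs → a ∈ vs × b ∈ vs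
∈-cycPairs⁻ (x ∷ xs) p = zip-∈ˡ (x ∷ xs) (xs ++ [ x ]) p
  , Equivalence.to (snoc⇔cons xs) (zip-∈ʳ (x ∷ xs) (xs ++ [ x ]) p)

-- Used to put all cycles of small span into faces of a single dimension, so that one term bounds
-- them together.
widen-to : ∀ {k n j} (φ : Face Bool k n) → k ≤′ j → j ≤ n →
  ∃ λ (ψ : Face Bool j n) → ∀ v → Contains φ v → Contains ψ v
widen-to φ ≤′-refl _ = φ , λ _ → id
widen-to φ (≤′-step k≤j) le with widen-to φ k≤j (ℕP.<⇒≤ le)
... | ψ , h with widen ψ le
... | χ , h′ = χ , λ v → h′ v ∘ h v

allDirections : ∀ {k} → List (Edge k) → Bool
allDirections {k} S = all (λ i → any (λ e → ⌊ proj₂ e F.≟ i ⌋) S) (allFin k)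

-- By `copies-by-sequences`, for `m` = 2l these are the traversals of the copies counted by `z k l`,
-- with `2 * m` of them for each copy.
fullCycles : ∀ k m → List (List (Vertex k))
fullCycles k m = filterᵇ (λ vs → allDirections (edgesOf (edgesQ k) vs)) (cyclesIn m (edgesQ k))

embed-restrict : ∀ {k n} (φ : Face Bool k n) {vs} → All (Contains φ) vs → map (embed id φ) (map (restrict φ) vs) ≡ vs
embed-restrict φ {vs} all = trans (sym (LP.map-∘ vs)) (LP.map-id-local all)

restrict-inside : ∀ {k n} (φ : Face Bool k n) {vs} → All (Contains φ) vs → Inside (edgesQ n) vs →
  Inside (edgesQ k) (map (restrict φ) vs)
restrict-inside {k} {n} φ {vs} all (u , h) = UP.map⁻ (subst Unique (sym (embed-restrict φ all)) u) , joined
  where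
  joined : ∀ {a b} → (a , b) ∈ cycPairs (map (restrict φ) vs) → Joined (edgesQ k) a b
  joined p with ∈-cycPairs-map⁻ (restrict φ) vs p
  ... | x , y , q , refl , refl with joined⇒flipAt (h q) | ∈-cycPairs⁻ vs q
  ... | j , eq | x∈ , y∈ with embed-reflects-flipAt id φ (restrict φ x)
          (trans (All.lookup all y∈) (trans eq (cong (λ w → flipAt w j) (sym (All.lookup all x∈)))))
  ... | i , eq′ = subst (Joined (edgesQ k) (restrict φ x)) (sym eq′) (joined-edgesQ⁺ (restrict φ x) i)

differ-along-edge : ∀ {n} {v : Vertex n} {i j a b} → Joins (v , j) a b → lookup a i ≢ lookup b i → j ≡ i
differ-along-edge {v = v} {i} {j} jo a≢b with j F.≟ i
... | yes j≡i = j≡i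
... | no j≢i with jo
... | inj₁ (refl , refl) = contradiction (sym (lookup-flipAt-other v (j≢i ∘ sym))) a≢b
... | inj₂ (refl , refl) = contradiction (lookup-flipAt-other v (j≢i ∘ sym)) a≢b

moves⇒allDirections : ∀ {k} {ws : List (Vertex k)} → Inside (edgesQ k) ws →
  (∀ i → ∃₂ λ a b → (a , b) ∈ cycPairs ws × lookup a i ≢ lookup b i) → T (allDirections (edgesOf (edgesQ k) ws))
moves⇒allDirections {k} {ws} (_ , h) moves = AllP.all⁻ (λ i → any (λ e → ⌊ proj₂ e F.≟ i ⌋) E) (All.tabulate {xs = allFin k} (λ {i} _ → used i))
  where
  E = edgesOf (edgesQ k) ws
  used : ∀ i → T (any (λ e → ⌊ proj₂ e F.≟ i ⌋) E)
  used i with moves i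
  ... | a , b , p , a≢b with h p
  ... | (v , j) , e∈ , jo = AnyP.any⁺ (λ e → ⌊ proj₂ e F.≟ i ⌋)
          (lose (∈-edgesOf⁺ {S = edgesQ k} {ws} e∈ p jo) (fromWitness (differ-along-edge jo a≢b)))

bools : List Bool
bools = true ∷ false ∷ []

∈-bools : ∀ b → b ∈ bools
∈-bools true = here refl
∈-bools false = there (here refl)

bools-unique : Unique bools
bools-unique = ((λ ()) ∷ []) ∷ [] ∷ []

-- Each of the directions of a cycle of length 2(l+1) occurs twice, so the cycle spans a face of dimension l + 1
-- or lies in one of dimension l.
cycles-covered-by-faces : ∀ {n l} → l ≤ n → length (cyclesIn (2 * suc l) (edgesQ n))
  ≤ faceCount 2 (suc l) n * length (fullCycles (suc l) (2 * suc l)) + faceCount 2 l n * length (vertexSeqs l (2 * suc l))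
cycles-covered-by-faces {n} {l} l≤n = ℕP.≤-trans (subset⇒length≤ (cyclesIn-unique m (edgesQ n)) covered) (ℕP.≤-reflexive total)
  where
  m = 2 * suc l
  place : ∀ {k} → Face Bool k n → List (Vertex k) → List (Vertex n)
  place φ ws = map (embed id φ) ws
  spanning = cartesianProductWith place (allFaces bools (suc l) n) (fullCycles (suc l) m)
  smaller = cartesianProductWith place (allFaces bools l n) (vertexSeqs l m)
  total : length (spanning ++ smaller) ≡ faceCount 2 (suc l) n * length (fullCycles (suc l) m) + faceCount 2 l n * length (vertexSeqs l m)
  total = trans (LP.length-++ spanning) (cong₂ _+_
    (trans (length-cartesianProductWith place (allFaces bools (suc l) n) (fullCycles (suc l) m))
           (cong (_* length (fullCycles (suc l) m)) (length-allFaces bools (suc l) n)))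
    (trans (length-cartesianProductWith place (allFaces bools l n) (vertexSeqs l m))
           (cong (_* length (vertexSeqs l m)) (length-allFaces bools l n))))
  covered : ∀ {vs} → vs ∈ cyclesIn m (edgesQ n) → vs ∈ spanning ++ smaller
  covered {vs} vs∈ with ∈-cyclesIn⁻ m (edgesQ n) vs∈
  covered {[]} vs∈ | () , _
  covered {v ∷ vs} vs∈ | len , ins with spanned-face v vs
  ... | k , φ , all , moves , le
    with ℕP.m≤n⇒m<n∨m≡n {k} {suc l} (ℕP.*-cancelˡ-≤ 2 (ℕP.≤-trans le (ℕP.≤-reflexive (trans (cyclicLength-cycle {S = edgesQ n} ins) len))))
  ... | inj₂ refl = ∈-++⁺ˡ (subst (_∈ spanning) (embed-restrict φ all)
          (∈-cartesianProductWith⁺ place (∈-allFaces ∈-bools φ)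
            (∈-filterᵇ⁺ (λ ws → allDirections (edgesOf (edgesQ (suc l)) ws)) {xs = cyclesIn m (edgesQ (suc l))}
              (∈-cyclesIn⁺ (trans (LP.length-map (restrict φ) (v ∷ vs)) len) ins′)
              (moves⇒allDirections ins′ moves′))))
    where
    ins′ = restrict-inside φ all ins
    moves′ : ∀ i → ∃₂ λ a b → (a , b) ∈ cycPairs (map (restrict φ) (v ∷ vs)) × lookup a i ≢ lookup b i
    moves′ i with moves i
    ... | a , b , p , a≢b = restrict φ a , restrict φ b
          , subst (_ ∈_) (sym (cycPairs-map (restrict φ) (v ∷ vs))) (∈-map⁺ _ p) , a≢b
  ... | inj₁ (s≤s k≤l) with widen-to φ (ℕP.≤⇒≤′ k≤l) l≤n
  ... | ψ , h = ∈-++⁺ʳ spanning (subst (_∈ smaller) (embed-restrict ψ (All.map (λ {w} → h w) all))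
          (∈-cartesianProductWith⁺ place (∈-allFaces ∈-bools ψ)
            (subst (λ j → map (restrict ψ) (v ∷ vs) ∈ vertexSeqs l j) (trans (LP.length-map (restrict ψ) (v ∷ vs)) len)
              (∈-vertexSeqs⁺ (map (restrict ψ) (v ∷ vs))))))

-- Labelled faces and the layers that contain their cycles

Labels : Set
Labels = Bool × Bool

-- The first label is the value of the fixed coordinate, the second an arbitrary sign for its direction; the signs
-- of the free directions compensate the parity of the fixed coordinates before them.
signs : ∀ {k n} → Face Labels k n → Vec Bool k → Bool → Vec Bool n
signs done [] t = []
signs (free φ) (c ∷ s) t = (t xor c) ∷ signs φ s t
signs (fix (b , c) φ) s t = c ∷ signs φ s (b xor t)

fixedParity : ∀ {k n} → Face Labels k n → Bool
fixedParity done = false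
fixedParity (free φ) = fixedParity φ
fixedParity (fix (b , _) φ) = b xor fixedParity φ

xor-left-comm : ∀ x y z → x xor (y xor z) ≡ y xor (x xor z)
xor-left-comm x y z = trans (sym (BP.xor-assoc x y z)) (trans (cong (_xor z) (BP.xor-comm x y)) (BP.xor-assoc y x z))

lookup-embed : ∀ {k n} (φ : Face Labels k n) v i → lookup (embed proj₁ φ v) (direction φ i) ≡ lookup v i
lookup-embed (free φ) (x ∷ v) zero = refl
lookup-embed (free φ) (x ∷ v) (suc i) = lookup-embed φ v i
lookup-embed (fix _ φ) v i = lookup-embed φ v i

parity-embed : ∀ {k n} (φ : Face Labels k n) v → parity (embed proj₁ φ v) ≡ fixedParity φ xor parity v
parity-embed done [] = refl
parity-embed (free φ) (x ∷ v) = trans (cong (x xor_) (parity-embed φ v)) (xor-left-comm x (fixedParity φ) (parity v))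
parity-embed (fix (b , _) φ) v = trans (cong (b xor_) (parity-embed φ v)) (sym (BP.xor-assoc b _ _))

-- The induction strips coordinates from the left: `r` carries the parity of the free bits already
-- passed and `t` that of the fixed bits. Both are `false` at the start.
signs-match : ∀ {k n} (φ : Face Labels k n) s t r v i → r xor parityBefore v i ≡ lookup s i →
  (r xor t) xor parityBefore (embed proj₁ φ v) (direction φ i) ≡ lookup (signs φ s t) (direction φ i)
signs-match (free φ) (c ∷ s) t r (x ∷ v) zero h = trans (BP.xor-identityʳ (r xor t))
  (trans (BP.xor-comm r t) (cong (t xor_) (trans (sym (BP.xor-identityʳ r)) h)))
signs-match (free φ) (c ∷ s) t r (x ∷ v) (suc i) h = trans move (signs-match φ s t (r xor x) v i (trans (BP.xor-assoc r x _) h))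
  where
  q = parityBefore (embed proj₁ φ v) (direction φ i)
  move : (r xor t) xor (x xor q) ≡ ((r xor x) xor t) xor q
  move = trans (sym (BP.xor-assoc (r xor t) x q)) (cong (_xor q)
    (trans (BP.xor-assoc r t x) (trans (cong (r xor_) (BP.xor-comm t x)) (sym (BP.xor-assoc r x t)))))
signs-match (fix (b , _) φ) s t r v i h = trans move (signs-match φ s (b xor t) r v i h)
  where
  q = parityBefore (embed proj₁ φ v) (direction φ i)
  move : (r xor t) xor (b xor q) ≡ (r xor (b xor t)) xor q
  move = trans (sym (BP.xor-assoc (r xor t) b q)) (cong (_xor q)
    (trans (BP.xor-assoc r t b) (cong (r xor_) (BP.xor-comm t b))))

embed-layer : ∀ {k n} (φ : Face Labels k n) {s p x y} → Joined (layer s p) x y →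
  Joined (layer (signs φ s false) (fixedParity φ xor p)) (embed proj₁ φ x) (embed proj₁ φ y)
embed-layer φ {s} {p} ((v , i) , e∈ , j) = (embed proj₁ φ v , direction φ i) , ∈-layer⁺ lowered , ends j
  where
  low = ∈-layer⁻ {s = s} {p} e∈
  lowered : Lower (signs φ s false) (fixedParity φ xor p) (embed proj₁ φ v) (direction φ i)
  lowered = lower (trans (lookup-embed φ v i) (zeroAt low))
    (trans (parity-embed φ v) (cong (fixedParity φ xor_) (par low)))
    (signs-match φ s false false v i (before low))
  ends : ∀ {x y} → Joins (v , i) x y → Joins (embed proj₁ φ v , direction φ i) (embed proj₁ φ x) (embed proj₁ φ y)
  ends (inj₁ (refl , refl)) = inj₁ (refl , embed-flipAt proj₁ φ v i)
  ends (inj₂ (refl , refl)) = inj₂ (refl , embed-flipAt proj₁ φ v i)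

-- The labelled face is read back from its sign vector and the placed points. Since the points take
-- both values in every free coordinate, the fixed coordinates are those where the placed points are
-- constant; that constant is the bit, and the entry of the sign vector there is the second label.
face-determined : ∀ {k n} {I : Set} → I → (g : I → Vertex k) →
  (∀ i → (∃ λ x → lookup (g x) i ≡ true) × (∃ λ x → lookup (g x) i ≡ false)) →
  (φ ψ : Face Labels k n) (s : Vec Bool k) (t : Bool) →
  signs φ s t ≡ signs ψ s t → (∀ x → embed proj₁ φ (g x) ≡ embed proj₁ ψ (g x)) → φ ≡ ψ
face-determined o g full done done s t _ _ = refl
face-determined o g full (free φ) (free ψ) (c ∷ s) t eq h =
  cong free (face-determined o (Vec.tail ∘ g) full′ φ ψ s t (VP.∷-injectiveʳ eq) h′)
  where
  tail-lookup : ∀ {k} (v : Vertex (suc k)) i → lookup (Vec.tail v) i ≡ lookup v (suc i)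
  tail-lookup (_ ∷ _) i = refl
  full′ : ∀ i → (∃ λ x → lookup (Vec.tail (g x)) i ≡ true) × (∃ λ x → lookup (Vec.tail (g x)) i ≡ false)
  full′ i with full (suc i)
  ... | (x , p) , (y , q) = (x , trans (tail-lookup (g x) i) p) , (y , trans (tail-lookup (g y) i) q)
  h′ : ∀ x → embed proj₁ φ (Vec.tail (g x)) ≡ embed proj₁ ψ (Vec.tail (g x))
  h′ x with g x | h x
  ... | _ ∷ _ | e = VP.∷-injectiveʳ e
face-determined o g full (fix (b , c) φ) (fix (b′ , c′) ψ) s t eq h with VP.∷-injective eq | VP.∷-injectiveˡ (h o)
... | refl , eq′ | refl = cong (fix (b , c)) (face-determined o g full φ ψ s (b xor t) eq′ (VP.∷-injectiveʳ ∘ h))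
face-determined o g full (free φ) (fix (b , c) ψ) s t _ h = ⊥-elim (clash (full zero))
  where
  head≡ : ∀ x → lookup (g x) zero ≡ b
  head≡ x with g x | h x
  ... | _ ∷ _ | e = VP.∷-injectiveˡ e
  clash : (∃ λ x → lookup (g x) zero ≡ true) × (∃ λ x → lookup (g x) zero ≡ false) → ⊥
  clash ((x , p) , (y , q)) with trans (sym p) (trans (head≡ x) (trans (sym (head≡ y)) q))
  ... | ()
face-determined o g full (fix (b , c) φ) (free ψ) s t _ h = ⊥-elim (clash (full zero))
  where
  head≡ : ∀ x → lookup (g x) zero ≡ b
  head≡ x with g x | h x
  ... | _ ∷ _ | e = sym (VP.∷-injectiveˡ e)
  clash : (∃ λ x → lookup (g x) zero ≡ true) × (∃ λ x → lookup (g x) zero ≡ false) → ⊥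
  clash ((x , p) , (y , q)) with trans (sym p) (trans (head≡ x) (trans (sym (head≡ y)) q))
  ... | ()

Full : ∀ {k} → List (Vertex k) → Set
Full vs = ∀ i → Any (λ v → lookup v i ≡ true) vs × Any (λ v → lookup v i ≡ false) vs

labels : List Labels
labels = cartesianProduct bools bools

map-≡-on : {A B : Set} {f g : A → B} (xs : List A) → map f xs ≡ map g xs → ∀ {x} → x ∈ xs → f x ≡ g x
map-≡-on (x ∷ xs) eq (here refl) = LP.∷-injectiveˡ eq
map-≡-on (x ∷ xs) eq (there p) = map-≡-on xs (LP.∷-injectiveʳ eq) p

length-concatMap-≤ : {A B : Set} (f : A → List B) (xs : List A) {d : ℕ} → (∀ {x} → x ∈ xs → length (f x) ≤ d) →
  length (concatMap f xs) ≤ length xs * d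
length-concatMap-≤ f [] h = z≤n
length-concatMap-≤ f (x ∷ xs) h = ℕP.≤-trans (ℕP.≤-reflexive (LP.length-++ (f x)))
  (ℕP.+-mono-≤ (h (here refl)) (length-concatMap-≤ f xs (h ∘ there)))

-- Averaging over the layers, without division. Every labelled face places the model cycle `vs` in
-- the layer given by its signs and parity, and different labelled faces give different pairs of
-- sign vector and placed sequence; there are `2 ^ n * 2` layers. Only one traversal of each placed
-- cycle is used, at the cost of a factor `2 * m` when sequences are turned into copies.
faces-in-layers : ∀ {k n m d} {s : Vec Bool k} {p} (vs : List (Vertex k)) → 1 ≤ length vs → length vs ≡ m →
  Inside (layer s p) vs → Full vs → (∀ s′ p′ → length (cyclesIn m (layer {n} s′ p′)) ≤ d) →
  faceCount 4 k n ≤ (2 ^ n * 2) * d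
faces-in-layers {k} {n} {m} {d} {s} {p} vs@(v₀ ∷ _) _ refl ins full bound =
  subst₂ _≤_ (length-allFaces labels k n)
    (cong (_* d) (trans (length-cartesianProductWith _,_ (allVertices n) bools) (cong (_* 2) (length-allVertices n))))
    (ℕP.≤-trans (injection⇒length≤ R (allFaces-unique (UP.cartesianProduct⁺ bools-unique bools-unique) k n) tot (λ {φ} {ψ} {y} → inj {φ} {ψ} {y}))
      (length-concatMap-≤ placed (cartesianProduct (allVertices n) bools)
        (λ {sp} _ → ℕP.≤-trans (ℕP.≤-reflexive (LP.length-map (sp ,_) (cyclesIn m (layer (proj₁ sp) (proj₂ sp))))) (bound (proj₁ sp) (proj₂ sp)))))
  where
  placed : Vec Bool n × Bool → List ((Vec Bool n × Bool) × List (Vertex n))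
  placed (s′ , p′) = map ((s′ , p′) ,_) (cyclesIn m (layer s′ p′))
  R : Face Labels k n → (Vec Bool n × Bool) × List (Vertex n) → Set
  R φ ((s′ , _) , ws) = s′ ≡ signs φ s false × ws ≡ map (embed proj₁ φ) vs
  tot : ∀ {φ} → φ ∈ allFaces labels k n → ∃ λ y → y ∈ concatMap placed (cartesianProduct (allVertices n) bools) × R φ y
  tot {φ} _ = _ , ∈-concatMap-intro placed (∈-cartesianProduct⁺ (∈-allVertices s′) (∈-bools p′))
      (∈-map⁺ ((s′ , p′) ,_) (∈-cyclesIn⁺ (LP.length-map (embed proj₁ φ) vs)
        (inside-map {S = layer s p} (embed proj₁ φ) (embed-injective proj₁ φ) (embed-layer φ) ins)))
    , refl , refl
    where
    s′ = signs φ s false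
    p′ = fixedParity φ xor p
  inj : ∀ {φ ψ y} → φ ∈ allFaces labels k n → ψ ∈ allFaces labels k n → R φ y → R ψ y → φ ≡ ψ
  inj {φ} {ψ} _ _ (eq , eq′) (eq₁ , eq₁′) =
    face-determined {I = ∃ λ v → v ∈ vs} (v₀ , here refl) proj₁ both φ ψ s false (trans (sym eq) eq₁)
      (λ { (v , v∈) → map-≡-on vs (trans (sym eq′) eq₁′) v∈ })
    where
    both : ∀ i → (∃ λ (x : ∃ λ v → v ∈ vs) → lookup (proj₁ x) i ≡ true) × (∃ λ (x : ∃ λ v → v ∈ vs) → lookup (proj₁ x) i ≡ false)
    both i with find (proj₁ (full i)) | find (proj₂ (full i))
    ... | v , v∈ , q | w , w∈ , r = ((v , v∈) , q) , ((w , w∈) , r)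

-- The extremal number and cycle-free graphs

free-copies≤ex : ∀ {n} a b {S : List (Edge n)} → S ∈ sublists (edgesQ n) → N-C b S ≡ 0 → N-C a S ≤ exQ n a b
free-copies≤ex {n} a b {S} S∈ zero-b = go (sublists (edgesQ n)) S∈
  where
  val : List (Edge n) → ℕ
  val S = if N-C b S ≡ᵇ 0 then N-C a S else 0
  go : ∀ Ss → S ∈ Ss → N-C a S ≤ foldr _⊔_ 0 (map val Ss)
  go (_ ∷ Ss) (here refl) rewrite zero-b = ℕP.m≤m⊔n _ _
  go (T ∷ Ss) (there p) = ℕP.≤-trans (go Ss p) (ℕP.m≤n⊔m (val T) _)

ex-induction : ∀ {n} a b (P : ℕ → Set) → P 0 →
  (∀ {S : List (Edge n)} → S ∈ sublists (edgesQ n) → N-C b S ≡ 0 → P (N-C a S)) → P (exQ n a b)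
ex-induction {n} a b P p₀ h = go (sublists (edgesQ n)) h
  where
  val : List (Edge n) → ℕ
  val S = if N-C b S ≡ᵇ 0 then N-C a S else 0
  value : ∀ S c → N-C b S ≡ c → (N-C b S ≡ 0 → P (N-C a S)) → P (if c ≡ᵇ 0 then N-C a S else 0)
  value S zero eq h′ = h′ eq
  value S (suc c) eq h′ = p₀
  go : ∀ Ss → (∀ {S} → S ∈ Ss → N-C b S ≡ 0 → P (N-C a S)) → P (foldr _⊔_ 0 (map val Ss))
  go [] _ = p₀
  go (S ∷ Ss) h′ with ℕP.⊔-sel (val S) (foldr _⊔_ 0 (map val Ss))
  ... | inj₁ eq = subst P (sym eq) (value S (N-C b S) refl (h′ (here refl)))
  ... | inj₂ eq = subst P (sym eq) (go Ss (h′ ∘ there))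

empty⇒length≡0 : {A : Set} (xs : List A) → (∀ {x} → x ∈ xs → ⊥) → length xs ≡ 0
empty⇒length≡0 [] h = refl
empty⇒length≡0 (x ∷ xs) h = ⊥-elim (h (here refl))

length≡0⇒empty : {A : Set} {xs : List A} → length xs ≡ 0 → ∀ {x} → x ∈ xs → ⊥
length≡0⇒empty {xs = _ ∷ _} () _

no-cycles⇒N-C≡0 : ∀ {n} m {S : List (Edge n)} → 3 ≤ suc m → Unique S → (∀ {e} → e ∈ S → e ∈ edgesQ n) →
  (∀ {vs} → length vs ≡ suc m → Inside S vs → ⊥) → N-C (suc m) S ≡ 0
no-cycles⇒N-C≡0 m {S} m≥3 u sub none = ℕP.m*n≡0⇒m≡0 (N-C (suc m) S) (2 * suc m)
  (trans (N-C-by-sequences m≥3 u sub) (empty⇒length≡0 (cyclesIn (suc m) S) none′))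
  where
  none′ : ∀ {vs} → vs ∈ cyclesIn (suc m) S → ⊥
  none′ vs∈ = let l , i = ∈-cyclesIn⁻ (suc m) S vs∈ in none l i

N-C≡0⇒no-cycles : ∀ {n} m {S : List (Edge n)} → 3 ≤ m → Unique S → (∀ {e} → e ∈ S → e ∈ edgesQ n) →
  N-C m S ≡ 0 → ∀ {vs} → length vs ≡ m → Inside S vs → ⊥
N-C≡0⇒no-cycles m {S} m≥3 u sub none l i = length≡0⇒empty
  (trans (sym (N-C-by-sequences m≥3 u sub)) (cong (_* (2 * m)) none)) (∈-cyclesIn⁺ {S = S} l i)

3ex≤N : ∀ n m → 5 ≤ m → 3 * exQ n m 6 ≤ N-Q n m
3ex≤N n m m≥5 = ex-induction m 6 (λ e → 3 * e ≤ N-Q n m) z≤n single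
  where
  instance
    2m≢0 : NonZero (2 * m)
    2m≢0 = >-nonZero (ℕP.≤-trans (s≤s z≤n) (ℕP.≤-trans m≥5 (ℕP.m≤m+n m (m + 0))))
  m≥3 = ℕP.≤-trans (s≤s (s≤s (s≤s z≤n))) m≥5
  single : ∀ {S} → S ∈ sublists (edgesQ n) → N-C 6 S ≡ 0 → 3 * N-C m S ≤ N-Q n m
  single {S} S∈ no6 = ℕP.*-cancelʳ-≤ _ _ (2 * m) (begin
    3 * N-C m S * (2 * m)        ≡⟨ ℕP.*-assoc 3 (N-C m S) (2 * m) ⟩
    3 * (N-C m S * (2 * m))      ≡⟨ cong (3 *_) (N-C-by-sequences m≥3 uS sub) ⟩
    3 * length (cyclesIn m S)    ≤⟨ cyclesIn≤third m≥5 sub (N-C≡0⇒no-cycles 6 (s≤s (s≤s (s≤s z≤n))) uS sub no6) ⟩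
    length (cyclesIn m (edgesQ n)) ≡⟨ sym (N-C-by-sequences m≥3 (edgesQ-unique n) id) ⟩
    N-Q n m * (2 * m) ∎)
    where
    open ℕP.≤-Reasoning
    uS = sublist-unique (edgesQ-unique n) S∈
    sub : ∀ {e} → e ∈ S → e ∈ edgesQ n
    sub = ∈-sublists⁻ S∈

-- A cycle in a layer of Q_l

-- The cycle lies in dimension `suc k` and starts with an upward step in coordinate zero followed by
-- a downward step; these two are kept explicit because `extend` replaces them. The edge of the
-- downward step is described from its lower end, in `second`. The leading sign is `false` because
-- nothing precedes coordinate zero.
record ZigZag (k : ℕ) : Set where
  field
    A      : Vertex k
    y      : Fin k
    rest   : List (Vertex (suc k))
    s      : Vec Bool k
    first  : Lower (false ∷ s) false (false ∷ A) zero
    second : Lower (false ∷ s) false (true ∷ flipAt A y) (suc y)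
  cycle : List (Vertex (suc k))
  cycle = (false ∷ A) ∷ (true ∷ A) ∷ (true ∷ flipAt A y) ∷ rest
  field
    len    : length cycle ≡ 2 * suc k
    inside : Inside (layer (false ∷ s) false) cycle
    full   : Full cycle

insert : ∀ {k} → Vertex (suc k) → Vertex (suc (suc (suc k)))
insert (b ∷ r) = false ∷ b ∷ false ∷ r

insert-injective : ∀ {k} {v w : Vertex (suc k)} → insert v ≡ insert w → v ≡ w
insert-injective {v = _ ∷ _} {_ ∷ _} refl = refl

joined-lower : ∀ {n} (s : Vec Bool n) p {v} i → Lower s p v i → Joined (layer s p) v (flipAt v i)
joined-lower s p {v} i l = (v , i) , ∈-layer⁺ l , inj₁ (refl , refl)

-- The two inserted bits are `false`, so neither the parity of a vertex nor the parity before an old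
-- coordinate changes.
insert-joined : ∀ {k} {s : Vec Bool k} {x y : Vertex (suc k)} → Joined (layer (false ∷ s) false) x y →
  Joined (layer (false ∷ false ∷ true ∷ s) false) (insert x) (insert y)
insert-joined {s = s} ((b ∷ r , i) , e∈ , j) = go i (∈-layer⁻ {s = false ∷ s} {false} e∈) j
  where
  s′ = false ∷ false ∷ true ∷ s
  ends : ∀ {i i′ x y} → insert (flipAt (b ∷ r) i) ≡ flipAt (insert (b ∷ r)) i′ → Lower s′ false (insert (b ∷ r)) i′ →
    Joins (b ∷ r , i) x y → Joined (layer s′ false) (insert x) (insert y)
  ends eq l (inj₁ (refl , refl)) = _ , ∈-layer⁺ l , inj₁ (refl , eq)
  ends eq l (inj₂ (refl , refl)) = _ , ∈-layer⁺ l , inj₂ (refl , eq)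
  go : ∀ i {x y} → Lower (false ∷ s) false (b ∷ r) i → Joins (b ∷ r , i) x y → Joined (layer s′ false) (insert x) (insert y)
  go zero (lower z q _) = ends {i = zero} {suc zero} refl (lower z q refl)
  go (suc i) (lower z q h) = ends {i = suc i} {suc (suc (suc i))} refl (lower z q h)

-- With p, x, q the first three coordinates, the steps +x −y of the old cycle become +p −y +q −p +x −q.
extend : ∀ {k} → ZigZag k → ZigZag (suc (suc k))
extend {k} Z = record
  { A = false ∷ false ∷ A ; y = suc (suc y) ; rest = w₃ ∷ w₄ ∷ w₅ ∷ map insert old ; s = false ∷ true ∷ s
  ; first = lower refl (par first) refl
  ; second = lower (zeroAt second) (par second) (before second)
  ; len = trans (cong (6 +_) (LP.length-map insert old)) (trans (cong (4 +_) len) (sym lenEq))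
  ; inside = unique (proj₁ inside) , joined
  ; full = full′ }
  where
  open ZigZag Z
  -- Both steps in direction q are made while exactly one of p and x is set, whence the sign `true`;
  -- the step in direction x is made while p is `false`.
  s′ = false ∷ false ∷ true ∷ s
  A′ = flipAt A y
  old = (true ∷ A′) ∷ rest
  w₀ = false ∷ false ∷ false ∷ A
  w₁ = true ∷ false ∷ false ∷ A
  w₂ = true ∷ false ∷ false ∷ A′
  w₃ = true ∷ false ∷ true ∷ A′
  w₄ = false ∷ false ∷ true ∷ A′
  w₅ = false ∷ true ∷ true ∷ A′
  new = w₀ ∷ w₁ ∷ w₂ ∷ w₃ ∷ w₄ ∷ w₅ ∷ map insert old
  lenEq : 2 * suc (suc (suc k)) ≡ 4 + 2 * suc k
  lenEq = trans (ℕP.*-suc 2 (suc (suc k))) (cong (2 +_) (ℕP.*-suc 2 (suc k)))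
  fresh : ∀ {w} → (∀ v → w ≢ insert v) → All (w ≢_) (map insert old)
  fresh h = AllP.map⁺ (All.tabulate (λ {v} _ → h v))
  unique : Unique cycle → Unique new
  unique ((c₀≢c₁ ∷ c₀≢c₂ ∷ c₀∉) ∷ (c₁≢c₂ ∷ _) ∷ u) =
    ((λ ()) ∷ (λ ()) ∷ (λ ()) ∷ (λ ()) ∷ (λ ()) ∷ AllP.map⁺ (All.map (λ c₀≢ eq → c₀≢ (insert-injective {v = false ∷ A} eq)) (c₀≢c₂ ∷ c₀∉)))
    ∷ ((λ eq → c₁≢c₂ (cong (true ∷_) (VP.∷-injectiveʳ (VP.∷-injectiveʳ (VP.∷-injectiveʳ eq))))) ∷ (λ ()) ∷ (λ ()) ∷ (λ ()) ∷ fresh (λ { (_ ∷ _) () }))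
    ∷ ((λ ()) ∷ (λ ()) ∷ (λ ()) ∷ fresh (λ { (_ ∷ _) () }))
    ∷ ((λ ()) ∷ (λ ()) ∷ fresh (λ { (_ ∷ _) () }))
    ∷ ((λ ()) ∷ fresh (λ { (_ ∷ _) () }))
    ∷ fresh (λ { (_ ∷ _) () })
    ∷ UP.map⁺ insert-injective u
  old-step : ∀ {a b} → (a , b) ∈ zip (map insert old) (map insert rest ++ [ insert (false ∷ A) ]) → Joined (layer s′ false) a b
  old-step p with ∈-map⁻ _ (subst (_ ∈_) mapped p)
    where
    mapped : zip (map insert old) (map insert rest ++ [ insert (false ∷ A) ]) ≡ map (λ q → insert (proj₁ q) , insert (proj₂ q)) (zip old (rest ++ [ false ∷ A ]))
    mapped = trans (cong (zip (map insert old)) (sym (LP.map-++ insert rest [ false ∷ A ])))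
      (trans (LP.zipWith-map _,_ insert insert old (rest ++ [ false ∷ A ])) (sym (LP.map-zipWith _,_ _ old (rest ++ [ false ∷ A ]))))
  ... | _ , q , refl = insert-joined (proj₂ inside (there (there q)))
  up : ∀ {v} i → Lower s′ false v i → Joined (layer s′ false) v (flipAt v i)
  up = joined-lower s′ false
  joined : ∀ {a b} → (a , b) ∈ cycPairs new → Joined (layer s′ false) a b
  joined (here refl) = up zero (lower refl (par first) refl)
  joined (there (here refl)) = joined-sym (subst (λ v → Joined (layer s′ false) w₂ (true ∷ false ∷ false ∷ v)) (flipAt-involutive A y)
    (up (suc (suc (suc y))) (lower (zeroAt second) (par second) (before second))))
  joined (there (there (here refl))) = up (suc (suc zero)) (lower refl (par second) refl)
  joined (there (there (there (here refl)))) = joined-sym (up zero (lower refl (par second) refl))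
  joined (there (there (there (there (here refl))))) = up (suc zero) (lower refl (par second) refl)
  joined (there (there (there (there (there (here refl)))))) = joined-sym (up (suc (suc zero)) (lower refl (par second) refl))
  joined (there (there (there (there (there (there p)))))) = old-step p
  -- `w₀` and `w₁` carry the tail `A` of the first two old vertices, and the remaining old vertices
  -- survive under `insert`.
  transfer : ∀ {j b} → Any (λ v → lookup v (suc j) ≡ b) cycle → Any (λ v → lookup v (suc (suc (suc j))) ≡ b) new
  transfer (here p) = here p
  transfer (there (here p)) = here p
  transfer {j} {b} (there (there p)) = there (there (there (there (there (there (AnyP.map⁺ (Any.map (λ {v} → keep v) p)))))))
    where
    keep : ∀ v → lookup v (suc j) ≡ b → lookup (insert v) (suc (suc (suc j))) ≡ b
    keep (_ ∷ _) p = p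
  full′ : Full new
  full′ zero = there (here refl) , here refl
  full′ (suc zero) = there (there (there (there (there (here refl))))) , here refl
  full′ (suc (suc zero)) = there (there (there (here refl))) , here refl
  full′ (suc (suc (suc j))) = transfer (proj₁ (full (suc j))) , transfer (proj₂ (full (suc j)))


full? : ∀ {k} (vs : List (Vertex k)) → Dec (Full vs)
full? vs = FP.all? (λ i → Any.any? (λ v → lookup v i B.≟ true) vs ×-dec Any.any? (λ v → lookup v i B.≟ false) vs)

private
  O I : Bool
  O = false
  I = true

-- `extend` raises the dimension by two, so one explicit cycle is needed for each parity: this one
-- in dimension 4 and the next in dimension 5. The layer condition and fullness are checked by
-- evaluation.
zigZag₄ : ZigZag 3
zigZag₄ = record
  { A = I ∷ O ∷ I ∷ [] ; y = zero ; s = I ∷ I ∷ O ∷ [] ; rest = rest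
  ; first = lower refl refl refl ; second = lower refl refl refl ; len = refl
  ; inside = inside⁻ (layer (O ∷ I ∷ I ∷ O ∷ []) O) cycle _ ; full = toWitness {a? = full? cycle} _ }
  where
  rest = (I ∷ O ∷ I ∷ I ∷ []) ∷ (I ∷ O ∷ I ∷ O ∷ []) ∷ (I ∷ I ∷ I ∷ O ∷ []) ∷ (O ∷ I ∷ I ∷ O ∷ []) ∷ (O ∷ I ∷ I ∷ I ∷ []) ∷ []
  cycle = (O ∷ I ∷ O ∷ I ∷ []) ∷ (I ∷ I ∷ O ∷ I ∷ []) ∷ (I ∷ O ∷ O ∷ I ∷ []) ∷ rest

zigZag₅ : ZigZag 4
zigZag₅ = record
  { A = I ∷ I ∷ O ∷ O ∷ [] ; y = zero ; s = I ∷ I ∷ O ∷ O ∷ [] ; rest = rest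
  ; first = lower refl refl refl ; second = lower refl refl refl ; len = refl
  ; inside = inside⁻ (layer (O ∷ I ∷ I ∷ O ∷ O ∷ []) O) cycle _ ; full = toWitness {a? = full? cycle} _ }
  where
  rest = (I ∷ O ∷ I ∷ I ∷ O ∷ []) ∷ (I ∷ O ∷ O ∷ I ∷ O ∷ []) ∷ (I ∷ I ∷ O ∷ I ∷ O ∷ []) ∷ (I ∷ I ∷ O ∷ O ∷ O ∷ [])
    ∷ (I ∷ I ∷ O ∷ O ∷ I ∷ []) ∷ (O ∷ I ∷ O ∷ O ∷ I ∷ []) ∷ (O ∷ I ∷ I ∷ O ∷ I ∷ []) ∷ []
  cycle = (O ∷ I ∷ I ∷ O ∷ O ∷ []) ∷ (I ∷ I ∷ I ∷ O ∷ O ∷ []) ∷ (I ∷ O ∷ I ∷ O ∷ O ∷ []) ∷ rest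

zigZag : ∀ {k} → 3 ≤ k → ZigZag k
zigZag {suc zero} (s≤s ())
zigZag {suc (suc zero)} (s≤s (s≤s ()))
zigZag {suc (suc (suc zero))} _ = zigZag₄
zigZag {suc (suc (suc (suc zero)))} _ = zigZag₅
zigZag {suc (suc (suc (suc (suc k))))} _ = extend (zigZag (s≤s (s≤s (s≤s z≤n))))

-- Arithmetic

-- After division by the binomial coefficient, for `k ≤ n`, this says that 4^(n-k) 2^k and 2^(n-k)
-- 2^n agree.
faceCount-labels : ∀ k n → faceCount 4 k n * 2 ^ k ≡ faceCount 2 k n * 2 ^ n
faceCount-labels zero zero = refl
faceCount-labels (suc k) zero = refl
faceCount-labels zero (suc n) = begin
  4 * a * 1              ≡⟨ solve 1 (λ a → con 4 :* a :* con 1 := con 4 :* (a :* con 1)) refl a ⟩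
  4 * (a * 1)            ≡⟨ cong (4 *_) (faceCount-labels zero n) ⟩
  4 * (b * 2 ^ n)        ≡⟨ solve 2 (λ b c → con 4 :* (b :* c) := con 2 :* b :* (con 2 :* c)) refl b (2 ^ n) ⟩
  2 * b * 2 ^ suc n      ∎
  where
  open ≡-Reasoning
  open +-*-Solver
  a = faceCount 4 zero n
  b = faceCount 2 zero n
faceCount-labels (suc k) (suc n) = begin
  (a + 4 * a′) * (2 * 2 ^ k)               ≡⟨ solve 3 (λ a a′ c → (a :+ con 4 :* a′) :* (con 2 :* c) := con 2 :* (a :* c) :+ con 4 :* (a′ :* (con 2 :* c))) refl a a′ (2 ^ k) ⟩
  2 * (a * 2 ^ k) + 4 * (a′ * 2 ^ suc k)   ≡⟨ cong₂ (λ x y → 2 * x + 4 * y) (faceCount-labels k n) (faceCount-labels (suc k) n) ⟩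
  2 * (b * 2 ^ n) + 4 * (b′ * 2 ^ n)       ≡⟨ solve 3 (λ b b′ c → con 2 :* (b :* c) :+ con 4 :* (b′ :* c) := (b :+ con 2 :* b′) :* (con 2 :* c)) refl b b′ (2 ^ n) ⟩
  (b + 2 * b′) * 2 ^ suc n                 ∎
  where
  open ≡-Reasoning
  open +-*-Solver
  a = faceCount 4 k n
  a′ = faceCount 4 (suc k) n
  b = faceCount 2 k n
  b′ = faceCount 2 (suc k) n

-- (n − k) faceCount 2 k n = 2 (k + 1) faceCount 2 (k + 1) n, without subtraction.
faceCount-suc : ∀ k n → faceCount 2 k n * n ≡ faceCount 2 k n * k + 2 * suc k * faceCount 2 (suc k) n
faceCount-suc zero zero = refl
faceCount-suc (suc k) zero = sym (ℕP.*-zeroʳ (2 * suc (suc k)))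
faceCount-suc zero (suc n) = begin
  2 * a * suc n                          ≡⟨ solve 2 (λ a n → con 2 :* a :* (con 1 :+ n) := con 2 :* (a :* n) :+ con 2 :* a) refl a n ⟩
  2 * (a * n) + 2 * a                    ≡⟨ cong (λ x → 2 * x + 2 * a) (faceCount-suc zero n) ⟩
  2 * (a * 0 + 2 * 1 * b) + 2 * a        ≡⟨ solve 2 (λ a b → con 2 :* (a :* con 0 :+ con 2 :* b) :+ con 2 :* a := con 2 :* a :* con 0 :+ con 2 :* (a :+ con 2 :* b)) refl a b ⟩
  2 * a * 0 + 2 * 1 * (a + 2 * b)        ∎
  where
  open ≡-Reasoning
  open +-*-Solver
  a = faceCount 2 zero n
  b = faceCount 2 1 n
faceCount-suc (suc k) (suc n) = begin
  (a + 2 * b) * suc n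
    ≡⟨ solve 3 (λ a b n → (a :+ con 2 :* b) :* (con 1 :+ n) := a :* n :+ con 2 :* (b :* n) :+ (a :+ con 2 :* b)) refl a b n ⟩
  a * n + 2 * (b * n) + (a + 2 * b)
    ≡⟨ cong₂ (λ x y → x + 2 * y + (a + 2 * b)) (faceCount-suc k n) (faceCount-suc (suc k) n) ⟩
  (a * k + 2 * suc k * b) + 2 * (b * suc k + 2 * suc (suc k) * c) + (a + 2 * b)
    ≡⟨ solve 4 (λ a b c k → (a :* k :+ con 2 :* (con 1 :+ k) :* b) :+ con 2 :* (b :* (con 1 :+ k) :+ con 2 :* (con 2 :+ k) :* c) :+ (a :+ con 2 :* b)
         := (a :+ con 2 :* b) :* (con 1 :+ k) :+ con 2 :* (con 2 :+ k) :* (b :+ con 2 :* c)) refl a b c k ⟩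
  (a + 2 * b) * suc k + 2 * suc (suc k) * (b + 2 * c) ∎
  where
  open ≡-Reasoning
  open +-*-Solver
  a = faceCount 2 k n
  b = faceCount 2 (suc k) n
  c = faceCount 2 (suc (suc k)) n

-- Passing from dimension `k` to `suc k` multiplies the number of faces by (n - k) / (2 (k + 1)),
-- which exceeds any constant for large `n`. This makes the cycles in smaller faces negligible.
faceCount-growth : ∀ k n c → k + 2 * suc k * c ≤ n → faceCount 2 k n * c ≤ faceCount 2 (suc k) n
faceCount-growth k n c le = ℕP.*-cancelˡ-≤ (2 * suc k) (ℕP.+-cancelˡ-≤ (a * k) _ _ (begin
  a * k + 2 * suc k * (a * c)   ≡⟨ solve 3 (λ a k c → a :* k :+ con 2 :* (con 1 :+ k) :* (a :* c) := a :* (k :+ con 2 :* (con 1 :+ k) :* c)) refl a k c ⟩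
  a * (k + 2 * suc k * c)       ≤⟨ ℕP.*-monoʳ-≤ a le ⟩
  a * n                         ≡⟨ faceCount-suc k n ⟩
  a * k + 2 * suc k * faceCount 2 (suc k) n ∎))
  where
  open ℕP.≤-Reasoning
  open +-*-Solver
  a = faceCount 2 k n

faceCount-positive : ∀ k n → k ≤ n → 1 ≤ faceCount 2 k n
faceCount-positive zero zero _ = s≤s z≤n
faceCount-positive zero (suc n) _ = ℕP.≤-trans (faceCount-positive zero n z≤n) (ℕP.m≤m+n _ _)
faceCount-positive (suc k) (suc n) (s≤s le) = ℕP.≤-trans (faceCount-positive k n le) (ℕP.m≤m+n _ _)

-- The left side is the number of traversals of a 2l-cycle. The induction starts from the equality
-- at `l` = 4.
4l≤2^l : ∀ {l} → 4 ≤ l → 4 * l ≤ 2 ^ l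
4l≤2^l {l} 4≤l with ℕP.m≤n⇒∃[o]m+o≡n 4≤l
... | d , refl = go d
  where
  open ℕP.≤-Reasoning
  go : ∀ d → 4 * (4 + d) ≤ 2 ^ (4 + d)
  go zero = ℕP.≤-refl
  go (suc d) = begin
    4 * suc (4 + d)           ≡⟨ ℕP.*-suc 4 (4 + d) ⟩
    4 + 4 * (4 + d)           ≤⟨ ℕP.+-monoˡ-≤ (4 * (4 + d)) (ℕP.*-monoʳ-≤ 4 (s≤s {n = 3 + d} z≤n)) ⟩
    4 * (4 + d) + 4 * (4 + d) ≤⟨ ℕP.+-mono-≤ (go d) (go d) ⟩
    2 ^ (4 + d) + 2 ^ (4 + d) ≡⟨ cong (λ x → 2 ^ (4 + d) + x) (sym (ℕP.+-identityʳ _)) ⟩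
    2 ^ (5 + d)               ∎

-- From inequalities of natural numbers to rational ones

fraction-≤ : ∀ a b c d → a * suc d ≤ c * suc b → (ℤ.+ a) Q./ suc b Q.≤ (ℤ.+ c) Q./ suc d
fraction-≤ a b c d le = QP.toℚᵘ-cancel-≤
  (QᵘP.≤-respˡ-≃ (QᵘP.≃-sym (QP.toℚᵘ-fromℚᵘ (Qᵘ.mkℚᵘ (ℤ.+ a) b)))
    (QᵘP.≤-respʳ-≃ (QᵘP.≃-sym (QP.toℚᵘ-fromℚᵘ (Qᵘ.mkℚᵘ (ℤ.+ c) d)))
      (Qᵘ.*≤* (subst₂ ℤ._≤_ (ℤP.pos-* a (suc d)) (ℤP.pos-* c (suc b)) (ℤ.+≤+ le)))))

inv≤ : ∀ q r → 0ℚ Q.≤ r → 0ℚ Q.< q → 1ℚ Q.≤ r Q.* q → inv q Q.≤ r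
inv≤ q r 0≤r 0<q le with q Q.≟ 0ℚ
... | yes _ = 0≤r
... | no q≢0 = QP.*-cancelʳ-≤-pos q {{Q.positive 0<q}} (subst (Q._≤ r Q.* q) (sym (QP.*-inverseˡ q {{Q.≢-nonZero q≢0}})) le)

inv≤ratio : ∀ c x y → 1 ≤ y → y ≤ c * x → inv ((ℤ.+ c) Q./ 1) Q.≤ ratio x y
inv≤ratio zero x (suc y) _ ()
inv≤ratio c@(suc c′) x (suc y) _ le = inv≤ ((ℤ.+ c) Q./ 1) ((ℤ.+ x) Q./ suc y) (fraction-≤ 0 0 x y z≤n) positive one≤
  where
  open QP using (toℚᵘ-fromℚᵘ)
  positive : 0ℚ Q.< (ℤ.+ c) Q./ 1
  positive = QP.toℚᵘ-cancel-< (QᵘP.<-respʳ-≃ (QᵘP.≃-sym (toℚᵘ-fromℚᵘ (Qᵘ.mkℚᵘ (ℤ.+ c) 0))) (Qᵘ.*<* (ℤ.+<+ (s≤s z≤n))))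
  product : Q.toℚᵘ ((ℤ.+ x) Q./ suc y Q.* ((ℤ.+ c) Q./ 1)) Qᵘ.≃ Qᵘ.mkℚᵘ (ℤ.+ x) y Qᵘ.* Qᵘ.mkℚᵘ (ℤ.+ c) 0
  product = QᵘP.≃-trans (QP.toℚᵘ-homo-* ((ℤ.+ x) Q./ suc y) ((ℤ.+ c) Q./ 1))
    (QᵘP.*-cong (toℚᵘ-fromℚᵘ (Qᵘ.mkℚᵘ (ℤ.+ x) y)) (toℚᵘ-fromℚᵘ (Qᵘ.mkℚᵘ (ℤ.+ c) 0)))
  one≤ : 1ℚ Q.≤ (ℤ.+ x) Q./ suc y Q.* ((ℤ.+ c) Q./ 1)
  one≤ = QP.toℚᵘ-cancel-≤ (QᵘP.≤-respʳ-≃ (QᵘP.≃-sym product) (Qᵘ.*≤* (subst₂ ℤ._≤_ left right (ℤ.+≤+ le′))))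
    where
    le′ : suc y ≤ x * c
    le′ = subst (suc y ≤_) (ℕP.*-comm c x) le
    left : ℤ.+ suc y ≡ ℤ.+ 1 ℤ.* ℤ.+ (suc y * 1)
    left = trans (cong ℤ.+_ (sym (ℕP.*-identityʳ (suc y)))) (sym (ℤP.*-identityˡ _))
    right : ℤ.+ (x * c) ≡ (ℤ.+ x ℤ.* ℤ.+ c) ℤ.* ℤ.+ 1
    right = trans (ℤP.pos-* x c) (sym (ℤP.*-identityʳ _))

ratio≤ : ∀ x y → 3 * x ≤ y → ratio x y Q.≤ (ℤ.+ 36577) Q./ 100000
ratio≤ x zero _ = fraction-≤ 0 0 36577 99999 z≤n
ratio≤ x (suc y) le = fraction-≤ x y 36577 99999 (begin
  -- 109731 is 3 * 36577: the density 1/3 lies below 0.36577.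
  x * 100000       ≤⟨ ℕP.*-monoʳ-≤ x (ℕP.≤ᵇ⇒≤ 100000 109731 _) ⟩
  x * 109731       ≡⟨ solve 1 (λ x → x :* con 109731 := con 36577 :* (con 3 :* x)) refl x ⟩
  36577 * (3 * x)  ≤⟨ ℕP.*-monoʳ-≤ 36577 le ⟩
  36577 * suc y    ∎)
  where
  open ℕP.≤-Reasoning
  open +-*-Solver

-- Assembly of the two bounds

5≤2l : ∀ {k} → 3 ≤ k → 5 ≤ 2 * suc k
5≤2l {k} 3≤k = ℕP.+-mono-≤ (s≤s 3≤k) (s≤s {n = k + 0} z≤n)

-- The factors 2 and `2 ^ suc k` together are the reciprocal of the proportion of layers that
-- contain a given placed model cycle; the factor `2 * m` counts the traversals of a copy.
layers-bound : ∀ {k} n → 3 ≤ k → let m = 2 * suc k in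
  faceCount 2 (suc k) n ≤ 2 * (exQ n m 6 * (2 * m)) * 2 ^ suc k
layers-bound {k} n 3≤k = ℕP.*-cancelʳ-≤ _ _ (2 ^ n) {{>-nonZero (ℕP.m^n>0 2 n)}} (begin
  faceCount 2 (suc k) n * 2 ^ n        ≡⟨ sym (faceCount-labels (suc k) n) ⟩
  faceCount 4 (suc k) n * 2 ^ suc k    ≤⟨ ℕP.*-monoˡ-≤ (2 ^ suc k) (faces-in-layers {n = n} {s = false ∷ s} {false} cycle (s≤s z≤n) len inside full bound) ⟩
  2 ^ n * 2 * d * 2 ^ suc k            ≡⟨ solve 3 (λ a d b → a :* con 2 :* d :* b := con 2 :* d :* b :* a) refl (2 ^ n) d (2 ^ suc k) ⟩
  2 * d * 2 ^ suc k * 2 ^ n            ∎)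
  where
  open ℕP.≤-Reasoning
  open +-*-Solver
  open ZigZag (zigZag 3≤k)
  m = 2 * suc k
  d = exQ n m 6 * (2 * m)
  m≥3 : 3 ≤ m
  m≥3 = ℕP.≤-trans (s≤s (s≤s (s≤s z≤n))) (5≤2l 3≤k)
  bound : ∀ s′ p′ → length (cyclesIn m (layer {n} s′ p′)) ≤ d
  bound s′ p′ = ℕP.≤-trans (ℕP.≤-reflexive (sym (N-C-by-sequences m≥3 (layer-unique s′ p′) (layer⊆edgesQ {s = s′} {p′}))))
    (ℕP.*-monoˡ-≤ (2 * m) (free-copies≤ex m 6 (filterᵇ∈sublists (layerᵇ s′ p′) (edgesQ n))
      (no-cycles⇒N-C≡0 5 (s≤s (s≤s (s≤s z≤n))) (layer-unique s′ p′) (layer⊆edgesQ {s = s′} {p′}) (layer-hexagon-free s′ p′))))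

-- The summand `suc k` ensures that a face of that dimension exists; the other one lets
-- `faceCount-growth` pay for every vertex sequence in the smaller faces.
threshold : ℕ → ℕ
threshold k = suc k + 2 * suc k * length (vertexSeqs k (2 * suc k))

-- Beyond the threshold the sequences in smaller faces number at most one for each face of dimension
-- `suc k`. As `z` is at least 1, they are no more than the main term, which is therefore doubled.
copies-bound : ∀ {k} n → 3 ≤ k → threshold k ≤ n → 1 ≤ z (suc k) (suc k) →
  N-Q n (2 * suc k) ≤ 2 * faceCount 2 (suc k) n * z (suc k) (suc k)
copies-bound {k} n 3≤k n≥ z≥1 = ℕP.*-cancelʳ-≤ _ _ (2 * m) (begin
  N-Q n m * (2 * m)                                ≡⟨ N-C-by-sequences m≥3 (edgesQ-unique n) id ⟩
  length (cyclesIn m (edgesQ n))                   ≤⟨ cycles-covered-by-faces k≤n ⟩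
  f * length (fullCycles (suc k) m) + f′ * c       ≡⟨ cong (λ x → f * x + f′ * c) (sym (copies-by-sequences allDirections m≥3 (edgesQ-unique (suc k)) id)) ⟩
  f * (z (suc k) (suc k) * (2 * m)) + f′ * c       ≤⟨ ℕP.+-monoʳ-≤ (f * (z (suc k) (suc k) * (2 * m))) (faceCount-growth k n c grow) ⟩
  f * (z (suc k) (suc k) * (2 * m)) + f            ≤⟨ ℕP.+-monoʳ-≤ (f * (z (suc k) (suc k) * (2 * m))) absorb ⟩
  f * (z (suc k) (suc k) * (2 * m)) + f * (z (suc k) (suc k) * (2 * m))
    ≡⟨ solve 3 (λ f z m → f :* (z :* m) :+ f :* (z :* m) := con 2 :* f :* z :* m) refl f (z (suc k) (suc k)) (2 * m) ⟩
  2 * f * z (suc k) (suc k) * (2 * m) ∎)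
  where
  open ℕP.≤-Reasoning
  open +-*-Solver
  m = 2 * suc k
  f = faceCount 2 (suc k) n
  f′ = faceCount 2 k n
  c = length (vertexSeqs k m)
  m≥3 : 3 ≤ m
  m≥3 = ℕP.≤-trans (s≤s (s≤s (s≤s z≤n))) (5≤2l 3≤k)
  grow : k + 2 * suc k * c ≤ n
  grow = ℕP.<⇒≤ n≥
  k≤n : k ≤ n
  k≤n = ℕP.≤-trans (ℕP.m≤m+n k _) grow
  absorb : f ≤ f * (z (suc k) (suc k) * (2 * m))
  absorb = ℕP.≤-trans (ℕP.≤-reflexive (sym (ℕP.*-identityʳ f))) (ℕP.*-monoʳ-≤ f (ℕP.*-mono-≤ z≥1 (s≤s {m = 0} z≤n)))

-- With l = `suc k`, the losses are 2 for the cycles in smaller faces, 2 * 2^l for the choice of a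
-- layer and 4l for the traversals. By `4l≤2^l` their product is at most 4 * 2^l * 2^l, which is
-- 4^(l+1).
copies≤constant*ex : ∀ {k} n → 3 ≤ k → threshold k ≤ n → 1 ≤ z (suc k) (suc k) →
  N-Q n (2 * suc k) ≤ 4 ^ (suc k + 1) * z (suc k) (suc k) * exQ n (2 * suc k) 6
copies≤constant*ex {k} n 3≤k n≥ z≥1 = begin
  N-Q n (2 * l)                          ≤⟨ copies-bound n 3≤k n≥ z≥1 ⟩
  2 * faceCount 2 l n * w                ≤⟨ ℕP.*-monoˡ-≤ w (ℕP.*-monoʳ-≤ 2 (layers-bound n 3≤k)) ⟩
  2 * (2 * (e * (2 * (2 * l))) * p) * w  ≡⟨ solve 4 (λ e l p w → con 2 :* (con 2 :* (e :* (con 2 :* (con 2 :* l))) :* p) :* w := con 4 :* (con 4 :* l :* p) :* w :* e) refl e l p w ⟩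
  4 * (4 * l * p) * w * e                ≤⟨ ℕP.*-monoˡ-≤ e (ℕP.*-monoˡ-≤ w (ℕP.*-monoʳ-≤ 4 (ℕP.*-monoˡ-≤ p (4l≤2^l (s≤s 3≤k))))) ⟩
  4 * (p * p) * w * e                    ≡⟨ cong (λ x → x * w * e) power ⟩
  4 ^ (l + 1) * w * e                    ∎
  where
  open ℕP.≤-Reasoning
  open +-*-Solver
  l = suc k
  w = z l l
  e = exQ n (2 * l) 6
  p = 2 ^ l
  squares : p * p ≡ 4 ^ l
  squares = trans (sym (ℕP.^-distribˡ-+-* 2 l l)) (trans (cong (λ x → 2 ^ (l + x)) (sym (ℕP.+-identityʳ l))) (sym (ℕP.^-*-assoc 2 2 l)))
  power : 4 * (p * p) ≡ 4 ^ (l + 1)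
  power = trans (cong (4 *_) squares) (cong (4 ^_) (sym (ℕP.+-comm l 1)))

ex-positive : ∀ {k} n → 3 ≤ k → threshold k ≤ n → 1 ≤ exQ n (2 * suc k) 6
ex-positive {k} n 3≤k n≥ = pos (exQ n (2 * suc k) 6) (ℕP.≤-trans (faceCount-positive (suc k) n (ℕP.≤-trans (ℕP.m≤m+n (suc k) _) n≥)) (layers-bound n 3≤k))
  where
  pos : ∀ e → 1 ≤ 2 * (e * (2 * (2 * suc k))) * 2 ^ suc k → 1 ≤ e
  pos (suc e) _ = s≤s z≤n

lower-bound : ∀ {k} n → 3 ≤ k → threshold k ≤ n →
  inv ((ℤ.+ (4 ^ (suc k + 1) * z (suc k) (suc k))) Q./ 1) Q.≤ dQ n (2 * suc k) 6
lower-bound {k} n 3≤k n≥ = by-z (z (suc k) (suc k)) (copies≤constant*ex n 3≤k n≥)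
  where
  e = exQ n (2 * suc k) 6
  N = N-Q n (2 * suc k)
  -- This excludes the default value of `ratio` at denominator zero. It follows from the upper
  -- bound, since the extremal number is positive.
  N≥1 : 1 ≤ N
  N≥1 = ℕP.≤-trans (ex-positive n 3≤k n≥) (ℕP.≤-trans (ℕP.m≤m+n e _) (3ex≤N n (2 * suc k) (5≤2l 3≤k)))
  by-z : ∀ w → (1 ≤ w → N ≤ 4 ^ (suc k + 1) * w * e) → inv ((ℤ.+ (4 ^ (suc k + 1) * w)) Q./ 1) Q.≤ ratio e N
  -- With `w` = 0 the constant is zero and `inv` takes its default `0ℚ`, so it suffices that the
  -- ratio is nonnegative.
  by-z zero _ = subst (λ c → inv ((ℤ.+ c) Q./ 1) Q.≤ ratio e N) (sym (ℕP.*-zeroʳ (4 ^ (suc k + 1)))) (ratio-nonneg e N)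
    where
    ratio-nonneg : ∀ x y → 0ℚ Q.≤ ratio x y
    ratio-nonneg x zero = QP.≤-refl
    ratio-nonneg x (suc y) = fraction-≤ 0 0 x y z≤n
  by-z (suc w) le = inv≤ratio (4 ^ (suc k + 1) * suc w) e N N≥1 (le (s≤s z≤n))

theorem3 : (l : ℕ) → l ≥ 4 →
    Σ (ℕ → ℚ) (λ ε →
    (∀ n → 0ℚ Q.≤ ε n)
    × (∀ δ → 0ℚ Q.< δ → ∃ (λ N → ∀ n → n ≥ N → ε n Q.≤ δ))
    × ∃ (λ N₀ → ∀ n → n ≥ N₀ →
    (inv ((ℤ.+ (4 ^ (l Data.Nat.+ 1) * z l l) Q./ 1) Q.* (1ℚ Q.+ ε n)) Q.≤ dQ n (2 * l) 6)
    × (dQ n (2 * l) 6 Q.≤ (ℤ.+ 36577) Q./ 100000)))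
theorem3 (suc k) (s≤s 3≤k) = (λ _ → 0ℚ) , (λ _ → QP.≤-refl) , (λ δ 0<δ → 0 , λ _ _ → QP.<⇒≤ 0<δ)
  , threshold k , λ n n≥ →
    subst (λ q → inv q Q.≤ dQ n (2 * suc k) 6)
      (sym (QP.*-identityʳ ((ℤ.+ (4 ^ (suc k + 1) * z (suc k) (suc k))) Q./ 1))) (lower-bound n 3≤k n≥)
    , ratio≤ (exQ n (2 * suc k) 6) (N-Q n (2 * suc k)) (3ex≤N n (2 * suc k) (5≤2l 3≤k))
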